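{- Let $f_t(z)=z^2+t\in\mathbb{Q}(t)[z]$, and let $P_t\in\mathbb{Z}[t]$ be a monic polynomial. Then there exists a power series $F(z)\in\mathbb{Q}[[z]]$, convergent in a real neighbourhood of $0$ and satisfying $F(0)=0$, such that for all $t\in\mathbb{Q}$ with $|t|$ sufficiently large, \[\hat h_{f_t}(P_t)=\hat h_f(P)h(t)+F\!\left(\tfrac1t\right).\]
   Context: $h$ is the usual absolute logarithmic Weil height on $\mathbb{P}^1(\mathbb{Q})$. For $t\in\mathbb{Q}$, $\hat h_{f_t}(x)=\lim_{N\to\infty}2^{ -N}h(f_t^N(x))$ is the canonical height of the specialized polynomial. Viewing $f\in K[z]$ and $P\in K$ with $K=\mathbb{Q}(t)$ the function field of $\mathbb{P}^1$, $\hat h_f(P)=\sum_{\beta\in\mathbb{P}^1(\overline{\mathbb{Q}})}\lim_{N\to\infty}2^{ -N}\max\{0,-\operatorname{ord}_\beta(f^N(P))\}$. -}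

module Defs where

open import Algebra.Bundles using (CommutativeRing; RawRing)
open import Algebra.Definitions.RawSemiring using (_^_)
open import Algebra.Morphism.Structures using (module RingMorphisms)
open import Data.Bool.Base using (if_then_else_)
open import Data.Integer.Base as ℤ using (ℤ; +_; 0ℤ; 1ℤ)
import Data.Integer.Properties as ℤ
open import Data.List.Base using (List; []; _∷_; _++_; [_]; map; foldr; last)
import Data.List.Membership.Setoid as Membership
import Data.List.Relation.Unary.Unique.Setoid as Unique
open import Data.Maybe.Base as Maybe using (Maybe; just; nothing)
import Data.Maybe.Relation.Binary.Pointwise as Pointwise
open import Data.Nat.Base as ℕ using (ℕ; zero; suc)
open import Data.Nat.GeneralisedArithmetic using (fold)
import Data.Nat.Properties as ℕ
open import Data.Product.Base using (∃; ∃-syntax; _×_; _,_; proj₁; proj₂)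
open import Data.Rational.Base as ℚ
  using (ℚ; 0ℚ; 1ℚ; ½; _+_; _*_; _-_; -_; 1/_; _/_; ∣_∣; _≤_; _<_; ↥_; ↧ₙ_)
import Data.Rational.Properties as ℚ
import Data.Rational.Unnormalised.Base as ℚᵘ
import Data.Rational.Unnormalised.Properties as ℚᵘ
open import Data.Rational.Solver using (module +-*-Solver)
open import Data.Sum.Base using (inj₁; inj₂)
open import Function.Base using (_⟨_⟩_)
open import Level using (Level; _⊔_) renaming (suc to lsuc)
open import Relation.Binary.Bundles using (Setoid)
open import Relation.Binary.Definitions using (Decidable)
open import Relation.Binary.PropositionalEquality hiding ([_])
open import Relation.Nullary using (¬_; does; yes; no)

open +-*-Solver using (solve; con; _:=_; _:+_; _:*_; _:-_; :-_)

infixr 8 _^ℚ_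
_^ℚ_ : ℚ → ℕ → ℚ
_^ℚ_ = _^_ ℚ.+-*-rawSemiring

fromℤ : ℤ → ℚ
fromℤ i = i / 1

fromℕ : ℕ → ℚ
fromℕ n = fromℤ (+ n)

Eventually : (ℕ → Set) → Set
Eventually A = ∃[ N ] ∀ n → N ℕ.≤ n → A n

Cauchy : (ℕ → ℚ) → Set
Cauchy x = ∀ ε → 0ℚ < ε →
  ∃[ N ] ∀ m n → N ℕ.≤ m → N ℕ.≤ n → ∣ x m - x n ∣ ≤ ε

record ℝ : Set where
  constructor mkℝ
  field
    seq    : ℕ → ℚ
    cauchy : Cauchy seq

open ℝ public

infix 4 _≃_ _≤ʳ_

_≃_ : ℝ → ℝ → Set
x ≃ y = ∀ ε → 0ℚ < ε → Eventually λ n → ∣ seq x n - seq y n ∣ ≤ ε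

_≤ʳ_ : ℝ → ℝ → Set
x ≤ʳ y = ∀ ε → 0ℚ < ε → Eventually λ n → seq x n ≤ seq y n + ε

module CauchyLemmas where

  ∣p-q∣≡∣q-p∣ : ∀ p q → ∣ p - q ∣ ≡ ∣ q - p ∣
  ∣p-q∣≡∣q-p∣ p q = trans (sym (ℚ.∣-p∣≡∣p∣ (p - q)))
    (cong ∣_∣ (solve 2 (λ a b → :- (a :- b) := b :- a) refl p q))

  p≤q∧-p≤q⇒∣p∣≤q : ∀ {p q} → p ≤ q → - p ≤ q → ∣ p ∣ ≤ q
  p≤q∧-p≤q⇒∣p∣≤q {p} p≤q -p≤q with ℚ.∣p∣≡p∨∣p∣≡-p p
  ... | inj₁ e = subst (_≤ _) (sym e) p≤q
  ... | inj₂ e = subst (_≤ _) (sym e) -p≤q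

  ∣p∣-∣q∣≤∣p-q∣ : ∀ p q → ∣ p ∣ - ∣ q ∣ ≤ ∣ p - q ∣
  ∣p∣-∣q∣≤∣p-q∣ p q = begin
    ∣ p ∣ - ∣ q ∣
      ≡⟨ cong (λ u → ∣ u ∣ - ∣ q ∣) (solve 2 (λ a b → a := (a :- b) :+ b) refl p q) ⟩
    ∣ (p - q) + q ∣ - ∣ q ∣
      ≤⟨ ℚ.+-monoˡ-≤ (- ∣ q ∣) (ℚ.∣p+q∣≤∣p∣+∣q∣ (p - q) q) ⟩
    (∣ p - q ∣ + ∣ q ∣) - ∣ q ∣
      ≡⟨ solve 2 (λ a b → (a :+ b) :- b := a) refl ∣ p - q ∣ ∣ q ∣ ⟩
    ∣ p - q ∣ ∎
    where open ℚ.≤-Reasoning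

  0<p*q : ∀ {p q} → 0ℚ < p → 0ℚ < q → 0ℚ < p * q
  0<p*q {p} {q} 0<p 0<q = ℚ.positive⁻¹ (p * q)
    ⦃ ℚ.pos*pos⇒pos p ⦃ ℚ.positive 0<p ⦄ q ⦃ ℚ.positive 0<q ⦄ ⦄

  *-mono-≤ : ∀ {p q r s} → 0ℚ ≤ p → 0ℚ ≤ s → p ≤ q → r ≤ s → p * r ≤ q * s
  *-mono-≤ {p} {q} {r} {s} 0≤p 0≤s p≤q r≤s = ℚ.≤-trans
    (ℚ.*-monoˡ-≤-nonNeg p ⦃ ℚ.nonNegative 0≤p ⦄ r≤s)
    (ℚ.*-monoʳ-≤-nonNeg s ⦃ ℚ.nonNegative 0≤s ⦄ p≤q)

  ½-sum : ∀ ε → ½ * ε + ½ * ε ≡ ε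
  ½-sum = solve 1 (λ e → con ½ :* e :+ con ½ :* e := e) refl

  0<½ : 0ℚ < ½
  0<½ = ℚ.positive⁻¹ ½

  const-cauchy : ∀ q → Cauchy (λ _ → q)
  const-cauchy q ε 0<ε = 0 , λ _ _ _ _ →
    subst (_≤ ε) (sym (cong ∣_∣ (ℚ.+-inverseʳ q))) (ℚ.<⇒≤ 0<ε)

  +-cauchy : ∀ {x y} → Cauchy x → Cauchy y → Cauchy (λ n → x n + y n)
  +-cauchy {x} {y} cx cy ε 0<ε
    with cx (½ * ε) (0<p*q 0<½ 0<ε) | cy (½ * ε) (0<p*q 0<½ 0<ε)
  ... | M , hx | N , hy = M ℕ.⊔ N , λ m n m≥ n≥ → begin
    ∣ (x m + y m) - (x n + y n) ∣
      ≡⟨ cong ∣_∣ (solve 4 (λ a b c d → (a :+ b) :- (c :+ d) := (a :- c) :+ (b :- d))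
           refl (x m) (y m) (x n) (y n)) ⟩
    ∣ (x m - x n) + (y m - y n) ∣
      ≤⟨ ℚ.∣p+q∣≤∣p∣+∣q∣ (x m - x n) (y m - y n) ⟩
    ∣ x m - x n ∣ + ∣ y m - y n ∣
      ≤⟨ ℚ.+-mono-≤ (hx m n (ℕ.m⊔n≤o⇒m≤o M N m≥) (ℕ.m⊔n≤o⇒m≤o M N n≥))
                    (hy m n (ℕ.m⊔n≤o⇒n≤o M N m≥) (ℕ.m⊔n≤o⇒n≤o M N n≥)) ⟩
    ½ * ε + ½ * ε
      ≡⟨ ½-sum ε ⟩
    ε ∎
    where open ℚ.≤-Reasoning

  neg-cauchy : ∀ {x} → Cauchy x → Cauchy (λ n → - x n)
  neg-cauchy {x} cx ε 0<ε with cx ε 0<ε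
  ... | N , h = N , λ m n m≥ n≥ → subst (_≤ ε)
    (cong ∣_∣ (solve 2 (λ a b → b :- a := (:- a) :- (:- b)) refl (x m) (x n)))
    (h n m n≥ m≥)

  abs-cauchy : ∀ {x} → Cauchy x → Cauchy (λ n → ∣ x n ∣)
  abs-cauchy {x} cx ε 0<ε with cx ε 0<ε
  ... | N , h = N , λ m n m≥ n≥ → p≤q∧-p≤q⇒∣p∣≤q
    (ℚ.≤-trans (∣p∣-∣q∣≤∣p-q∣ (x m) (x n)) (h m n m≥ n≥))
    (ℚ.≤-trans (ℚ.≤-reflexive
        (solve 2 (λ a b → :- (a :- b) := b :- a) refl ∣ x m ∣ ∣ x n ∣))
      (ℚ.≤-trans (∣p∣-∣q∣≤∣p-q∣ (x n) (x m)) (h n m n≥ m≥)))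

  bounded : ∀ {x} → Cauchy x → ∃[ B ] 0ℚ < B × Eventually λ n → ∣ x n ∣ ≤ B
  bounded {x} cx with cx 1ℚ (ℚ.positive⁻¹ 1ℚ)
  ... | N , h = ∣ x N ∣ + 1ℚ
    , ℚ.≤-<-trans (ℚ.0≤∣p∣ (x N))
        (subst (_< ∣ x N ∣ + 1ℚ) (ℚ.+-identityʳ ∣ x N ∣)
          (ℚ.+-monoʳ-< ∣ x N ∣ (ℚ.positive⁻¹ 1ℚ)))
    , N , λ n n≥ → begin
      ∣ x n ∣
        ≡⟨ cong ∣_∣ (solve 2 (λ a b → a := b :+ (a :- b)) refl (x n) (x N)) ⟩
      ∣ x N + (x n - x N) ∣
        ≤⟨ ℚ.∣p+q∣≤∣p∣+∣q∣ (x N) (x n - x N) ⟩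
      ∣ x N ∣ + ∣ x n - x N ∣
        ≤⟨ ℚ.+-monoʳ-≤ ∣ x N ∣ (h n N n≥ ℕ.≤-refl) ⟩
      ∣ x N ∣ + 1ℚ ∎
    where open ℚ.≤-Reasoning

  *-close : ∀ a b c d {A B δ} → 0ℚ ≤ δ → 0ℚ ≤ B →
    ∣ a ∣ ≤ A → ∣ d ∣ ≤ B → ∣ a - c ∣ ≤ δ → ∣ b - d ∣ ≤ δ →
    ∣ a * b - c * d ∣ ≤ δ * (A + B)
  *-close a b c d {A} {B} {δ} 0≤δ 0≤B a≤A d≤B ac≤δ bd≤δ = begin
    ∣ a * b - c * d ∣
      ≡⟨ cong ∣_∣ (solve 4 (λ a b c d →
           a :* b :- c :* d := a :* (b :- d) :+ (a :- c) :* d) refl a b c d) ⟩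
    ∣ a * (b - d) + (a - c) * d ∣
      ≤⟨ ℚ.∣p+q∣≤∣p∣+∣q∣ (a * (b - d)) ((a - c) * d) ⟩
    ∣ a * (b - d) ∣ + ∣ (a - c) * d ∣
      ≡⟨ cong₂ _+_ (ℚ.∣p*q∣≡∣p∣*∣q∣ a (b - d)) (ℚ.∣p*q∣≡∣p∣*∣q∣ (a - c) d) ⟩
    ∣ a ∣ * ∣ b - d ∣ + ∣ a - c ∣ * ∣ d ∣
      ≤⟨ ℚ.+-mono-≤
           (*-mono-≤ (ℚ.0≤∣p∣ a) 0≤δ a≤A bd≤δ)
           (*-mono-≤ (ℚ.0≤∣p∣ (a - c)) 0≤B ac≤δ d≤B) ⟩
    A * δ + δ * B
      ≡⟨ solve 3 (λ a b e → a :* e :+ e :* b := e :* (a :+ b)) refl A B δ ⟩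
    δ * (A + B) ∎
    where open ℚ.≤-Reasoning

  divide : ∀ ε C → 0ℚ < ε → 0ℚ < C → ∃[ δ ] 0ℚ < δ × δ * C ≡ ε
  divide ε C 0<ε 0<C = ε * 1/C
    , 0<p*q 0<ε (ℚ.positive⁻¹ 1/C ⦃ ℚ.1/pos⇒pos C ⦃ C-pos ⦄ ⦄)
    , trans (ℚ.*-assoc ε 1/C C)
        (trans (cong (ε *_) (ℚ.*-inverseˡ C ⦃ C-nonZero ⦄)) (ℚ.*-identityʳ ε))
    where
    C-pos : ℚ.Positive C
    C-pos = ℚ.positive 0<C
    C-nonZero : ℚ.NonZero C
    C-nonZero = ℚ.pos⇒nonZero C ⦃ C-pos ⦄
    1/C : ℚ
    1/C = (1/ C) ⦃ C-nonZero ⦄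

  *-cauchy : ∀ {x y} → Cauchy x → Cauchy y → Cauchy (λ n → x n * y n)
  *-cauchy {x} {y} cx cy ε 0<ε = use-bounds (bounded cx) (bounded cy)
    where
    Goal : Set
    Goal = ∃[ N ] ∀ m n → N ℕ.≤ m → N ℕ.≤ n → ∣ x m * y m - x n * y n ∣ ≤ ε

    use-moduli : ∀ A B δ K L → 0ℚ < B → 0ℚ < δ → δ * (A + B) ≡ ε →
      (∀ n → K ℕ.≤ n → ∣ x n ∣ ≤ A) → (∀ n → L ℕ.≤ n → ∣ y n ∣ ≤ B) →
      (∃[ P ] ∀ m n → P ℕ.≤ m → P ℕ.≤ n → ∣ x m - x n ∣ ≤ δ) →
      (∃[ Q ] ∀ m n → Q ℕ.≤ m → Q ℕ.≤ n → ∣ y m - y n ∣ ≤ δ) → Goal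
    use-moduli A B δ K L 0<B 0<δ δ[A+B]≡ε hA hB (P , hx) (Q , hy) =
      (K ℕ.⊔ L) ℕ.⊔ (P ℕ.⊔ Q) , λ m n m≥ n≥ →
        subst (λ u → ∣ x m * y m - x n * y n ∣ ≤ u) δ[A+B]≡ε
          (*-close (x m) (y m) (x n) (y n) {A} {B} {δ}
            (ℚ.<⇒≤ {0ℚ} {δ} 0<δ) (ℚ.<⇒≤ {0ℚ} {B} 0<B)
            (hA m (K≤ (KL≤ m≥))) (hB n (L≤ (KL≤ n≥)))
            (hx m n (P≤ (PQ≤ m≥)) (P≤ (PQ≤ n≥)))
            (hy m n (Q≤ (PQ≤ m≥)) (Q≤ (PQ≤ n≥))))
      where
      KL≤ : ∀ {m} → (K ℕ.⊔ L) ℕ.⊔ (P ℕ.⊔ Q) ℕ.≤ m → K ℕ.⊔ L ℕ.≤ m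
      KL≤ = ℕ.m⊔n≤o⇒m≤o (K ℕ.⊔ L) (P ℕ.⊔ Q)
      PQ≤ : ∀ {m} → (K ℕ.⊔ L) ℕ.⊔ (P ℕ.⊔ Q) ℕ.≤ m → P ℕ.⊔ Q ℕ.≤ m
      PQ≤ = ℕ.m⊔n≤o⇒n≤o (K ℕ.⊔ L) (P ℕ.⊔ Q)
      K≤ : ∀ {m} → K ℕ.⊔ L ℕ.≤ m → K ℕ.≤ m
      K≤ = ℕ.m⊔n≤o⇒m≤o K L
      L≤ : ∀ {m} → K ℕ.⊔ L ℕ.≤ m → L ℕ.≤ m
      L≤ = ℕ.m⊔n≤o⇒n≤o K L
      P≤ : ∀ {m} → P ℕ.⊔ Q ℕ.≤ m → P ℕ.≤ m
      P≤ = ℕ.m⊔n≤o⇒m≤o P Q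
      Q≤ : ∀ {m} → P ℕ.⊔ Q ℕ.≤ m → Q ℕ.≤ m
      Q≤ = ℕ.m⊔n≤o⇒n≤o P Q

    use-δ : ∀ A B K L → 0ℚ < B →
      (∀ n → K ℕ.≤ n → ∣ x n ∣ ≤ A) → (∀ n → L ℕ.≤ n → ∣ y n ∣ ≤ B) →
      (∃[ δ ] 0ℚ < δ × δ * (A + B) ≡ ε) → Goal
    use-δ A B K L 0<B hA hB (δ , 0<δ , δ[A+B]≡ε) =
      use-moduli A B δ K L 0<B 0<δ δ[A+B]≡ε hA hB (cx δ 0<δ) (cy δ 0<δ)

    use-bounds : (∃[ A ] 0ℚ < A × Eventually λ n → ∣ x n ∣ ≤ A) →
      (∃[ B ] 0ℚ < B × Eventually λ n → ∣ y n ∣ ≤ B) → Goal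
    use-bounds (A , 0<A , K , hA) (B , 0<B , L , hB) =
      use-δ A B K L 0<B hA hB
        (divide ε (A + B) 0<ε (ℚ.+-mono-< {0ℚ} {A} {0ℚ} {B} 0<A 0<B))

open CauchyLemmas

infixl 7 _*ʳ_
infixl 6 _+ʳ_ _-ʳ_
infixr 8 _^ʳ_

fromℚ : ℚ → ℝ
fromℚ q = mkℝ (λ _ → q) (const-cauchy q)

0ʳ 1ʳ : ℝ
0ʳ = fromℚ 0ℚ
1ʳ = fromℚ 1ℚ

_+ʳ_ _*ʳ_ _-ʳ_ : ℝ → ℝ → ℝ
x +ʳ y = mkℝ (λ n → seq x n + seq y n) (+-cauchy {seq x} {seq y} (cauchy x) (cauchy y))
x *ʳ y = mkℝ (λ n → seq x n * seq y n) (*-cauchy {seq x} {seq y} (cauchy x) (cauchy y))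
x -ʳ y = mkℝ (λ n → seq x n - seq y n)
  (+-cauchy {seq x} {λ n → - seq y n} (cauchy x) (neg-cauchy {seq y} (cauchy y)))

∣_∣ʳ : ℝ → ℝ
∣ x ∣ʳ = mkℝ (λ n → ∣ seq x n ∣) (abs-cauchy {seq x} (cauchy x))

_^ʳ_ : ℝ → ℕ → ℝ
x ^ʳ zero  = 1ʳ
x ^ʳ suc n = x *ʳ x ^ʳ n

infix 4 _⟶_
_⟶_ : (ℕ → ℝ) → ℝ → Set
a ⟶ l = ∀ ε → 0ℚ < ε → Eventually λ n → ∣ a n -ʳ l ∣ʳ ≤ʳ fromℚ ε

∑<ℚ : ℕ → (ℕ → ℚ) → ℚ
∑<ℚ zero    a = 0ℚ
∑<ℚ (suc n) a = ∑<ℚ n a + a n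

∑<ʳ : ℕ → (ℕ → ℝ) → ℝ
∑<ʳ zero    a = 0ʳ
∑<ʳ (suc n) a = ∑<ʳ n a +ʳ a n

PowerSeriesSum : (ℕ → ℚ) → ℝ → ℝ → Set
PowerSeriesSum F x s = (λ n → ∑<ʳ n λ m → fromℚ (F m) *ʳ x ^ʳ m) ⟶ s

ConvergesNear0 : (ℕ → ℚ) → Set
ConvergesNear0 F = ∃[ r ] 0ℚ < r × (∀ x → ∣ x ∣ʳ ≤ʳ fromℚ r → ∃[ s ] PowerSeriesSum F x s)

-- The natural logarithm of a positive integer:
--
--   log (1 + k) = 2 artanh w = ∑_j 2 w^(2j+1) / (2j+1),   w = k / (k + 2),
--
-- since (1 + w) / (1 - w) = 1 + k.
log-term : ℕ → ℕ → ℚ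
log-term k j = (+ 2 / suc (2 ℕ.* j)) * (+ k / suc (suc k)) ^ℚ suc (2 ℕ.* j)

module LogSeries where

  w : ℕ → ℚ
  w k = + k / suc (suc k)

  /-cancel : ∀ i d → (i / suc d) * fromℕ (suc d) ≡ fromℤ i
  /-cancel i d = ℚ.toℚᵘ-injective (begin
    ℚ.toℚᵘ ((i / suc d) * fromℕ (suc d))
      ≈⟨ ℚ.toℚᵘ-homo-* (i / suc d) (fromℕ (suc d)) ⟩
    ℚ.toℚᵘ (i / suc d) ℚᵘ.* ℚ.toℚᵘ (fromℕ (suc d))
      ≈⟨ ℚᵘ.*-cong (ℚ.toℚᵘ-fromℚᵘ (ℚᵘ.mkℚᵘ i d)) (ℚ.toℚᵘ-fromℚᵘ (ℚᵘ.mkℚᵘ (+ suc d) 0)) ⟩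
    ℚᵘ.mkℚᵘ i d ℚᵘ.* ℚᵘ.mkℚᵘ (+ suc d) 0
      ≈⟨ ℚᵘ.*≡* (ℤ.*-assoc i (+ suc d) 1ℤ ⟨ trans ⟩
           cong (i ℤ.*_) (trans (ℤ.*-identityʳ (+ suc d))
             (sym (cong +_ (ℕ.*-identityʳ (suc d)))))) ⟩
    ℚᵘ.mkℚᵘ i 0
      ≈⟨ ℚ.toℚᵘ-fromℚᵘ (ℚᵘ.mkℚᵘ i 0) ⟨
    ℚ.toℚᵘ (fromℤ i) ∎)
    where open ℚᵘ.≃-Reasoning

  fromℕ-suc : ∀ n → fromℕ (suc n) ≡ 1ℚ + fromℕ n
  fromℕ-suc n = ℚ.toℚᵘ-injective (begin
    ℚ.toℚᵘ (fromℕ (suc n))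
      ≈⟨ ℚ.toℚᵘ-fromℚᵘ (ℚᵘ.mkℚᵘ (+ suc n) 0) ⟩
    ℚᵘ.mkℚᵘ (+ suc n) 0
      ≈⟨ ℚᵘ.*≡* (cong (ℤ._* 1ℤ) (cong (λ m → + suc m) (sym (ℕ.*-identityʳ n))
           ⟨ trans ⟩ cong (λ i → 1ℤ ℤ.+ i) (ℤ.pos-* n 1))) ⟩
    ℚᵘ.mkℚᵘ 1ℤ 0 ℚᵘ.+ ℚᵘ.mkℚᵘ (+ n) 0
      ≈⟨ ℚᵘ.+-congʳ (ℚᵘ.mkℚᵘ 1ℤ 0) (ℚ.toℚᵘ-fromℚᵘ (ℚᵘ.mkℚᵘ (+ n) 0)) ⟨
    ℚᵘ.mkℚᵘ 1ℤ 0 ℚᵘ.+ ℚ.toℚᵘ (fromℕ n)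
      ≈⟨ ℚ.toℚᵘ-homo-+ 1ℚ (fromℕ n) ⟨
    ℚ.toℚᵘ (1ℚ + fromℕ n) ∎)
    where open ℚᵘ.≃-Reasoning

  0≤/ : ∀ n d → 0ℚ ≤ + n / suc d
  0≤/ n d = ℚ.nonNegative⁻¹ (+ n / suc d) ⦃ ℚ.normalize-nonNeg n (suc d) ⦄

  0≤1 : 0ℚ ≤ 1ℚ
  0≤1 = ℚ.nonNegative⁻¹ 1ℚ

  p≤p+q : ∀ p {q} → 0ℚ ≤ q → p ≤ p + q
  p≤p+q p {q} 0≤q = subst (_≤ p + q) (ℚ.+-identityʳ p) (ℚ.+-monoʳ-≤ p 0≤q)

  p≤q+p : ∀ p {q} → 0ℚ ≤ q → p ≤ q + p
  p≤q+p p {q} 0≤q = subst (p ≤_) (ℚ.+-comm p q) (p≤p+q p 0≤q)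

  0<fromℕ-suc : ∀ n → 0ℚ < fromℕ (suc n)
  0<fromℕ-suc n = subst (0ℚ <_) (sym (fromℕ-suc n))
    (ℚ.<-≤-trans (ℚ.positive⁻¹ 1ℚ) (p≤p+q 1ℚ (0≤/ n 0)))

  fromℕ-mono : ∀ {m n} → m ℕ.≤ n → fromℕ m ≤ fromℕ n
  fromℕ-mono {n = n} ℕ.z≤n = 0≤/ n 0
  fromℕ-mono (ℕ.s≤s {m} {n} m≤n) = subst₂ _≤_ (sym (fromℕ-suc m)) (sym (fromℕ-suc n))
    (ℚ.+-monoʳ-≤ 1ℚ (fromℕ-mono m≤n))

  0≤p*q : ∀ {p q} → 0ℚ ≤ p → 0ℚ ≤ q → 0ℚ ≤ p * q
  0≤p*q {p} {q} 0≤p 0≤q = subst (_≤ p * q) (ℚ.*-zeroʳ p)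
    (ℚ.*-monoˡ-≤-nonNeg p ⦃ ℚ.nonNegative 0≤p ⦄ 0≤q)

  module _ (k : ℕ) where

    c : ℚ
    c = fromℕ (suc (suc k))

    c≡ : c ≡ 1ℚ + (1ℚ + fromℕ k)
    c≡ = trans (fromℕ-suc (suc k)) (cong (λ u → 1ℚ + u) (fromℕ-suc k))

    0<c : 0ℚ < c
    0<c = 0<fromℕ-suc (suc k)

    0≤w : 0ℚ ≤ w k
    0≤w = 0≤/ k (suc k)

    wc≡c-2 : w k * c ≡ c - (1ℚ + 1ℚ)
    wc≡c-2 = trans (/-cancel (+ k) (suc k)) (trans
      (solve 1 (λ n → n := (con 1ℚ :+ (con 1ℚ :+ n)) :- (con 1ℚ :+ con 1ℚ)) refl (fromℕ k))
      (cong (_- (1ℚ + 1ℚ)) (sym c≡)))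

    w≤1 : w k ≤ 1ℚ
    w≤1 = ℚ.*-cancelʳ-≤-pos c ⦃ ℚ.positive 0<c ⦄ (begin
      w k * c               ≡⟨ /-cancel (+ k) (suc k) ⟩
      fromℕ k               ≤⟨ p≤q+p (fromℕ k) 0≤1 ⟩
      1ℚ + fromℕ k          ≤⟨ p≤q+p (1ℚ + fromℕ k) 0≤1 ⟩
      1ℚ + (1ℚ + fromℕ k)   ≡⟨ c≡ ⟨
      c                     ≡⟨ ℚ.*-identityˡ c ⟨
      1ℚ * c                ∎)
      where open ℚ.≤-Reasoning

    0≤wⁿ : ∀ n → 0ℚ ≤ w k ^ℚ n
    0≤wⁿ zero    = 0≤1
    0≤wⁿ (suc n) = 0≤p*q 0≤w (0≤wⁿ n)

    wᵐ⁺ⁿ≤wⁿ : ∀ m n → w k ^ℚ (m ℕ.+ n) ≤ w k ^ℚ n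
    wᵐ⁺ⁿ≤wⁿ zero    n = ℚ.≤-refl
    wᵐ⁺ⁿ≤wⁿ (suc m) n = subst (w k ^ℚ (suc m ℕ.+ n) ≤_) (ℚ.*-identityˡ (w k ^ℚ n))
      (*-mono-≤ 0≤w (0≤wⁿ n) w≤1 (wᵐ⁺ⁿ≤wⁿ m n))

    2/≤2 : ∀ m → + 2 / suc m ≤ 1ℚ + 1ℚ
    2/≤2 m = begin
      + 2 / suc m                       ≡⟨ ℚ.*-identityʳ (+ 2 / suc m) ⟨
      (+ 2 / suc m) * 1ℚ                ≤⟨ ℚ.*-monoˡ-≤-nonNeg (+ 2 / suc m)
                                             ⦃ ℚ.nonNegative (0≤/ 2 m) ⦄
                                             (fromℕ-mono (ℕ.s≤s (ℕ.z≤n {m}))) ⟩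
      (+ 2 / suc m) * fromℕ (suc m)     ≡⟨ /-cancel (+ 2) m ⟩
      1ℚ + 1ℚ                           ∎
      where open ℚ.≤-Reasoning

    0≤log-term : ∀ j → 0ℚ ≤ log-term k j
    0≤log-term j = 0≤p*q (0≤/ 2 (2 ℕ.* j)) (0≤wⁿ (suc (2 ℕ.* j)))

    log-term≤ : ∀ j → log-term k j ≤ c * w k ^ℚ j - c * w k ^ℚ suc j
    log-term≤ j = begin
      log-term k j
        ≤⟨ *-mono-≤ (0≤/ 2 (2 ℕ.* j)) (0≤wⁿ j) (2/≤2 (2 ℕ.* j))
             (subst (λ m → w k ^ℚ suc m ≤ w k ^ℚ j) (ℕ.+-comm (j ℕ.+ 0) j)
               (wᵐ⁺ⁿ≤wⁿ (suc (j ℕ.+ 0)) j)) ⟩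
      (1ℚ + 1ℚ) * w k ^ℚ j
        ≡⟨ solve 2 (λ C W → (con 1ℚ :+ con 1ℚ) :* W
             := C :* W :- (C :- (con 1ℚ :+ con 1ℚ)) :* W) refl c (w k ^ℚ j) ⟩
      c * w k ^ℚ j - (c - (1ℚ + 1ℚ)) * w k ^ℚ j
        ≡⟨ cong (λ u → c * w k ^ℚ j - u * w k ^ℚ j) wc≡c-2 ⟨
      c * w k ^ℚ j - (w k * c) * w k ^ℚ j
        ≡⟨ solve 3 (λ C W V → C :* W :- (V :* C) :* W := C :* W :- C :* (V :* W))
             refl c (w k ^ℚ j) (w k) ⟩
      c * w k ^ℚ j - c * w k ^ℚ suc j ∎
      where open ℚ.≤-Reasoning

    S : ℕ → ℚ
    S n = ∑<ℚ n (log-term k)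

    S-mono : ∀ m n → 0ℚ ≤ S (m ℕ.+ n) - S n
    S-mono zero    n = ℚ.≤-reflexive (sym (ℚ.+-inverseʳ (S n)))
    S-mono (suc m) n = subst (0ℚ ≤_)
      (solve 3 (λ a b t → (a :- b) :+ t := (a :+ t) :- b) refl
        (S (m ℕ.+ n)) (S n) (log-term k (m ℕ.+ n)))
      (ℚ.+-mono-≤ (S-mono m n) (0≤log-term (m ℕ.+ n)))

    S-tail : ∀ m n → S (m ℕ.+ n) - S n ≤ c * w k ^ℚ n - c * w k ^ℚ (m ℕ.+ n)
    S-tail zero    n = ℚ.≤-reflexive
      (trans (ℚ.+-inverseʳ (S n)) (sym (ℚ.+-inverseʳ (c * w k ^ℚ n))))
    S-tail (suc m) n = begin
      (S (m ℕ.+ n) + log-term k (m ℕ.+ n)) - S n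
        ≡⟨ solve 3 (λ a b t → (a :+ t) :- b := (a :- b) :+ t) refl
             (S (m ℕ.+ n)) (S n) (log-term k (m ℕ.+ n)) ⟩
      (S (m ℕ.+ n) - S n) + log-term k (m ℕ.+ n)
        ≤⟨ ℚ.+-mono-≤ (S-tail m n) (log-term≤ (m ℕ.+ n)) ⟩
      (c * w k ^ℚ n - c * w k ^ℚ (m ℕ.+ n))
        + (c * w k ^ℚ (m ℕ.+ n) - c * w k ^ℚ suc (m ℕ.+ n))
        ≡⟨ solve 3 (λ a b d → (a :- b) :+ (b :- d) := a :- d) refl
             (c * w k ^ℚ n) (c * w k ^ℚ (m ℕ.+ n)) (c * w k ^ℚ suc (m ℕ.+ n)) ⟩
      c * w k ^ℚ n - c * w k ^ℚ suc (m ℕ.+ n) ∎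
      where open ℚ.≤-Reasoning

    wⁿ-decay : ∀ n → (fromℕ n + c) * w k ^ℚ n ≤ c
    wⁿ-decay zero    = ℚ.≤-reflexive
      (trans (ℚ.*-identityʳ (0ℚ + c)) (ℚ.+-identityˡ c))
    wⁿ-decay (suc n) = begin
      (fromℕ (suc n) + c) * (w k * w k ^ℚ n)
        ≡⟨ cong (λ u → (u + c) * (w k * w k ^ℚ n)) (fromℕ-suc n) ⟩
      ((1ℚ + fromℕ n) + c) * (w k * w k ^ℚ n)
        ≡⟨ solve 4 (λ v C x W → ((con 1ℚ :+ v) :+ C) :* (x :* W)
             := (((con 1ℚ :+ v) :* x) :+ x :* C) :* W) refl
             (fromℕ n) c (w k) (w k ^ℚ n) ⟩
      ((1ℚ + fromℕ n) * w k + w k * c) * w k ^ℚ n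
        ≤⟨ ℚ.*-monoʳ-≤-nonNeg (w k ^ℚ n) ⦃ ℚ.nonNegative (0≤wⁿ n) ⦄ step ⟩
      (fromℕ n + c) * w k ^ℚ n
        ≤⟨ wⁿ-decay n ⟩
      c ∎
      where
      open ℚ.≤-Reasoning
      step : (1ℚ + fromℕ n) * w k + w k * c ≤ fromℕ n + c
      step = begin
        (1ℚ + fromℕ n) * w k + w k * c
          ≤⟨ ℚ.+-mono-≤
               (ℚ.*-monoˡ-≤-nonNeg (1ℚ + fromℕ n)
                 ⦃ ℚ.nonNegative (ℚ.+-mono-≤ 0≤1 (0≤/ n 0)) ⦄ w≤1)
               (ℚ.≤-reflexive wc≡c-2) ⟩
        (1ℚ + fromℕ n) * 1ℚ + (c - (1ℚ + 1ℚ))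
          ≡⟨ solve 2 (λ v C → (con 1ℚ :+ v) :* con 1ℚ :+ (C :- (con 1ℚ :+ con 1ℚ))
               := (v :+ C) :- con 1ℚ) refl (fromℕ n) c ⟩
        (fromℕ n + c) - 1ℚ
          ≤⟨ ℚ.+-monoʳ-≤ (fromℕ n + c) {y = 0ℚ} (ℚ.nonPositive⁻¹ (- 1ℚ)) ⟩
        (fromℕ n + c) + 0ℚ
          ≡⟨ ℚ.+-identityʳ (fromℕ n + c) ⟩
        fromℕ n + c ∎

    tail-small : ∀ ε → 0ℚ < ε → Eventually λ n → c * w k ^ℚ n ≤ ε
    tail-small ε@(ℚ.mkℚ (+ suc p) d _) 0<ε = N , λ n n≥ →
      let instance
            n+c-pos : ℚ.Positive (fromℕ n + c)
            n+c-pos = ℚ.positive (ℚ.+-mono-≤-< (0≤/ n 0) 0<c)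
      in ℚ.*-cancelˡ-≤-pos (fromℕ n + c) (begin
        (fromℕ n + c) * (c * w k ^ℚ n)
          ≡⟨ solve 3 (λ a b e → a :* (b :* e) := b :* (a :* e)) refl
               (fromℕ n + c) c (w k ^ℚ n) ⟩
        c * ((fromℕ n + c) * w k ^ℚ n)
          ≤⟨ ℚ.*-monoˡ-≤-nonNeg c ⦃ ℚ.nonNegative (ℚ.<⇒≤ 0<c) ⦄ (wⁿ-decay n) ⟩
        c * c
          ≤⟨ c*c≤ ⟩
        fromℕ N * ε
          ≤⟨ ℚ.*-monoʳ-≤-nonNeg ε (ℚ.≤-trans (fromℕ-mono n≥)
               (p≤p+q (fromℕ n) (ℚ.<⇒≤ 0<c))) ⟩
        (fromℕ n + c) * ε ∎)
      where
      open ℚ.≤-Reasoning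
      K = suc (suc k)
      N = (K ℕ.* K) ℕ.* suc d
      fromℕ-* : ∀ a b → fromℕ (a ℕ.* b) ≡ fromℕ a * fromℕ b
      fromℕ-* zero    b = sym (ℚ.*-zeroˡ (fromℕ b))
      fromℕ-* (suc a) b = trans (fromℕ-+ b (a ℕ.* b)) (trans
        (cong (λ u → fromℕ b + u) (fromℕ-* a b)) (trans
        (solve 2 (λ x y → y :+ x :* y := (con 1ℚ :+ x) :* y) refl (fromℕ a) (fromℕ b))
        (cong (_* fromℕ b) (sym (fromℕ-suc a)))))
        where
        fromℕ-+ : ∀ m n → fromℕ (m ℕ.+ n) ≡ fromℕ m + fromℕ n
        fromℕ-+ zero    n = sym (ℚ.+-identityˡ (fromℕ n))
        fromℕ-+ (suc m) n = trans (fromℕ-suc (m ℕ.+ n)) (trans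
          (cong (λ u → 1ℚ + u) (fromℕ-+ m n)) (trans
          (sym (ℚ.+-assoc 1ℚ (fromℕ m) (fromℕ n)))
          (cong (_+ fromℕ n) (sym (fromℕ-suc m)))))
      dε≡ : fromℕ (suc d) * ε ≡ fromℕ (suc p)
      dε≡ = trans (ℚ.*-comm (fromℕ (suc d)) ε) (trans
        (cong (_* fromℕ (suc d)) (sym (ℚ.↥p/↧p≡p ε))) (/-cancel (+ suc p) d))
      c*c≤ : c * c ≤ fromℕ N * ε
      c*c≤ = begin
        c * c
          ≡⟨ ℚ.*-identityʳ (c * c) ⟨
        (c * c) * 1ℚ
          ≤⟨ ℚ.*-monoˡ-≤-nonNeg (c * c)
               ⦃ ℚ.nonNegative (ℚ.<⇒≤ (0<p*q 0<c 0<c)) ⦄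
               (fromℕ-mono (ℕ.s≤s (ℕ.z≤n {p}))) ⟩
        (c * c) * fromℕ (suc p)
          ≡⟨ cong₂ _*_ (fromℕ-* K K) dε≡ ⟨
        fromℕ (K ℕ.* K) * (fromℕ (suc d) * ε)
          ≡⟨ ℚ.*-assoc (fromℕ (K ℕ.* K)) (fromℕ (suc d)) ε ⟨
        (fromℕ (K ℕ.* K) * fromℕ (suc d)) * ε
          ≡⟨ cong (_* ε) (fromℕ-* (K ℕ.* K) (suc d)) ⟨
        fromℕ N * ε ∎
    tail-small (ℚ.mkℚ (+ zero) d _) (ℚ.*<* (ℤ.+<+ ()))
    tail-small (ℚ.mkℚ (ℤ.-[1+ p ]) d _) (ℚ.*<* ())

    S-close : ∀ ε {m n} → c * w k ^ℚ n ≤ ε → n ℕ.≤ m → ∣ S m - S n ∣ ≤ ε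
    S-close ε {m} {n} tail n≤m = subst (λ m → ∣ S m - S n ∣ ≤ ε) (ℕ.m∸n+n≡m n≤m)
      (subst (_≤ ε) (sym (ℚ.0≤p⇒∣p∣≡p (S-mono l n))) (begin
        S (l ℕ.+ n) - S n
          ≤⟨ S-tail l n ⟩
        c * w k ^ℚ n - c * w k ^ℚ (l ℕ.+ n)
          ≤⟨ ℚ.+-monoʳ-≤ (c * w k ^ℚ n)
               (ℚ.neg-antimono-≤ (0≤p*q (ℚ.<⇒≤ 0<c) (0≤wⁿ (l ℕ.+ n)))) ⟩
        c * w k ^ℚ n + 0ℚ
          ≡⟨ ℚ.+-identityʳ (c * w k ^ℚ n) ⟩
        c * w k ^ℚ n
          ≤⟨ tail ⟩
        ε ∎))
      where
      open ℚ.≤-Reasoning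
      l = m ℕ.∸ n

    log-cauchy : Cauchy S
    log-cauchy ε 0<ε with tail-small ε 0<ε
    ... | N , h = N , λ m n m≥ n≥ → close m n m≥ n≥ (ℕ.≤-total n m)
      where
      close : ∀ m n → N ℕ.≤ m → N ℕ.≤ n → _ → ∣ S m - S n ∣ ≤ ε
      close m n m≥ n≥ (inj₁ n≤m) = S-close ε (h n n≥) n≤m
      close m n m≥ n≥ (inj₂ m≤n) =
        subst (_≤ ε) (∣p-q∣≡∣q-p∣ (S n) (S m)) (S-close ε (h m m≥) m≤n)

log : (n : ℕ) → .⦃ ℕ.NonZero n ⦄ → ℝ
log (suc k) = mkℝ (λ n → ∑<ℚ n (log-term k)) (LogSeries.log-cauchy k)

h : ℚ → ℝ
h x = log (ℤ.∣ ↥ x ∣ ℕ.⊔ ↧ₙ x) ⦃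
  ℕ.>-nonZero (ℕ.≤-trans (ℕ.s≤s ℕ.z≤n) (ℕ.m≤n⊔m ℤ.∣ ↥ x ∣ (↧ₙ x))) ⦄

f : ℚ → ℚ → ℚ
f t z = z * z + t

IsCanonicalHeight : ℚ → ℚ → ℝ → Set
IsCanonicalHeight t x a = (λ N → fromℚ (½ ^ℚ N) *ʳ h (fold x (f t) N)) ⟶ a

-- Polynomials are lists of coefficients, constant term first; trailing
-- zeros are allowed

module Polynomial {a ℓ} (R : RawRing a ℓ) where
  open RawRing R renaming (Carrier to A; _+_ to _⊕_; _*_ to _⊗_)

  eval : List A → A → A
  eval p x = foldr (λ c v → c ⊕ x ⊗ v) 0# p

  _+ₚ_ : List A → List A → List A
  []      +ₚ q       = q
  p       +ₚ []      = p
  (c ∷ p) +ₚ (d ∷ q) = (c ⊕ d) ∷ (p +ₚ q)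

  _*ₚ_ : List A → List A → List A
  []      *ₚ q = []
  (c ∷ p) *ₚ q = map (c ⊗_) q +ₚ (0# ∷ (p *ₚ q))

  -- The quotient of p by t - x: if p = c + t q then
  -- p = p(x) + (t - x) (q(x) + t (q / (t - x))).
  _/ₚt-_ : List A → A → List A
  []      /ₚt- x = []
  (c ∷ q) /ₚt- x = eval q x ∷ (q /ₚt- x)

-- A polynomial is monic when its last listed coefficient is 1; every monic
-- polynomial has exactly one such list.
Monic : List ℤ → Set
Monic P = last P ≡ just 1ℤ

ℚ[t] : Set
ℚ[t] = List ℚ

open Polynomial ℚ.+-*-rawRing public

ℤ[t]⇒ℚ[t] : List ℤ → ℚ[t]
ℤ[t]⇒ℚ[t] = map fromℤ

-- The zero polynomial, in any of its representations, has degree nothing.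
degree : ℚ[t] → Maybe ℕ
degree []      = nothing
degree (c ∷ p) with degree p
... | just d  = just (suc d)
... | nothing = if does (c ℚ.≟ 0ℚ) then nothing else just 0

-- The list 0ℚ ∷ 1ℚ ∷ [] is the variable t.
fₜ : ℚ[t] → ℚ[t]
fₜ z = (z *ₚ z) +ₚ (0ℚ ∷ 1ℚ ∷ [])

record AlgebraicClosureOfℚ (a ℓ : Level) : Set (lsuc (a ⊔ ℓ)) where
  field
    commutativeRing : CommutativeRing a ℓ

  open CommutativeRing commutativeRing public
    renaming (_+_ to _⊕_; _*_ to _⊗_; -_ to ⊖_; _-_ to _⊖_)
  open RingMorphisms ℚ.+-*-rawRing rawRing using (IsRingHomomorphism)
  open Polynomial rawRing public using ()
    renaming (eval to evalᴷ; _/ₚt-_ to _/ᴷt-_)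
  field
    _≈?_     : Decidable _≈_
    0≉1      : ¬ (0# ≈ 1#)
    inverse  : ∀ x → ¬ (x ≈ 0#) → ∃[ y ] x ⊗ y ≈ 1#
    ι        : ℚ → Carrier
    ι-homo   : IsRingHomomorphism ι
    algebraic : ∀ x → ∃[ p ] evalᴷ (map ι (p ++ [ 1ℚ ])) x ≈ 0#
    algebraicallyClosed : ∀ c p → ∃[ x ] evalᴷ (c ∷ p ++ [ 1# ]) x ≈ 0#

module FunctionField {a ℓ} (ℚ̄ : AlgebraicClosureOfℚ a ℓ) where
  private module ℚ̄ = AlgebraicClosureOfℚ ℚ̄
  open ℚ̄ using (_≈?_; 0#; ι; evalᴷ; _/ᴷt-_)

  ℙ¹-setoid : Setoid a (a ⊔ ℓ)
  ℙ¹-setoid = Pointwise.setoid ℚ̄.setoid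

  ℙ¹ : Set a
  ℙ¹ = Maybe ℚ̄.Carrier

  pattern ∞ = nothing

  open Membership ℙ¹-setoid using (_∉_)
  open Unique ℙ¹-setoid using () renaming (Unique to Distinct)

  -- The multiplicity of x as a root, capped at the first argument.
  multiplicity : ℕ → ℚ̄.Carrier → List ℚ̄.Carrier → ℕ
  multiplicity zero    x p = 0
  multiplicity (suc n) x p =
    if does (evalᴷ p x ≈? 0#) then suc (multiplicity n x (p /ᴷt- x)) else 0

  -- ord_β on ℚ[t] ⊂ ℚ(t); nothing stands for ord_β 0 = +∞. The degree
  -- bounds all multiplicities, so the cap loses nothing.
  ord : ℙ¹ → ℚ[t] → Maybe ℤ
  ord ∞        g = Maybe.map (λ d → ℤ.- (+ d)) (degree g)
  ord (just x) g = Maybe.map (λ d → + multiplicity d x (map ι g)) (degree g)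

  max0- : Maybe ℤ → ℤ
  max0- nothing  = 0ℤ
  max0- (just k) = 0ℤ ℤ.⊔ (ℤ.- k)

  IsLocalHeight : ℚ[t] → ℙ¹ → ℝ → Set
  IsLocalHeight P β a =
    (λ N → fromℚ (½ ^ℚ N * fromℤ (max0- (ord β (fold P fₜ N))))) ⟶ a

  IsSum : (ℙ¹ → ℝ) → ℝ → Set (a ⊔ ℓ)
  IsSum u s = ∃[ βs ] Distinct βs × (∀ β → β ∉ βs → u β ≃ 0ʳ)
    × foldr (λ β v → u β +ʳ v) 0ʳ βs ≃ s

  -- The orbit of a polynomial P stays in ℚ[t], so ord is only needed there.
  IsFunctionFieldHeight : ℚ[t] → ℝ → Set (a ⊔ ℓ)
  IsFunctionFieldHeight P s =
    ∃[ u ] (∀ β → IsLocalHeight P β (u β)) × IsSum u s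

open FunctionField public using (IsFunctionFieldHeight)

{-# OPTIONS --safe #-}
module Submission where

-- Put s = 1/t and let x₀ = P(t), xᵢ₊₁ = xᵢ² + t be the orbit of P(t), where d = deg P ≥ 1.
-- Since P is monic with integral coefficients and t = a/b in lowest terms, the denominator
-- of xᵢ is exactly b^(2ⁱd); as |xᵢ| ≥ 1, the height of xᵢ is the logarithm of |xᵢ| b^(2ⁱd).
-- Writing x₀ = tᵈ (1 + u₀) and xᵢ₊₁ = xᵢ² (1 + uᵢ₊₁), so that uᵢ₊₁ = t / xᵢ², telescoping gives
--   2⁻ⁿ h(xₙ) = d h(t) + Σ_{i ≤ n} 2⁻ⁱ log (1 + uᵢ).
-- Here u₁ = s^(2d-1) / (1 + u₀)² and uᵢ₊₁ = s (uᵢ / (1 + uᵢ))² for i ≥ 1, so uᵢ is a rational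
-- power series in s of order at least i, and on a small fixed disc all the uᵢ are bounded by 1/2
-- in the norm Σ |cₖ| Rᵏ. Hence F = Σ 2⁻ⁱ log (1 + uᵢ) is a rational power series that converges
-- there. If d = 0 then P = 1, and the orbit of 1 + t is used instead.

open import Defs
open import Data.Integer.Base as ℤ using (ℤ; +_; 0ℤ; 1ℤ)
import Data.Integer.Divisibility.Signed as ℤ
import Data.Integer.Properties as ℤ
open import Data.List.Base using (List; []; _∷_; [_]; map; length)
import Data.List.Properties as List
open import Data.List.Relation.Unary.AllPairs using ([]; _∷_)
open import Data.List.Relation.Unary.All using ([])
open import Data.List.Relation.Unary.Any using (here)
open import Data.Maybe.Base using (Maybe; just; nothing)
import Data.Maybe.Relation.Binary.Pointwise as Pointwise
open import Data.Nat.Base as ℕ using (ℕ; zero; suc)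
open import Data.Nat.Coprimality as Coprimality using (Coprime)
open import Data.Nat.Divisibility as ℕ using (∣-trans)
open import Data.Nat.GeneralisedArithmetic using (fold; fold-+)
import Data.Nat.Properties as ℕ
open import Data.Product.Base using (∃-syntax; _×_; _,_; proj₁; proj₂)
open import Data.Rational.Base as ℚ
  using (ℚ; 0ℚ; 1ℚ; ½; _+_; _*_; _-_; -_; 1/_; _/_; ∣_∣; _≤_; _<_; ↥_; ↧ₙ_)
import Data.Rational.Properties as ℚ
import Data.Rational.Unnormalised.Base as ℚᵘ
import Data.Rational.Unnormalised.Properties as ℚᵘ
open import Data.Sum.Base using (inj₁; inj₂)
open import Level using (0ℓ)
open import Relation.Binary.PropositionalEquality hiding ([_])
open import Relation.Nullary using (yes; no; contradiction)
open import Tactic.RingSolver using (solve-∀)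
open import Tactic.RingSolver.Core.AlmostCommutativeRing
  using (AlmostCommutativeRing; fromCommutativeRing)

open CauchyLemmas
open LogSeries using (/-cancel; fromℕ-suc; 0≤/; 0≤1; 0<fromℕ-suc; fromℕ-mono; 0≤p*q)


-- Rational arithmetic and null sequences

-- The obstacle is the logarithm. Reals are Cauchy sequences, and `log` is given only at positive
-- integers, by partial sums of an artanh series, while the factors `1 + uᵢ` are rational and need
-- not be integers. So the argument stays with rational partial sums: `lg x n` extends those of
-- `log` to rational arguments, and an identity between logarithms means that a difference of such
-- sequences tends to 0. Even the functional equation has to be proved in this form, without
-- derivatives or integrals; mean value inequalities for powers take their place. The same index n
-- truncates the artanh series, the power series and the sum over i. Exchanging these limits
-- requires errors that are uniform in i. This is why the series are bounded in one norm on a disc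
-- of radius R and evaluated only for `∣ s ∣ ≤ ½ R`: every truncation error is then a constant times
-- `½ ^ n`.

ring : AlmostCommutativeRing 0ℓ 0ℓ
ring = fromCommutativeRing ℚ.+-*-commutativeRing zero?
  where
  zero? : ∀ q → Maybe (0ℚ ≡ q)
  zero? q with 0ℚ ℚ.≟ q
  ... | yes 0≡q = just 0≡q
  ... | no  _   = nothing

2ℚ 4ℚ : ℚ
2ℚ = 1ℚ + 1ℚ
4ℚ = 2ℚ + 2ℚ

0<1 : 0ℚ < 1ℚ
0<1 = ℚ.positive⁻¹ 1ℚ

≤-by : ∀ {p q e} → 0ℚ ≤ e → q ≡ p + e → p ≤ q
≤-by {p} {q} {e} 0≤e q≡p+e = subst₂ _≤_ (ℚ.+-identityʳ p) (sym q≡p+e) (ℚ.+-monoʳ-≤ p 0≤e)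

p≤q⇒0≤q-p : ∀ {p q} → p ≤ q → 0ℚ ≤ q - p
p≤q⇒0≤q-p {p} {q} p≤q = subst (_≤ q - p) (ℚ.+-inverseʳ p) (ℚ.+-monoˡ-≤ (- p) p≤q)

0≤q-p⇒p≤q : ∀ {p q} → 0ℚ ≤ q - p → p ≤ q
0≤q-p⇒p≤q {p} {q} 0≤q-p = ≤-by 0≤q-p (eq p q)
  where
  eq : ∀ p q → q ≡ p + (q - p)
  eq = solve-∀ ring

0≤p+q : ∀ {p q} → 0ℚ ≤ p → 0ℚ ≤ q → 0ℚ ≤ p + q
0≤p+q 0≤p 0≤q = ℚ.+-mono-≤ 0≤p 0≤q

-p*-p≡p*p : ∀ p → (- p) * (- p) ≡ p * p
-p*-p≡p*p = solve-∀ ring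

0≤p² : ∀ p → 0ℚ ≤ p * p
0≤p² p with ℚ.≤-total 0ℚ p
... | inj₁ 0≤p = 0≤p*q 0≤p 0≤p
... | inj₂ p≤0 = subst (0ℚ ≤_) (-p*-p≡p*p p) (0≤p*q (ℚ.neg-antimono-≤ p≤0) (ℚ.neg-antimono-≤ p≤0))

*-cancel-0≤ : ∀ {c p} → 0ℚ < c → 0ℚ ≤ c * p → 0ℚ ≤ p
*-cancel-0≤ {c} {p} 0<c 0≤cp = ℚ.*-cancelˡ-≤-pos c ⦃ ℚ.positive 0<c ⦄
  (subst (_≤ c * p) (sym (ℚ.*-zeroʳ c)) 0≤cp)

reciprocal : ∀ q → 0ℚ < q → ∃[ r ] 0ℚ < r × q * r ≡ 1ℚ
reciprocal q 0<q with divide 1ℚ q 0<1 0<q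
... | r , 0<r , rq≡1 = r , 0<r , trans (ℚ.*-comm q r) rq≡1

p≤∣p∣ : ∀ p → p ≤ ∣ p ∣
p≤∣p∣ p with ℚ.≤-total 0ℚ p
... | inj₁ 0≤p = ℚ.≤-reflexive (sym (ℚ.0≤p⇒∣p∣≡p 0≤p))
... | inj₂ p≤0 = ℚ.≤-trans p≤0 (ℚ.0≤∣p∣ p)

-p≤∣p∣ : ∀ p → - p ≤ ∣ p ∣
-p≤∣p∣ p = subst (- p ≤_) (ℚ.∣-p∣≡∣p∣ p) (p≤∣p∣ (- p))

∣p∣≤q⇒0≤q+p : ∀ {p q} → ∣ p ∣ ≤ q → 0ℚ ≤ q + p
∣p∣≤q⇒0≤q+p {p} {q} ∣p∣≤q = subst (0ℚ ≤_) (eq p q) (p≤q⇒0≤q-p (ℚ.≤-trans (-p≤∣p∣ p) ∣p∣≤q))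
  where
  eq : ∀ p q → q - (- p) ≡ q + p
  eq = solve-∀ ring

∣p∣≤q⇒0≤q-p : ∀ {p q} → ∣ p ∣ ≤ q → 0ℚ ≤ q - p
∣p∣≤q⇒0≤q-p {p} ∣p∣≤q = p≤q⇒0≤q-p (ℚ.≤-trans (p≤∣p∣ p) ∣p∣≤q)

∣p+q∣≤ : ∀ p q {P Q} → ∣ p ∣ ≤ P → ∣ q ∣ ≤ Q → ∣ p + q ∣ ≤ P + Q
∣p+q∣≤ p q p≤P q≤Q = ℚ.≤-trans (ℚ.∣p+q∣≤∣p∣+∣q∣ p q) (ℚ.+-mono-≤ p≤P q≤Q)

∣p*q∣≤ : ∀ p q {P Q} → ∣ p ∣ ≤ P → ∣ q ∣ ≤ Q → ∣ p * q ∣ ≤ P * Q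
∣p*q∣≤ p q p≤P q≤Q = subst (_≤ _) (sym (ℚ.∣p*q∣≡∣p∣*∣q∣ p q))
  (*-mono-≤ (ℚ.0≤∣p∣ p) (ℚ.≤-trans (ℚ.0≤∣p∣ q) q≤Q) p≤P q≤Q)

0≤^ : ∀ {x} n → 0ℚ ≤ x → 0ℚ ≤ x ^ℚ n
0≤^ zero    0≤x = 0≤1
0≤^ (suc n) 0≤x = 0≤p*q 0≤x (0≤^ n 0≤x)

0<^ : ∀ {x} n → 0ℚ < x → 0ℚ < x ^ℚ n
0<^ zero    0<x = 0<1
0<^ (suc n) 0<x = 0<p*q 0<x (0<^ n 0<x)

^-monoˡ-≤ : ∀ {x y} n → 0ℚ ≤ x → x ≤ y → x ^ℚ n ≤ y ^ℚ n
^-monoˡ-≤ zero    0≤x x≤y = ℚ.≤-refl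
^-monoˡ-≤ (suc n) 0≤x x≤y =
  *-mono-≤ 0≤x (0≤^ n (ℚ.≤-trans 0≤x x≤y)) x≤y (^-monoˡ-≤ n 0≤x x≤y)

∣^∣ : ∀ x n → ∣ x ^ℚ n ∣ ≡ ∣ x ∣ ^ℚ n
∣^∣ x zero    = refl
∣^∣ x (suc n) = trans (ℚ.∣p*q∣≡∣p∣*∣q∣ x (x ^ℚ n)) (cong (∣ x ∣ *_) (∣^∣ x n))

^-distribʳ-* : ∀ x y n → (x * y) ^ℚ n ≡ x ^ℚ n * y ^ℚ n
^-distribʳ-* x y zero    = refl
^-distribʳ-* x y (suc n) = trans (cong (x * y *_) (^-distribʳ-* x y n))
  (eq x y (x ^ℚ n) (y ^ℚ n))
  where
  eq : ∀ x y a b → (x * y) * (a * b) ≡ (x * a) * (y * b)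
  eq = solve-∀ ring

^-+ : ∀ x m n → x ^ℚ (m ℕ.+ n) ≡ x ^ℚ m * x ^ℚ n
^-+ x zero    n = sym (ℚ.*-identityˡ (x ^ℚ n))
^-+ x (suc m) n = trans (cong (x *_) (^-+ x m n)) (sym (ℚ.*-assoc x (x ^ℚ m) (x ^ℚ n)))

1^n≡1 : ∀ n → 1ℚ ^ℚ n ≡ 1ℚ
1^n≡1 zero    = refl
1^n≡1 (suc n) = trans (ℚ.*-identityˡ (1ℚ ^ℚ n)) (1^n≡1 n)

^-antimonoʳ-≤ : ∀ {x} m n → 0ℚ ≤ x → x ≤ 1ℚ → x ^ℚ (m ℕ.+ n) ≤ x ^ℚ n
^-antimonoʳ-≤ {x} m n 0≤x x≤1 = subst₂ _≤_ (sym (^-+ x m n)) (ℚ.*-identityˡ (x ^ℚ n))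
  (ℚ.*-monoʳ-≤-nonNeg (x ^ℚ n) ⦃ ℚ.nonNegative (0≤^ n 0≤x) ⦄
    (subst (x ^ℚ m ≤_) (1^n≡1 m) (^-monoˡ-≤ m 0≤x x≤1)))

0≤fromℕ : ∀ n → 0ℚ ≤ fromℕ n
0≤fromℕ n = 0≤/ n 0

archimedean : ∀ C ε → 0ℚ < ε → ∃[ N ] ∀ n → N ℕ.≤ n → C ≤ fromℕ n * ε
archimedean C ε 0<ε = use (divide ε B 0<ε 0<B)
  where
  B : ℚ
  B = 1ℚ + ∣ C ∣
  0<B : 0ℚ < B
  0<B = ℚ.+-mono-<-≤ 0<1 (ℚ.0≤∣p∣ C)
  eq : ∀ c a → 1ℚ + a ≡ c + (1ℚ + (a - c))
  eq = solve-∀ ring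
  unit : ∀ δ → 0ℚ < δ → ∃[ N ] 1ℚ ≤ fromℕ N * δ
  unit δ@(ℚ.mkℚ (+ suc p) d _) _ = suc d ,
    subst (1ℚ ≤_) (sym (trans (ℚ.*-comm (fromℕ (suc d)) δ)
        (trans (cong (_* fromℕ (suc d)) (sym (ℚ.↥p/↧p≡p δ))) (/-cancel (+ suc p) d))))
      (fromℕ-mono (ℕ.s≤s (ℕ.z≤n {p})))
  unit (ℚ.mkℚ (+ zero) d _) (ℚ.*<* (ℤ.+<+ ()))
  unit (ℚ.mkℚ (ℤ.-[1+ p ]) d _) (ℚ.*<* ())
  use : ∃[ δ ] 0ℚ < δ × δ * B ≡ ε → _
  use (δ , 0<δ , δB≡ε) with unit δ 0<δ
  ... | N , 1≤Nδ = N , λ n N≤n → begin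
    C                    ≤⟨ ≤-by (0≤p+q 0≤1 (p≤q⇒0≤q-p (p≤∣p∣ C))) (eq C ∣ C ∣) ⟩
    B                    ≡⟨ ℚ.*-identityˡ B ⟨
    1ℚ * B               ≤⟨ *-mono-≤ 0≤1 (ℚ.<⇒≤ 0<B) (ℚ.≤-trans 1≤Nδ
                              (ℚ.*-monoʳ-≤-nonNeg δ ⦃ ℚ.nonNegative (ℚ.<⇒≤ 0<δ) ⦄
                                (fromℕ-mono N≤n))) ℚ.≤-refl ⟩
    (fromℕ n * δ) * B    ≡⟨ ℚ.*-assoc (fromℕ n) δ B ⟩
    fromℕ n * (δ * B)    ≡⟨ cong (fromℕ n *_) δB≡ε ⟩
    fromℕ n * ε          ∎
    where open ℚ.≤-Reasoning

≤-limit : ∀ {p q} → (∀ ε → 0ℚ < ε → p ≤ q + ε) → p ≤ q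
≤-limit {p} {q} p≤q+ε with p ℚ.≤? q
... | yes p≤q = p≤q
... | no  p≰q = contradiction (ℚ.≤-<-trans (p≤q+ε (½ * (p - q)) (0<p*q 0<½ 0<p-q)) q+<p) (ℚ.<-irrefl refl)
  where
  0<p-q : 0ℚ < p - q
  0<p-q = subst (_< p - q) (ℚ.+-inverseʳ q) (ℚ.+-monoˡ-< (- q) (ℚ.≰⇒> p≰q))
  eq : ∀ p q → (q + ½ * (p - q)) + ½ * (p - q) ≡ p
  eq = solve-∀ ring
  q+<p : q + ½ * (p - q) < p
  q+<p = subst₂ _<_ (ℚ.+-identityʳ _)
    (eq p q)
    (ℚ.+-monoʳ-< (q + ½ * (p - q)) (0<p*q 0<½ 0<p-q))

-- Applied to a difference of representing sequences this is `≃` unfolded, so identities between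
-- reals can be handled termwise in ℚ.
Null : (ℕ → ℚ) → Set
Null x = ∀ ε → 0ℚ < ε → Eventually λ n → ∣ x n ∣ ≤ ε

Null-squeeze : ∀ {x y} N → (∀ n → N ℕ.≤ n → ∣ x n ∣ ≤ ∣ y n ∣) → Null y → Null x
Null-squeeze N x≤y y⟶0 ε 0<ε with y⟶0 ε 0<ε
... | M , y≤ε = N ℕ.⊔ M , λ n n≥ →
  ℚ.≤-trans (x≤y n (ℕ.m⊔n≤o⇒m≤o N M n≥)) (y≤ε n (ℕ.m⊔n≤o⇒n≤o N M n≥))

Null-bound : ∀ {x y} → (∀ n → ∣ x n ∣ ≤ y n) → Null y → Null x
Null-bound {x} {y} x≤y = Null-squeeze 0 λ n _ → ℚ.≤-trans (x≤y n) (p≤∣p∣ (y n))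

Null-cong : ∀ {x y} → (∀ n → x n ≡ y n) → Null y → Null x
Null-cong x≡y = Null-squeeze 0 λ n _ → ℚ.≤-reflexive (cong ∣_∣ (x≡y n))

Null-+ : ∀ {x y} → Null x → Null y → Null (λ n → x n + y n)
Null-+ {x} {y} x⟶0 y⟶0 ε 0<ε with x⟶0 (½ * ε) (0<p*q 0<½ 0<ε) | y⟶0 (½ * ε) (0<p*q 0<½ 0<ε)
... | M , x≤ | N , y≤ = M ℕ.⊔ N , λ n n≥ → subst (_ ≤_) (½-sum ε)
  (∣p+q∣≤ (x n) (y n) (x≤ n (ℕ.m⊔n≤o⇒m≤o M N n≥)) (y≤ n (ℕ.m⊔n≤o⇒n≤o M N n≥)))

Null-* : ∀ {x} c → Null x → Null (λ n → c * x n)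
Null-* {x} c x⟶0 ε 0<ε = use (divide ε B 0<ε 0<B)
  where
  B : ℚ
  B = 1ℚ + ∣ c ∣
  0<B : 0ℚ < B
  0<B = ℚ.+-mono-<-≤ 0<1 (ℚ.0≤∣p∣ c)
  use : ∃[ δ ] 0ℚ < δ × δ * B ≡ ε → _
  use (δ , 0<δ , δB≡ε) with x⟶0 δ 0<δ
  ... | N , x≤δ = N , λ n n≥ → subst (_ ≤_) (trans (ℚ.*-comm B δ) δB≡ε)
    (∣p*q∣≤ c (x n) (≤-by 0≤1 (ℚ.+-comm 1ℚ ∣ c ∣)) (x≤δ n n≥))

Null-neg : ∀ {x} → Null x → Null (λ n → - x n)
Null-neg {x} = Null-squeeze 0 λ n _ → ℚ.≤-reflexive (ℚ.∣-p∣≡∣p∣ (x n))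

Null-0 : Null (λ _ → 0ℚ)
Null-0 ε 0<ε = 0 , λ _ _ → ℚ.<⇒≤ 0<ε

Null-∑ : ∀ {x : ℕ → ℕ → ℚ} m → (∀ i → Null (x i)) → Null (λ n → ∑<ℚ m (λ i → x i n))
Null-∑ zero    _   = Null-0
Null-∑ (suc m) x⟶0 = Null-+ (Null-∑ m x⟶0) (x⟶0 m)

Null-suc : ∀ {x} → Null (λ n → x (suc n)) → Null x
Null-suc x⟶0 ε 0<ε with x⟶0 ε 0<ε
... | N , x≤ε = suc N , λ where (suc n) (ℕ.s≤s N≤n) → x≤ε n N≤n

-- Bernoulli's inequality makes q ^ n at most 1 / (1 + n (1 - q)).
bernoulli : ∀ {q} → 0ℚ ≤ q → ∀ n → q ^ℚ n * (1ℚ + fromℕ n * (1ℚ - q)) ≤ 1ℚ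
bernoulli {q} 0≤q zero    = ℚ.≤-reflexive (eq q)
  where
  eq : ∀ q → 1ℚ * (1ℚ + 0ℚ * (1ℚ - q)) ≡ 1ℚ
  eq = solve-∀ ring
bernoulli {q} 0≤q (suc n) = ℚ.≤-trans (≤-by
    (0≤p*q (0≤^ n 0≤q) (0≤p*q (0≤p+q 0≤1 (0≤fromℕ n)) (0≤p² (1ℚ - q))))
    (trans (eq q (q ^ℚ n) (fromℕ n))
      (cong (λ u → (q * q ^ℚ n) * (1ℚ + u * (1ℚ - q)) + q ^ℚ n * ((1ℚ + fromℕ n) * ((1ℚ - q) * (1ℚ - q))))
        (sym (fromℕ-suc n)))))
    (bernoulli 0≤q n)
  where
  eq : ∀ q Q k → Q * (1ℚ + k * (1ℚ - q)) ≡ (q * Q) * (1ℚ + (1ℚ + k) * (1ℚ - q)) + Q * ((1ℚ + k) *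
      ((1ℚ - q) * (1ℚ - q)))
  eq = solve-∀ ring

Null-^ : ∀ {q} → 0ℚ ≤ q → q < 1ℚ → Null (q ^ℚ_)
Null-^ {q} 0≤q q<1 ε 0<ε = use (archimedean 1ℚ ((1ℚ - q) * ε) (0<p*q 0<1-q 0<ε))
  where
  0<1-q : 0ℚ < 1ℚ - q
  0<1-q = subst (_< 1ℚ - q) (ℚ.+-inverseʳ q) (ℚ.+-monoˡ-< (- q) q<1)
  eq : ∀ Q k q ε → ε ≡ Q + (Q * (k * ((1ℚ - q) * ε) - 1ℚ) + ε * ((1ℚ - Q * (1ℚ + k * (1ℚ - q))) + Q))
  eq = solve-∀ ring
  bound : ∀ Q k → 0ℚ ≤ Q → 1ℚ ≤ k * ((1ℚ - q) * ε) → Q * (1ℚ + k * (1ℚ - q)) ≤ 1ℚ → Q ≤ ε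
  bound Q k 0≤Q 1≤ ≤1 = ≤-by (0≤p+q (0≤p*q 0≤Q (p≤q⇒0≤q-p 1≤))
    (0≤p*q (ℚ.<⇒≤ 0<ε) (0≤p+q (p≤q⇒0≤q-p ≤1) 0≤Q))) (eq Q k q ε)
  use : ∃[ N ] (∀ n → N ℕ.≤ n → 1ℚ ≤ fromℕ n * ((1ℚ - q) * ε)) → Eventually λ n → ∣ q ^ℚ n ∣ ≤ ε
  use (N , 1≤) = N , λ n n≥ → subst (_≤ ε) (sym (ℚ.0≤p⇒∣p∣≡p (0≤^ n 0≤q)))
    (bound (q ^ℚ n) (fromℕ n) (0≤^ n 0≤q) (1≤ n n≥) (bernoulli 0≤q n))

½<1 : ½ < 1ℚ
½<1 = ℚ.*<* (ℤ.+<+ (ℕ.s≤s (ℕ.s≤s ℕ.z≤n)))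

½≤1 : ½ ≤ 1ℚ
½≤1 = ℚ.<⇒≤ ½<1

0≤½ : 0ℚ ≤ ½
0≤½ = ℚ.<⇒≤ 0<½

Null-½^ : Null (½ ^ℚ_)
Null-½^ = Null-^ 0≤½ ½<1

-- The logarithm

-- At `w = k / (k + 2)` this is `log-term k`. A free argument makes the logarithm of a rational
-- ratio available.
artanh-term : ℚ → ℕ → ℚ
artanh-term w j = (+ 2 / suc (2 ℕ.* j)) * w ^ℚ suc (2 ℕ.* j)

2artanh : ℚ → ℕ → ℚ
2artanh w n = ∑<ℚ n (artanh-term w)

^-2* : ∀ w j → w ^ℚ (2 ℕ.* j) ≡ (w * w) ^ℚ j
^-2* w j = trans (^-+ w j (j ℕ.+ 0))
  (trans (cong (λ i → w ^ℚ j * w ^ℚ i) (ℕ.+-identityʳ j)) (sym (^-distribʳ-* w w j)))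

artanh-coeff : ∀ j → (+ 2 / suc (2 ℕ.* j)) * fromℕ (suc (2 ℕ.* j)) ≡ 2ℚ
artanh-coeff j = /-cancel (+ 2) (2 ℕ.* j)

2artanh-neg : ∀ w n → 2artanh (- w) n ≡ - 2artanh w n
2artanh-neg w zero    = refl
2artanh-neg w (suc n) = trans (cong₂ _+_ (2artanh-neg w n) (trans
    (cong (λ x → (+ 2 / suc (2 ℕ.* n)) * ((- w) * x)) (trans (^-2* (- w) n)
      (trans (cong (_^ℚ n) (-p*-p≡p*p w)) (sym (^-2* w n)))))
    (neg-term (+ 2 / suc (2 ℕ.* n)) w (w ^ℚ (2 ℕ.* n)))))
  (sym (ℚ.neg-distrib-+ (2artanh w n) (artanh-term w n)))
  where
  neg-term : ∀ c w x → c * ((- w) * x) ≡ - (c * (w * x))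
  neg-term = solve-∀ ring

2artanh-0 : ∀ n → 2artanh 0ℚ n ≡ 0ℚ
2artanh-0 zero    = refl
2artanh-0 (suc n) = trans (cong₂ _+_ (2artanh-0 n)
  (zero-term (+ 2 / suc (2 ℕ.* n)) (0ℚ ^ℚ (2 ℕ.* n)))) refl
  where
  zero-term : ∀ c x → c * (0ℚ * x) ≡ 0ℚ
  zero-term = solve-∀ ring

-- The mean value theorem for powers, in place of derivatives. The factor `suc m` will cancel the
-- denominators of the artanh series.
^-difference-upper : ∀ {v w} → 0ℚ ≤ v → v ≤ w → ∀ m →
  w ^ℚ suc m - v ^ℚ suc m ≤ fromℕ (suc m) * ((w - v) * w ^ℚ m)
^-difference-upper {v} {w} 0≤v v≤w zero = ℚ.≤-reflexive (eq v w)
  where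
  eq : ∀ v w → w * 1ℚ - v * 1ℚ ≡ 1ℚ * ((w - v) * 1ℚ)
  eq = solve-∀ ring
^-difference-upper {v} {w} 0≤v v≤w (suc m) =
  step v w (v ^ℚ suc m) (w ^ℚ m) (fromℕ (suc m)) _ (fromℕ-suc (suc m)) 0≤v v≤w
    (^-difference-upper 0≤v v≤w m) (^-monoˡ-≤ (suc m) 0≤v v≤w)
  where
  eq : ∀ v w V W k → (1ℚ + k) * ((w - v) * (w * W)) ≡
    (w * (w * W) - v * V) + (w * (k * ((w - v) * W) - (w * W - V)) + (w - v) * (w * W - V))
  eq = solve-∀ ring
  step : ∀ v w V W k k′ → k′ ≡ 1ℚ + k → 0ℚ ≤ v → v ≤ w → w * W - V ≤ k * ((w - v) * W) → V ≤ w * W →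
    w * (w * W) - v * V ≤ k′ * ((w - v) * (w * W))
  step v w V W k _ refl 0≤v v≤w h V≤W = ≤-by (0≤p+q (0≤p*q (ℚ.≤-trans 0≤v v≤w) (p≤q⇒0≤q-p h))
    (0≤p*q (p≤q⇒0≤q-p v≤w) (p≤q⇒0≤q-p V≤W))) (eq v w V W k)

^-difference-lower : ∀ {v w} → 0ℚ ≤ v → v ≤ w → ∀ m →
  fromℕ (suc m) * ((w - v) * v ^ℚ m) ≤ w ^ℚ suc m - v ^ℚ suc m
^-difference-lower {v} {w} 0≤v v≤w zero = ℚ.≤-reflexive (eq v w)
  where
  eq : ∀ v w → 1ℚ * ((w - v) * 1ℚ) ≡ w * 1ℚ - v * 1ℚ
  eq = solve-∀ ring
^-difference-lower {v} {w} 0≤v v≤w (suc m) =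
  step v w (v ^ℚ m) (w ^ℚ suc m) (fromℕ (suc m)) _ (fromℕ-suc (suc m)) 0≤v v≤w
    (^-difference-lower 0≤v v≤w m) (^-monoˡ-≤ (suc m) 0≤v v≤w)
  where
  eq : ∀ v w V W k → w * W - v * (v * V) ≡
    (1ℚ + k) * ((w - v) * (v * V)) + (v * ((W - v * V) - k * ((w - v) * V)) + (w - v) * (W - v * V))
  eq = solve-∀ ring
  step : ∀ v w V W k k′ → k′ ≡ 1ℚ + k → 0ℚ ≤ v → v ≤ w → k * ((w - v) * V) ≤ W - v * V → v * V ≤ W →
    k′ * ((w - v) * (v * V)) ≤ w * W - v * (v * V)
  step v w V W k _ refl 0≤v v≤w h V≤W = ≤-by (0≤p+q (0≤p*q 0≤v (p≤q⇒0≤q-p h))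
    (0≤p*q (p≤q⇒0≤q-p v≤w) (p≤q⇒0≤q-p V≤W))) (eq v w V W k)

-- Truncation of `1 / (1 - w²)`, the derivative of artanh.
evenPowers : ℚ → ℕ → ℚ
evenPowers w n = ∑<ℚ n (λ j → w ^ℚ (2 ℕ.* j))

evenPowers-telescope : ∀ w n → evenPowers w n * (1ℚ - w * w) ≡ 1ℚ - w ^ℚ (2 ℕ.* n)
evenPowers-telescope w zero    = ℚ.*-zeroˡ (1ℚ - w * w)
evenPowers-telescope w (suc n) = trans (eq₁ (evenPowers w n) w (w ^ℚ (2 ℕ.* n)))
  (trans (cong (_+ w ^ℚ (2 ℕ.* n) * (1ℚ - w * w)) (evenPowers-telescope w n))
    (trans (eq₂ w (w ^ℚ (2 ℕ.* n))) (cong (λ x → 1ℚ - x) next)))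
  where
  eq₁ : ∀ G w x → (G + x) * (1ℚ - w * w) ≡ G * (1ℚ - w * w) + x * (1ℚ - w * w)
  eq₁ = solve-∀ ring
  eq₂ : ∀ w x → (1ℚ - x) + x * (1ℚ - w * w) ≡ 1ℚ - (w * w) * x
  eq₂ = solve-∀ ring
  next : (w * w) * w ^ℚ (2 ℕ.* n) ≡ w ^ℚ (2 ℕ.* suc n)
  next = trans (cong (w * w *_) (^-2* w n)) (sym (^-2* w (suc n)))

0≤evenPowers : ∀ {w} → 0ℚ ≤ w → ∀ n → 0ℚ ≤ evenPowers w n
0≤evenPowers 0≤w zero    = ℚ.≤-refl
0≤evenPowers 0≤w (suc n) = 0≤p+q (0≤evenPowers 0≤w n) (0≤^ (2 ℕ.* n) 0≤w)

-- Termwise mean value bound: `artanh-coeff` cancels the exponent, leaving the truncated derivative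
-- at the larger point. `2artanh-difference-lower` takes it at the smaller one.
2artanh-difference-upper : ∀ {v w} → 0ℚ ≤ v → v ≤ w → ∀ n →
  2artanh w n - 2artanh v n ≤ (2ℚ * (w - v)) * evenPowers w n
2artanh-difference-upper {v} {w} 0≤v v≤w zero = ℚ.≤-reflexive (sym (ℚ.*-zeroʳ (2ℚ * (w - v))))
2artanh-difference-upper {v} {w} 0≤v v≤w (suc n) = step
  (2artanh w n) (2artanh v n) (+ 2 / suc (2 ℕ.* n)) (w ^ℚ suc (2 ℕ.* n)) (v ^ℚ suc (2 ℕ.* n))
  (fromℕ (suc (2 ℕ.* n))) (w - v) (w ^ℚ (2 ℕ.* n)) (evenPowers w n)
  (2artanh-difference-upper 0≤v v≤w n) (0≤/ 2 (2 ℕ.* n)) (artanh-coeff n) (^-difference-upper 0≤v v≤w (2 ℕ.* n))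
  where
  eq : ∀ A B c W V k d p G → (2ℚ * d) * G + (c * k) * (d * p) ≡
    ((A + c * W) - (B + c * V)) + (((2ℚ * d) * G - (A - B)) + c * (k * (d * p) - (W - V)))
  eq = solve-∀ ring
  step : ∀ A B c W V k d p G → A - B ≤ (2ℚ * d) * G → 0ℚ ≤ c → c * k ≡ 2ℚ → W - V ≤ k * (d * p) →
    (A + c * W) - (B + c * V) ≤ (2ℚ * d) * (G + p)
  step A B c W V k d p G h 0≤c ck≡2 h′ = ℚ.≤-trans
    (≤-by (0≤p+q (p≤q⇒0≤q-p h) (0≤p*q 0≤c (p≤q⇒0≤q-p h′))) (eq A B c W V k d p G))
    (ℚ.≤-reflexive (trans (cong (λ x → (2ℚ * d) * G + x * (d * p)) ck≡2) (eq′ d p G)))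
    where
    eq′ : ∀ d p G → (2ℚ * d) * G + 2ℚ * (d * p) ≡ (2ℚ * d) * (G + p)
    eq′ = solve-∀ ring

2artanh-difference-lower : ∀ {v w} → 0ℚ ≤ v → v ≤ w → ∀ n →
  (2ℚ * (w - v)) * evenPowers v n ≤ 2artanh w n - 2artanh v n
2artanh-difference-lower {v} {w} 0≤v v≤w zero = ℚ.≤-reflexive (ℚ.*-zeroʳ (2ℚ * (w - v)))
2artanh-difference-lower {v} {w} 0≤v v≤w (suc n) = step
  (2artanh w n) (2artanh v n) (+ 2 / suc (2 ℕ.* n)) (w ^ℚ suc (2 ℕ.* n)) (v ^ℚ suc (2 ℕ.* n))
  (fromℕ (suc (2 ℕ.* n))) (w - v) (v ^ℚ (2 ℕ.* n)) (evenPowers v n)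
  (2artanh-difference-lower 0≤v v≤w n) (0≤/ 2 (2 ℕ.* n)) (artanh-coeff n) (^-difference-lower 0≤v v≤w (2 ℕ.* n))
  where
  eq : ∀ A B c W V k d p G → (A + c * W) - (B + c * V) ≡
    ((2ℚ * d) * G + (c * k) * (d * p)) + (((A - B) - (2ℚ * d) * G) + c * ((W - V) - k * (d * p)))
  eq = solve-∀ ring
  step : ∀ A B c W V k d p G → (2ℚ * d) * G ≤ A - B → 0ℚ ≤ c → c * k ≡ 2ℚ → k * (d * p) ≤ W - V →
    (2ℚ * d) * (G + p) ≤ (A + c * W) - (B + c * V)
  step A B c W V k d p G h 0≤c ck≡2 h′ = ℚ.≤-trans
    (ℚ.≤-reflexive (trans (eq′ d p G) (cong (λ x → (2ℚ * d) * G + x * (d * p)) (sym ck≡2))))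
    (≤-by (0≤p+q (p≤q⇒0≤q-p h) (0≤p*q 0≤c (p≤q⇒0≤q-p h′))) (eq A B c W V k d p G))
    where
    eq′ : ∀ d p G → (2ℚ * d) * (G + p) ≡ (2ℚ * d) * G + 2ℚ * (d * p)
    eq′ = solve-∀ ring

-- The Cayley transform and the growth of the logarithm

0≤⇒0<+1 : ∀ {x} → 0ℚ ≤ x → 0ℚ < x + 1ℚ
0≤⇒0<+1 0≤x = ℚ.+-mono-≤-< 0≤x 0<1

0≤2 : 0ℚ ≤ 2ℚ
0≤2 = 0≤p+q 0≤1 0≤1

0≤4 : 0ℚ ≤ 4ℚ
0≤4 = 0≤p+q 0≤2 0≤2

abstract
  -- (x - 1) / (x + 1), with junk value 0 for x ≤ -1.
  cayley : ℚ → ℚ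
  cayley x with 0ℚ ℚ.<? x + 1ℚ
  ... | yes 0<x+1 = (x - 1ℚ) * proj₁ (reciprocal (x + 1ℚ) 0<x+1)
  ... | no  _     = 0ℚ

  cayley-spec : ∀ {x} → 0ℚ ≤ x → cayley x * (x + 1ℚ) ≡ x - 1ℚ
  cayley-spec {x} 0≤x with 0ℚ ℚ.<? x + 1ℚ
  ... | no  ≮ = contradiction (0≤⇒0<+1 0≤x) ≮
  ... | yes 0<x+1 = spec (x - 1ℚ) (x + 1ℚ) (reciprocal (x + 1ℚ) 0<x+1)
    where
    eq : ∀ a b r → (a * r) * b ≡ a * (b * r)
    eq = solve-∀ ring
    spec : ∀ a b (r : ∃[ r ] 0ℚ < r × b * r ≡ 1ℚ) → (a * proj₁ r) * b ≡ a
    spec a b (r , _ , br≡1) = trans (eq a b r) (trans (cong (a *_) br≡1) (ℚ.*-identityʳ a))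

*-cancelʳ : ∀ {a b c} → 0ℚ < c → a * c ≡ b * c → a ≡ b
*-cancelʳ {a} {b} {c} 0<c ac≡bc = ℚ.≤-antisym (cancel a b ac≡bc) (cancel b a (sym ac≡bc))
  where
  cancel : ∀ a b → a * c ≡ b * c → a ≤ b
  cancel a b e = ℚ.*-cancelʳ-≤-pos c ⦃ ℚ.positive 0<c ⦄ (ℚ.≤-reflexive e)

cayley-unique : ∀ {x w} → 0ℚ ≤ x → w * (x + 1ℚ) ≡ x - 1ℚ → cayley x ≡ w
cayley-unique 0≤x spec = *-cancelʳ (0≤⇒0<+1 0≤x) (trans (cayley-spec 0≤x) (sym spec))

-- Denominators are cleared because the transform is known only through its defining equation.
-- Together with `cayley-1-w²` this turns each slope inequality in `v` and `w` into a polynomial one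
-- in `x` and `y`.
cayley-difference : ∀ v w x y → v * (x + 1ℚ) ≡ x - 1ℚ → w * (y + 1ℚ) ≡ y - 1ℚ →
  ((x + 1ℚ) * (y + 1ℚ)) * (w - v) ≡ 2ℚ * (y - x)
cayley-difference v w x y hv hw = trans (eq₁ v w x y)
  (trans (cong₂ (λ a b → (x + 1ℚ) * a - (y + 1ℚ) * b) hw hv) (eq₂ x y))
  where
  eq₁ : ∀ v w x y → ((x + 1ℚ) * (y + 1ℚ)) * (w - v) ≡ (x + 1ℚ) * (w * (y + 1ℚ)) - (y + 1ℚ) * (v * (x + 1ℚ))
  eq₁ = solve-∀ ring
  eq₂ : ∀ x y → (x + 1ℚ) * (y - 1ℚ) - (y + 1ℚ) * (x - 1ℚ) ≡ 2ℚ * (y - x)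
  eq₂ = solve-∀ ring

cayley-1-w² : ∀ w x → w * (x + 1ℚ) ≡ x - 1ℚ →
  ((x + 1ℚ) * (x + 1ℚ)) * (1ℚ - w * w) ≡ 4ℚ * x
cayley-1-w² w x hw = trans (eq₁ w x) (trans (cong (λ a → (x + 1ℚ) * (x + 1ℚ) - a * a) hw) (eq₂ x))
  where
  eq₁ : ∀ w x → ((x + 1ℚ) * (x + 1ℚ)) * (1ℚ - w * w) ≡ (x + 1ℚ) * (x + 1ℚ) - (w * (x + 1ℚ)) * (w * (x + 1ℚ))
  eq₁ = solve-∀ ring
  eq₂ : ∀ x → (x + 1ℚ) * (x + 1ℚ) - (x - 1ℚ) * (x - 1ℚ) ≡ 4ℚ * x
  eq₂ = solve-∀ ring

cayley-mono-≤ : ∀ {x y} → 0ℚ ≤ x → x ≤ y → cayley x ≤ cayley y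
cayley-mono-≤ {x} {y} 0≤x x≤y = 0≤q-p⇒p≤q (*-cancel-0≤ (0<p*q (0≤⇒0<+1 0≤x) (0≤⇒0<+1 0≤y))
  (subst (0ℚ ≤_) (sym (cayley-difference (cayley x) (cayley y) x y (cayley-spec 0≤x) (cayley-spec 0≤y)))
    (0≤p*q 0≤2 (p≤q⇒0≤q-p x≤y))))
  where
  0≤y : 0ℚ ≤ y
  0≤y = ℚ.≤-trans 0≤x x≤y

cayley-1 : cayley 1ℚ ≡ 0ℚ
cayley-1 = cayley-unique 0≤1 refl

0≤cayley : ∀ {x} → 1ℚ ≤ x → 0ℚ ≤ cayley x
0≤cayley {x} 1≤x = subst (_≤ cayley x) cayley-1 (cayley-mono-≤ 0≤1 1≤x)

cayley<1 : ∀ {x} → 0ℚ ≤ x → cayley x < 1ℚ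
cayley<1 {x} 0≤x = ℚ.*-cancelʳ-<-nonNeg (x + 1ℚ) ⦃ ℚ.nonNegative (ℚ.<⇒≤ (0≤⇒0<+1 0≤x)) ⦄
  (subst₂ _<_ (sym (cayley-spec 0≤x)) (sym (ℚ.*-identityˡ (x + 1ℚ))) (ℚ.+-monoʳ-< x -1<1))
  where
  -1<1 : - 1ℚ < 1ℚ
  -1<1 = ℚ.*<* ℤ.-<+

-- The partial sums of log x = 2 artanh ((x - 1) / (x + 1)), as in the definition of log.
lg : ℚ → ℕ → ℚ
lg x = 2artanh (cayley x)

-- Up to the error cayley x ^ 2n of truncating the artanh series, log (x + u x) - log x
-- lies between u - u² and u.
lg-difference-upper : ∀ {x u} → 0ℚ ≤ u → 1ℚ ≤ x → ∀ n → lg (x + u * x) n - lg x n ≤ u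
lg-difference-upper {x} {u} 0≤u 1≤x n = ℚ.≤-trans
  (2artanh-difference-upper (0≤cayley 1≤x) (cayley-mono-≤ 0≤x x≤y) n)
  (combine (cayley y) (cayley x) (evenPowers (cayley y) n) (cayley-spec 0≤x) (cayley-spec 0≤y)
    (0≤evenPowers (0≤cayley (ℚ.≤-trans 1≤x x≤y)) n)
    (subst (_≤ 1ℚ) (sym (evenPowers-telescope (cayley y) n))
      (≤-by (0≤^ (2 ℕ.* n) (0≤cayley (ℚ.≤-trans 1≤x x≤y))) (eq₀ (cayley y ^ℚ (2 ℕ.* n))))))
  where
  0≤x : 0ℚ ≤ x
  0≤x = ℚ.≤-trans 0≤1 1≤x
  y : ℚ
  y = x + u * x
  x≤y : x ≤ y
  x≤y = ≤-by (0≤p*q 0≤u 0≤x) refl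
  0≤y : 0ℚ ≤ y
  0≤y = ℚ.≤-trans 0≤x x≤y
  eq₀ : ∀ q → 1ℚ ≡ (1ℚ - q) + q
  eq₀ = solve-∀ ring
  eq₁ : ∀ u w v x y → ((x + 1ℚ) * ((y + 1ℚ) * (y + 1ℚ))) * (u * (1ℚ - w * w) - 2ℚ * (w - v)) ≡
    (u * (x + 1ℚ)) * (((y + 1ℚ) * (y + 1ℚ)) * (1ℚ - w * w)) - (2ℚ * (y + 1ℚ)) * (((x + 1ℚ) * (y + 1ℚ)) *
        (w - v))
  eq₁ = solve-∀ ring
  eq₂ : ∀ u x → (u * (x + 1ℚ)) * (4ℚ * (x + u * x)) - (2ℚ * ((x + u * x) + 1ℚ)) * (2ℚ * ((x + u * x) - x)) ≡
    4ℚ * (u * (u * x))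
  eq₂ = solve-∀ ring
  eq₃ : ∀ u w v G → u ≡ (2ℚ * (w - v)) * G + (u * (1ℚ - G * (1ℚ - w * w)) + G * (u * (1ℚ - w * w) - 2ℚ *
      (w - v)))
  eq₃ = solve-∀ ring
  combine : ∀ w v G → v * (x + 1ℚ) ≡ x - 1ℚ → w * (y + 1ℚ) ≡ y - 1ℚ → 0ℚ ≤ G → G * (1ℚ - w * w) ≤ 1ℚ →
    (2ℚ * (w - v)) * G ≤ u
  combine w v G hv hw 0≤G G≤ = ≤-by (0≤p+q (0≤p*q 0≤u (p≤q⇒0≤q-p G≤)) (0≤p*q 0≤G slope)) (eq₃ u w v G)
    where
    -- Multiplied by `(x + 1) (y + 1)²` the right side becomes `4 u² x`.
    slope : 0ℚ ≤ u * (1ℚ - w * w) - 2ℚ * (w - v)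
    slope = *-cancel-0≤ (0<p*q (0≤⇒0<+1 0≤x) (0<p*q (0≤⇒0<+1 0≤y) (0≤⇒0<+1 0≤y)))
      (subst (0ℚ ≤_) (sym (trans (eq₁ u w v x y)
          (cong₂ (λ a b → (u * (x + 1ℚ)) * a - (2ℚ * (y + 1ℚ)) * b)
            (cayley-1-w² w y hw) (cayley-difference v w x y hv hw))))
        (subst (0ℚ ≤_) (sym (eq₂ u x)) (0≤p*q 0≤4 (0≤p*q 0≤u (0≤p*q 0≤u 0≤x)))))

lg-difference-lower : ∀ {x u} → 0ℚ ≤ u → 1ℚ ≤ x → ∀ n →
  (u - u * u) - cayley x ^ℚ (2 ℕ.* n) ≤ lg (x + u * x) n - lg x n
lg-difference-lower {x} {u} 0≤u 1≤x n = ℚ.≤-trans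
  (combine (cayley y) (cayley x) (evenPowers (cayley x) n) (cayley x ^ℚ (2 ℕ.* n))
    (cayley-spec 0≤x) (cayley-spec 0≤y) (0≤evenPowers 0≤v n) (evenPowers-telescope (cayley x) n) (0≤^
        (2 ℕ.* n) 0≤v))
  (2artanh-difference-lower 0≤v (cayley-mono-≤ 0≤x x≤y) n)
  where
  0≤x : 0ℚ ≤ x
  0≤x = ℚ.≤-trans 0≤1 1≤x
  0≤v : 0ℚ ≤ cayley x
  0≤v = 0≤cayley 1≤x
  y : ℚ
  y = x + u * x
  x≤y : x ≤ y
  x≤y = ≤-by (0≤p*q 0≤u 0≤x) refl
  0≤y : 0ℚ ≤ y
  0≤y = ℚ.≤-trans 0≤x x≤y
  eq₁ : ∀ u w v x y → (((x + 1ℚ) * (x + 1ℚ)) * (y + 1ℚ)) * (2ℚ * (w - v) - (u - u * u) * (1ℚ - v * v)) ≡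
    (2ℚ * (x + 1ℚ)) * (((x + 1ℚ) * (y + 1ℚ)) * (w - v)) - ((u - u * u) * (y + 1ℚ)) * (((x + 1ℚ) *
        (x + 1ℚ)) * (1ℚ - v * v))
  eq₁ = solve-∀ ring
  eq₂ : ∀ u x → (2ℚ * (x + 1ℚ)) * (2ℚ * ((x + u * x) - x)) - ((u - u * u) * ((x + u * x) + 1ℚ)) * (4ℚ * x) ≡
    4ℚ * ((u * x) * ((u * u) * x + u))
  eq₂ = solve-∀ ring
  eq₃ : ∀ u w v G → (2ℚ * (w - v)) * G ≡
    (u - u * u) * (G * (1ℚ - v * v)) + G * (2ℚ * (w - v) - (u - u * u) * (1ℚ - v * v))
  eq₃ = solve-∀ ring
  eq₄ : ∀ u p → (u - u * u) * (1ℚ - p) ≡ ((u - u * u) - p) + p * ((1ℚ - u) * (1ℚ - u) + u)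
  eq₄ = solve-∀ ring
  combine : ∀ w v G p → v * (x + 1ℚ) ≡ x - 1ℚ → w * (y + 1ℚ) ≡ y - 1ℚ → 0ℚ ≤ G →
      G * (1ℚ - v * v) ≡ 1ℚ - p → 0ℚ ≤ p →
    (u - u * u) - p ≤ (2ℚ * (w - v)) * G
  combine w v G p hv hw 0≤G G≡ 0≤p = ℚ.≤-trans
    -- This uses `u - u² ≤ 1`, in the form `1 - u + u² = (1 - u)² + u`.
    (≤-by (0≤p*q 0≤p (0≤p+q (0≤p² (1ℚ - u)) 0≤u)) (eq₄ u p))
    (≤-by (0≤p*q 0≤G slope) (trans (eq₃ u w v G)
      (cong (λ a → (u - u * u) * a + G * (2ℚ * (w - v) - (u - u * u) * (1ℚ - v * v))) G≡)))
    where
    -- The quotient `2 (w - v) / (1 - v²)` is `u (x + 1) / (y + 1) = u - u (u x) / (y +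
    -- 1)`, and the loss is at most `u²` because `x ≤ y + 1`.
    slope : 0ℚ ≤ 2ℚ * (w - v) - (u - u * u) * (1ℚ - v * v)
    slope = *-cancel-0≤ (0<p*q (0<p*q (0≤⇒0<+1 0≤x) (0≤⇒0<+1 0≤x)) (0≤⇒0<+1 0≤y))
      (subst (0ℚ ≤_) (sym (trans (eq₁ u w v x y)
          (cong₂ (λ a b → (2ℚ * (x + 1ℚ)) * b - ((u - u * u) * (y + 1ℚ)) * a)
            (cayley-1-w² v x hv) (cayley-difference v w x y hv hw))))
        (subst (0ℚ ≤_) (sym (eq₂ u x)) (0≤p*q 0≤4
          (0≤p*q (0≤p*q 0≤u 0≤x) (0≤p+q (0≤p*q (0≤p*q 0≤u 0≤u) 0≤x) 0≤u)))))

-- A common bound `ω` for the Cayley images makes the truncation error the same at all points of a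
-- subdivision.
lg-difference : ∀ {x u ω} → 0ℚ ≤ u → 1ℚ ≤ x → cayley x ≤ ω → ∀ n →
  ∣ (lg (x + u * x) n - lg x n) - u ∣ ≤ u * u + ω ^ℚ n
lg-difference {x} {u} {ω} 0≤u 1≤x v≤ω n = bound (lg (x + u * x) n - lg x n) (ω ^ℚ n)
    (cayley x ^ℚ (2 ℕ.* n)) (lg-difference-upper 0≤u 1≤x n) (lg-difference-lower 0≤u 1≤x n)
    (0≤^ n (ℚ.≤-trans 0≤v v≤ω)) v²ⁿ≤ωⁿ
  where
  0≤v : 0ℚ ≤ cayley x
  0≤v = 0≤cayley 1≤x
  v²ⁿ≤ωⁿ : cayley x ^ℚ (2 ℕ.* n) ≤ ω ^ℚ n
  v²ⁿ≤ωⁿ = ℚ.≤-trans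
    (^-antimonoʳ-≤ n (n ℕ.+ 0) 0≤v (ℚ.<⇒≤ (cayley<1 (ℚ.≤-trans 0≤1 1≤x))))
    (subst (λ m → cayley x ^ℚ m ≤ ω ^ℚ n) (sym (ℕ.+-identityʳ n)) (^-monoˡ-≤ n 0≤v v≤ω))
  bound : ∀ d Ω p → d ≤ u → (u - u * u) - p ≤ d → 0ℚ ≤ Ω → p ≤ Ω → ∣ d - u ∣ ≤ u * u + Ω
  bound d Ω p d≤u ≤d 0≤Ω p≤Ω = p≤q∧-p≤q⇒∣p∣≤q
    (≤-by (0≤p+q (p≤q⇒0≤q-p d≤u) (0≤p+q 0≤Ω (0≤p*q 0≤u 0≤u))) (upper d u Ω))
    (≤-by (0≤p+q (p≤q⇒0≤q-p ≤d) (p≤q⇒0≤q-p p≤Ω)) (lower d u Ω p))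
    where
    upper : ∀ d u Ω → u * u + Ω ≡ (d - u) + ((u - d) + (Ω + u * u))
    upper = solve-∀ ring
    lower : ∀ d u Ω p → u * u + Ω ≡ (- (d - u)) + ((d - ((u - u * u) - p)) + (Ω - p))
    lower = solve-∀ ring

lg-1 : ∀ n → lg 1ℚ n ≡ 0ℚ
lg-1 n = trans (cong (λ w → 2artanh w n) cayley-1) (2artanh-0 n)

-- The functional equation of the logarithm

module _ {x y : ℚ} (1≤x : 1ℚ ≤ x) (1≤y : 1ℚ ≤ y) where

  private
    ω : ℚ
    ω = cayley (x * y)

    shift : ℕ → ℚ → ℚ
    shift n z = lg (x * z) n - lg z n

    0≤x : 0ℚ ≤ x
    0≤x = ℚ.≤-trans 0≤1 1≤x

    z≤x*z : ∀ {z} → 1ℚ ≤ z → z ≤ x * z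
    z≤x*z {z} 1≤z = ≤-by (0≤p*q (p≤q⇒0≤q-p 1≤x) (ℚ.≤-trans 0≤1 1≤z)) (eq x z)
      where
      eq : ∀ x z → x * z ≡ z + (x - 1ℚ) * z
      eq = solve-∀ ring

    -- Adding `δ` to `z` multiplies both `z` and `x z` by the same `1 + u`, where `u = δ / z ≤ δ`.
    -- The leading terms `u` therefore cancel and only the two error terms survive.
    shift-step : ∀ {z δ} → 1ℚ ≤ z → z ≤ y → 0ℚ ≤ δ → ∀ n →
      ∣ shift n (z + δ) - shift n z ∣ ≤ 2ℚ * (δ * δ + ω ^ℚ n)
    shift-step {z} {δ} 1≤z z≤y 0≤δ n = use (reciprocal z (ℚ.<-≤-trans 0<1 1≤z))
      where
      0≤z : 0ℚ ≤ z
      0≤z = ℚ.≤-trans 0≤1 1≤z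
      xz≤xy : x * z ≤ x * y
      xz≤xy = *-mono-≤ 0≤x (ℚ.≤-trans 0≤1 1≤y) ℚ.≤-refl z≤y
      use : ∃[ r ] 0ℚ < r × z * r ≡ 1ℚ → ∣ shift n (z + δ) - shift n z ∣ ≤ 2ℚ * (δ * δ + ω ^ℚ n)
      use (r , 0<r , zr≡1) = subst₂ (λ a b → ∣ (lg a n - lg b n) - shift n z ∣ ≤ 2ℚ * (δ * δ + ω ^ℚ n))
          (trans (eq₁ x z (δ * r)) (cong (λ d → x * (z + d)) urz≡δ)) (cong (λ d → z + d) urz≡δ)
          (combine (lg (x * z + u * (x * z)) n) (lg (x * z) n) (lg (z + u * z) n) (lg z n) u (ω ^ℚ n)
            0≤u u≤δ
            (lg-difference 0≤u (ℚ.≤-trans 1≤z (z≤x*z 1≤z)) (cayley-mono-≤ (0≤p*q 0≤x 0≤z) xz≤xy) n)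
            (lg-difference 0≤u 1≤z (cayley-mono-≤ 0≤z (ℚ.≤-trans (z≤x*z 1≤z) xz≤xy)) n))
        where
        u : ℚ
        u = δ * r
        0≤u : 0ℚ ≤ u
        0≤u = 0≤p*q 0≤δ (ℚ.<⇒≤ 0<r)
        assoc : ∀ δ r z → (δ * r) * z ≡ δ * (z * r)
        assoc = solve-∀ ring
        urz≡δ : (δ * r) * z ≡ δ
        urz≡δ = trans (assoc δ r z) (trans (cong (δ *_) zr≡1) (ℚ.*-identityʳ δ))
        eq₁ : ∀ x z u → x * z + u * (x * z) ≡ x * (z + u * z)
        eq₁ = solve-∀ ring
        eq₂ : ∀ u z → u * z ≡ u + u * (z - 1ℚ)
        eq₂ = solve-∀ ring
        u≤δ : u ≤ δ
        u≤δ = subst (u ≤_) urz≡δ (≤-by (0≤p*q 0≤u (p≤q⇒0≤q-p 1≤z)) (eq₂ u z))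
        combine : ∀ A B C D u Ω → 0ℚ ≤ u → u ≤ δ → ∣ (A - B) - u ∣ ≤ u * u + Ω → ∣ (C - D) - u ∣ ≤ u * u + Ω →
          ∣ (A - C) - (B - D) ∣ ≤ 2ℚ * (δ * δ + Ω)
        combine A B C D u Ω 0≤u u≤δ h h′ = subst (_≤ 2ℚ * (δ * δ + Ω)) (cong ∣_∣ (sym (eq₃ A B C D u)))
          (ℚ.≤-trans (∣p+q∣≤ ((A - B) - u) (- ((C - D) - u)) h
              (subst (_≤ u * u + Ω) (sym (ℚ.∣-p∣≡∣p∣ ((C - D) - u))) h′))
            (≤-by (0≤p*q 0≤2 (0≤p*q (p≤q⇒0≤q-p u≤δ) (0≤p+q 0≤δ 0≤u))) (eq₄ u δ Ω)))
          where
          eq₃ : ∀ A B C D u → (A - C) - (B - D) ≡ ((A - B) - u) + (- ((C - D) - u))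
          eq₃ = solve-∀ ring
          eq₄ : ∀ u δ Ω → 2ℚ * (δ * δ + Ω) ≡ ((u * u + Ω) + (u * u + Ω)) + 2ℚ * ((δ - u) * (δ + u))
          eq₄ = solve-∀ ring

    shift-steps : ∀ δ → 0ℚ ≤ δ → ∀ n i → 1ℚ + fromℕ i * δ ≤ y →
      ∣ shift n (1ℚ + fromℕ i * δ) - shift n 1ℚ ∣ ≤ fromℕ i * (2ℚ * (δ * δ + ω ^ℚ n))
    shift-steps δ 0≤δ n zero _ = ℚ.≤-reflexive (trans
      (cong ∣_∣ (trans (cong (λ z → shift n z - shift n 1ℚ) (eq δ)) (ℚ.+-inverseʳ (shift n 1ℚ))))
      (sym (ℚ.*-zeroˡ (2ℚ * (δ * δ + ω ^ℚ n)))))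
      where
      eq : ∀ δ → 1ℚ + 0ℚ * δ ≡ 1ℚ
      eq = solve-∀ ring
    shift-steps δ 0≤δ n (suc i) z′≤y = subst₂ (λ z k → ∣ shift n z - shift n 1ℚ ∣ ≤ k * (2ℚ * (δ * δ + ω ^ℚ n)))
        (sym z′≡z+δ) (sym (fromℕ-suc i))
        (combine (shift n (z + δ)) (shift n z) (shift n 1ℚ) (fromℕ i) (2ℚ * (δ * δ + ω ^ℚ n))
          (shift-step 1≤z z≤y 0≤δ n) (shift-steps δ 0≤δ n i z≤y))
      where
      z : ℚ
      z = 1ℚ + fromℕ i * δ
      eq₁ : ∀ k δ → 1ℚ + (1ℚ + k) * δ ≡ (1ℚ + k * δ) + δ
      eq₁ = solve-∀ ring
      z′≡z+δ : 1ℚ + fromℕ (suc i) * δ ≡ z + δ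
      z′≡z+δ = trans (cong (λ k → 1ℚ + k * δ) (fromℕ-suc i)) (eq₁ (fromℕ i) δ)
      z≤y : z ≤ y
      z≤y = ℚ.≤-trans (≤-by 0≤δ z′≡z+δ) z′≤y
      1≤z : 1ℚ ≤ z
      1≤z = ≤-by (0≤p*q (0≤fromℕ i) 0≤δ) refl
      combine : ∀ A B C k E → ∣ A - B ∣ ≤ E → ∣ B - C ∣ ≤ k * E → ∣ A - C ∣ ≤ (1ℚ + k) * E
      combine A B C k E h h′ = subst₂ _≤_ (cong ∣_∣ (eq₂ A B C)) (eq₃ k E) (∣p+q∣≤ (A - B) (B - C) h h′)
        where
        eq₂ : ∀ A B C → (A - B) + (B - C) ≡ A - C
        eq₂ = solve-∀ ring
        eq₃ : ∀ k E → E + k * E ≡ (1ℚ + k) * E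
        eq₃ = solve-∀ ring

  -- Both lg (x z) and lg z grow by u - O(u²) when z is multiplied by 1 + u, so
  -- cutting [1, y] into K equal parts changes lg (x z) - lg z by O(1/K) in total.
  lg-* : Null (λ n → lg (x * y) n - (lg x n + lg y n))
  lg-* ε 0<ε = refine (archimedean (4ℚ * (e * e)) ε 0<ε)
    where
    e : ℚ
    e = y - 1ℚ
    Goal : Set
    Goal = Eventually λ n → ∣ lg (x * y) n - (lg x n + lg y n) ∣ ≤ ε

    -- With `δ = e / K` the total error is `2 e² / K + 2 K ωⁿ`. The hypothesis on `K` makes the
    -- first summand at most `ε / 2`; with `K` fixed, a large `n` does the same for the second.
    subdivide : ∀ K → 4ℚ * (e * e) ≤ fromℕ K * ε → (∃[ r ] 0ℚ < r × fromℕ K * r ≡ 1ℚ) → Goal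
    subdivide K 4e²≤Kε (r , 0<r , Kr≡1) =
      conclude (Null-* (2ℚ * fromℕ K) (Null-^ (0≤cayley 1≤xy) (cayley<1 0≤xy)) (½ * ε) (0<p*q 0<½ 0<ε))
      where
      δ : ℚ
      δ = e * r
      0≤δ : 0ℚ ≤ δ
      0≤δ = 0≤p*q (p≤q⇒0≤q-p 1≤y) (ℚ.<⇒≤ 0<r)
      1≤xy : 1ℚ ≤ x * y
      1≤xy = ℚ.≤-trans 1≤y (z≤x*z 1≤y)
      0≤xy : 0ℚ ≤ x * y
      0≤xy = ℚ.≤-trans 0≤1 1≤xy
      1+Kδ≡y : 1ℚ + fromℕ K * δ ≡ y
      1+Kδ≡y = trans (eq₁ (fromℕ K) y r) (trans (cong (λ a → 1ℚ + (y - 1ℚ) * a) Kr≡1) (eq₂ y))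
        where
        eq₁ : ∀ K y r → 1ℚ + K * ((y - 1ℚ) * r) ≡ 1ℚ + (y - 1ℚ) * (K * r)
        eq₁ = solve-∀ ring
        eq₂ : ∀ y → 1ℚ + (y - 1ℚ) * 1ℚ ≡ y
        eq₂ = solve-∀ ring
      bound : ∀ A B C D k Ω → 0ℚ ≤ r → 4ℚ * (e * e) ≤ k * ε → k * r ≡ 1ℚ → ∣ (2ℚ * k) * Ω ∣ ≤ ½ * ε →
        D ≡ 0ℚ → ∣ (A - B) - (C - D) ∣ ≤ k * (2ℚ * ((e * r) * (e * r) + Ω)) → ∣ A - (C + B) ∣ ≤ ε
      bound A B C D k Ω 0≤r h kr≡1 hΩ refl h′ = subst (_≤ ε) (cong ∣_∣ (eq₃ A B C))
        (ℚ.≤-trans h′ (≤-by (0≤p+q (0≤p*q 0≤½ (0≤p*q 0≤r (p≤q⇒0≤q-p h))) (∣p∣≤q⇒0≤q-p hΩ))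
          (trans (eq₄ ε) (trans (cong (λ a → (½ * ε + ½ * (a * ε)) + (2ℚ * (e * e * r)) * (a - 1ℚ))
              (sym kr≡1)) (eq₅ k e r Ω ε)))))
        where
        eq₃ : ∀ A B C → (A - B) - (C - 0ℚ) ≡ A - (C + B)
        eq₃ = solve-∀ ring
        eq₄ : ∀ ε → ε ≡ (½ * ε + ½ * (1ℚ * ε)) + (2ℚ * (e * e * r)) * (1ℚ - 1ℚ)
        eq₄ ε = eq e r ε
          where
          eq : ∀ e r ε → ε ≡ (½ * ε + ½ * (1ℚ * ε)) + (2ℚ * (e * e * r)) * (1ℚ - 1ℚ)
          eq = solve-∀ ring
        eq₅ : ∀ k e r Ω ε → (½ * ε + ½ * ((k * r) * ε)) + (2ℚ * (e * e * r)) * (k * r - 1ℚ) ≡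
          k * (2ℚ * ((e * r) * (e * r) + Ω)) + (½ * (r * (k * ε - 4ℚ * (e * e))) + (½ * ε - (2ℚ * k) * Ω))
        eq₅ = solve-∀ ring
      conclude : Eventually (λ n → ∣ (2ℚ * fromℕ K) * cayley (x * y) ^ℚ n ∣ ≤ ½ * ε) → Goal
      conclude (N , small) = N , λ n n≥ →
        bound (lg (x * y) n) (lg y n) (lg x n) (lg 1ℚ n) (fromℕ K) (cayley (x * y) ^ℚ n)
          (ℚ.<⇒≤ 0<r) 4e²≤Kε Kr≡1 (small n n≥) (lg-1 n)
          (subst₂ (λ a b → ∣ shift n a - (lg b n - lg 1ℚ n) ∣ ≤ fromℕ K * (2ℚ * (δ * δ + cayley (x * y) ^ℚ n)))
            1+Kδ≡y (ℚ.*-identityʳ x) (shift-steps δ 0≤δ n K (ℚ.≤-reflexive 1+Kδ≡y)))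

    refine : (∃[ N ] ∀ n → N ℕ.≤ n → 4ℚ * (e * e) ≤ fromℕ n * ε) → Goal
    refine (N , large) = subdivide (suc N) (large (suc N) (ℕ.n≤1+n N)) (reciprocal (fromℕ (suc N))
        (0<fromℕ-suc N))

-- The Cayley transform of `y / x` is `(y - x) / (y + x) = w`, so this is `lg-*` for the factors `x`
-- and `y / x`.
lg-ratio-larger : ∀ {x y} w → 1ℚ ≤ x → x ≤ y → w * (x + y) ≡ y - x → Null (λ n →
    (lg y n - lg x n) - 2artanh w n)
lg-ratio-larger {x} {y} w 1≤x x≤y hw = use (reciprocal x (ℚ.<-≤-trans 0<1 1≤x))
  where
  use : ∃[ r ] 0ℚ < r × x * r ≡ 1ℚ → Null (λ n → (lg y n - lg x n) - 2artanh w n)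
  use (r , 0<r , xr≡1) = Null-cong {y = λ n → lg (x * (y * r)) n - (lg x n + lg (y * r) n)}
    (λ n → trans (cong₂ (λ a b → (lg a n - lg x n) - 2artanh b n) (sym xz≡y) (sym z↦w))
      (eq₃ (lg (x * (y * r)) n) (lg x n) (lg (y * r) n)))
    (lg-* 1≤x 1≤z)
    where
    eq₁ : ∀ x y r → x * (y * r) ≡ y * (x * r)
    eq₁ = solve-∀ ring
    eq₂ : ∀ x y w r → (w * (y * r + 1ℚ)) * x ≡ w * (x * 1ℚ + y * (x * r))
    eq₂ = solve-∀ ring
    eq₃ : ∀ a b c → (a - b) - c ≡ a - (b + c)
    eq₃ = solve-∀ ring
    eq₄ : ∀ x y r → y * (x * r) - x * 1ℚ ≡ (y * r - 1ℚ) * x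
    eq₄ = solve-∀ ring
    xz≡y : x * (y * r) ≡ y
    xz≡y = trans (eq₁ x y r) (trans (cong (y *_) xr≡1) (ℚ.*-identityʳ y))
    yxr≡y : y * (x * r) ≡ y
    yxr≡y = trans (cong (y *_) xr≡1) (ℚ.*-identityʳ y)
    1≤z : 1ℚ ≤ y * r
    1≤z = subst (_≤ y * r) xr≡1 (ℚ.*-monoʳ-≤-nonNeg r ⦃ ℚ.nonNegative (ℚ.<⇒≤ 0<r) ⦄ x≤y)
    z↦w : cayley (y * r) ≡ w
    z↦w = cayley-unique (ℚ.≤-trans 0≤1 1≤z) (*-cancelʳ (ℚ.<-≤-trans 0<1 1≤x) (trans (eq₂ x y w r)
      (trans (cong₂ (λ a b → w * (a + b)) (ℚ.*-identityʳ x) yxr≡y) (trans hw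
        (trans (cong₂ _-_ (sym yxr≡y) (sym (ℚ.*-identityʳ x))) (eq₄ x y r))))))

-- Oddness of artanh reduces `y ≤ x` to the other case. With `y = x (1 + u)` and `w = u / (2 + u)`
-- this is how `log (1 + u)` enters, for either sign of `u`.
lg-ratio : ∀ {x y} w → 1ℚ ≤ x → 1ℚ ≤ y → w * (x + y) ≡ y - x → Null (λ n → (lg y n - lg x n) - 2artanh w n)
lg-ratio {x} {y} w 1≤x 1≤y hw with ℚ.≤-total x y
... | inj₁ x≤y = lg-ratio-larger w 1≤x x≤y hw
... | inj₂ y≤x = Null-cong {y = λ n → - ((lg x n - lg y n) - 2artanh (- w) n)}
    (λ n → trans (eq₁ (lg x n) (lg y n) (2artanh w n))
      (cong (λ a → - ((lg x n - lg y n) - a)) (sym (2artanh-neg w n))))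
    (Null-neg (lg-ratio-larger (- w) 1≤y y≤x (trans (eq₂ x y w) (trans (cong -_ hw) (eq₃ x y)))))
  where
  eq₁ : ∀ a b c → (b - a) - c ≡ - ((a - b) - (- c))
  eq₁ = solve-∀ ring
  eq₂ : ∀ x y w → (- w) * (y + x) ≡ - (w * (x + y))
  eq₂ = solve-∀ ring
  eq₃ : ∀ x y → - (y - x) ≡ x - y
  eq₃ = solve-∀ ring

-- Power series with rational coefficients

∑-cong : ∀ {a b} n → (∀ i → i ℕ.< n → a i ≡ b i) → ∑<ℚ n a ≡ ∑<ℚ n b
∑-cong zero    a≡b = refl
∑-cong (suc n) a≡b = cong₂ _+_ (∑-cong n (λ i i<n → a≡b i (ℕ.m<n⇒m<1+n i<n))) (a≡b n ℕ.≤-refl)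

∑-mono-≤ : ∀ {a b} n → (∀ i → a i ≤ b i) → ∑<ℚ n a ≤ ∑<ℚ n b
∑-mono-≤ zero    a≤b = ℚ.≤-refl
∑-mono-≤ (suc n) a≤b = ℚ.+-mono-≤ (∑-mono-≤ n a≤b) (a≤b n)

0≤∑ : ∀ {a} n → (∀ i → 0ℚ ≤ a i) → 0ℚ ≤ ∑<ℚ n a
0≤∑ zero    0≤a = ℚ.≤-refl
0≤∑ (suc n) 0≤a = 0≤p+q (0≤∑ n 0≤a) (0≤a n)

∑-+ : ∀ (a b : ℕ → ℚ) n → ∑<ℚ n (λ i → a i + b i) ≡ ∑<ℚ n a + ∑<ℚ n b
∑-+ a b zero    = refl
∑-+ a b (suc n) = trans (cong (_+ (a n + b n)) (∑-+ a b n)) (eq (∑<ℚ n a) (∑<ℚ n b) (a n) (b n))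
  where
  eq : ∀ A B x y → (A + B) + (x + y) ≡ (A + x) + (B + y)
  eq = solve-∀ ring

∑-* : ∀ c (a : ℕ → ℚ) n → ∑<ℚ n (λ i → c * a i) ≡ c * ∑<ℚ n a
∑-* c a zero    = sym (ℚ.*-zeroʳ c)
∑-* c a (suc n) = trans (cong (_+ c * a n) (∑-* c a n)) (sym (ℚ.*-distribˡ-+ c (∑<ℚ n a) (a n)))

∑-neg : ∀ (a : ℕ → ℚ) n → ∑<ℚ n (λ i → - a i) ≡ - ∑<ℚ n a
∑-neg a zero    = refl
∑-neg a (suc n) = trans (cong (_+ - a n) (∑-neg a n)) (sym (ℚ.neg-distrib-+ (∑<ℚ n a) (a n)))

∑-0 : ∀ n → ∑<ℚ n (λ _ → 0ℚ) ≡ 0ℚ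
∑-0 zero    = refl
∑-0 (suc n) = trans (ℚ.+-identityʳ (∑<ℚ n (λ _ → 0ℚ))) (∑-0 n)

∑-swap : ∀ (a : ℕ → ℕ → ℚ) m n → ∑<ℚ m (λ i → ∑<ℚ n (a i)) ≡ ∑<ℚ n (λ j → ∑<ℚ m (λ i → a i j))
∑-swap a zero    n = sym (∑-0 n)
∑-swap a (suc m) n = trans (cong (_+ ∑<ℚ n (a m)) (∑-swap a m n))
  (sym (∑-+ (λ j → ∑<ℚ m (λ i → a i j)) (a m) n))

∑-stable : ∀ {a} m n → (∀ i → m ℕ.≤ i → a i ≡ 0ℚ) → m ℕ.≤ n → ∑<ℚ n a ≡ ∑<ℚ m a
∑-stable {a} m n a≡0 m≤n = subst (λ n → ∑<ℚ n a ≡ ∑<ℚ m a) (ℕ.m∸n+n≡m m≤n) (go (n ℕ.∸ m))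
  where
  go : ∀ l → ∑<ℚ (l ℕ.+ m) a ≡ ∑<ℚ m a
  go zero    = refl
  go (suc l) = trans (cong₂ _+_ (go l) (a≡0 (l ℕ.+ m) (ℕ.m≤n+m m l))) (ℚ.+-identityʳ (∑<ℚ m a))

∣∑∣≤∑∣∣ : ∀ (a : ℕ → ℚ) n → ∣ ∑<ℚ n a ∣ ≤ ∑<ℚ n (λ i → ∣ a i ∣)
∣∑∣≤∑∣∣ a zero    = ℚ.≤-refl
∣∑∣≤∑∣∣ a (suc n) = ∣p+q∣≤ (∑<ℚ n a) (a n) (∣∑∣≤∑∣∣ a n) ℚ.≤-refl

∑½^≤2 : ∀ n → ∑<ℚ n (½ ^ℚ_) ≤ 2ℚ
∑½^≤2 n = ≤-by (0≤p*q 0≤2 (0≤^ n 0≤½)) (telescope n)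
  where
  eq : ∀ S x → (S + x) + 2ℚ * (½ * x) ≡ S + 2ℚ * x
  eq = solve-∀ ring
  telescope : ∀ n → 2ℚ ≡ ∑<ℚ n (½ ^ℚ_) + 2ℚ * ½ ^ℚ n
  telescope zero    = refl
  telescope (suc n) = trans (telescope n) (sym (eq (∑<ℚ n (½ ^ℚ_)) (½ ^ℚ n)))

Coeffs : Set
Coeffs = ℕ → ℚ

partial : Coeffs → ℚ → ℕ → ℚ
partial c s n = ∑<ℚ n (λ k → c k * s ^ℚ k)

-- The infinite sum `Σ |cₖ| Rᵏ` need not be rational, so only its partial sums appear and `Bounded`
-- quantifies over all of them.
norm : ℚ → Coeffs → ℕ → ℚ
norm R c n = ∑<ℚ n (λ k → ∣ c k ∣ * R ^ℚ k)

Order : ℕ → Coeffs → Set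
Order i c = ∀ k → k ℕ.< i → c k ≡ 0ℚ

Order-weaken : ∀ {i j c} → i ℕ.≤ j → Order j c → Order i c
Order-weaken i≤j c≡0 k k<i = c≡0 k (ℕ.<-≤-trans k<i i≤j)

one : Coeffs
one zero    = 1ℚ
one (suc _) = 0ℚ

scale : ℚ → Coeffs → Coeffs
scale a c k = a * c k

_⊞_ : Coeffs → Coeffs → Coeffs
(c ⊞ d) k = c k + d k

shift : Coeffs → Coeffs
shift c zero    = 0ℚ
shift c (suc k) = c k

shiftBy : ℕ → Coeffs → Coeffs
shiftBy zero    c = c
shiftBy (suc i) c = shift (shiftBy i c)

-- The sum of the series c i, where c i is assumed to have order at least i.
infiniteSum : (ℕ → Coeffs) → Coeffs
infiniteSum c k = ∑<ℚ (suc k) (λ i → c i k)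

-- The summand `cᵢ sⁱ d(s)` of the product. Writing the Cauchy product as the sum of these makes its
-- norm and its value special cases of the facts about `infiniteSum`.
⊠-term : Coeffs → Coeffs → ℕ → Coeffs
⊠-term c d i = scale (c i) (shiftBy i d)

infixl 7 _⊠_
_⊠_ : Coeffs → Coeffs → Coeffs
c ⊠ d = infiniteSum (⊠-term c d)

power : Coeffs → ℕ → Coeffs
power c zero    = one
power c (suc i) = c ⊠ power c i

Order-scale : ∀ {i} a c → Order i c → Order i (scale a c)
Order-scale a c c≡0 k k<i = trans (cong (a *_) (c≡0 k k<i)) (ℚ.*-zeroʳ a)

Order-⊞ : ∀ {i} c d → Order i c → Order i d → Order i (c ⊞ d)
Order-⊞ c d c≡0 d≡0 k k<i = cong₂ _+_ (c≡0 k k<i) (d≡0 k k<i)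

Order-shift : ∀ {i} c → Order i c → Order (suc i) (shift c)
Order-shift c c≡0 zero    _           = refl
Order-shift c c≡0 (suc k) (ℕ.s≤s k<i) = c≡0 k k<i

Order-shiftBy : ∀ {i} j c → Order i c → Order (j ℕ.+ i) (shiftBy j c)
Order-shiftBy zero    c c≡0 = c≡0
Order-shiftBy (suc j) c c≡0 = Order-shift (shiftBy j c) (Order-shiftBy j c c≡0)

Order-infiniteSum : ∀ {i} c → (∀ j → Order i (c j)) → Order i (infiniteSum c)
Order-infiniteSum c c≡0 k k<i = trans (∑-cong (suc k) (λ j _ → c≡0 j k k<i)) (∑-0 (suc k))

Order-⊠ : ∀ {i j} c d → Order i c → Order j d → Order (i ℕ.+ j) (c ⊠ d)
Order-⊠ {i} {j} c d c≡0 d≡0 k k<i+j = trans (∑-cong (suc k) (λ l _ → term l)) (∑-0 (suc k))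
  where
  term : ∀ l → scale (c l) (shiftBy l d) k ≡ 0ℚ
  term l with ℕ.<-≤-connex l i
  ... | inj₁ l<i = trans (cong (_* shiftBy l d k) (c≡0 l l<i)) (ℚ.*-zeroˡ (shiftBy l d k))
  ... | inj₂ i≤l = Order-scale (c l) (shiftBy l d) (Order-shiftBy l d d≡0) k
                     (ℕ.<-≤-trans k<i+j (ℕ.+-monoˡ-≤ j i≤l))

Order-0 : ∀ {c} → Order 0 c
Order-0 k ()

Order-⊠-term : ∀ c d i → Order i (⊠-term c d i)
Order-⊠-term c d i = Order-scale (c i) (shiftBy i d)
  (subst (λ j → Order j (shiftBy i d)) (ℕ.+-identityʳ i) (Order-shiftBy i d Order-0))

Order-power : ∀ c → Order 1 c → ∀ i → Order i (power c i)
Order-power c c≡0 zero    = Order-0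
Order-power c c≡0 (suc i) = Order-⊠ c (power c i) c≡0 (Order-power c c≡0 i)

-- A coefficient of index `k < n` receives contributions only from the series with `i ≤ k`, and
-- those with `k < i < n` vanish there. Hence the truncations agree exactly, with no error term.
partial-infiniteSum : ∀ c → (∀ i → Order i (c i)) → ∀ s n →
  partial (infiniteSum c) s n ≡ ∑<ℚ n (λ i → partial (c i) s n)
partial-infiniteSum c c≡0 s n = trans (∑-cong n coefficient)
  (∑-swap (λ k i → c i k * s ^ℚ k) n n)
  where
  coefficient : ∀ k → k ℕ.< n → infiniteSum c k * s ^ℚ k ≡ ∑<ℚ n (λ i → c i k * s ^ℚ k)
  coefficient k k<n = trans (cong (_* s ^ℚ k) (sym (∑-stable (suc k) n (λ i k<i → c≡0 i k k<i) k<n)))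
    (trans (ℚ.*-comm (∑<ℚ n (λ i → c i k)) (s ^ℚ k)) (trans (sym (∑-* (s ^ℚ k) (λ i → c i k) n))
      (∑-cong n (λ i _ → ℚ.*-comm (s ^ℚ k) (c i k)))))

partial-scale : ∀ a c s n → partial (scale a c) s n ≡ a * partial c s n
partial-scale a c s n = trans (∑-cong n (λ k _ → ℚ.*-assoc a (c k) (s ^ℚ k)))
  (∑-* a (λ k → c k * s ^ℚ k) n)

partial-⊞ : ∀ c d s n → partial (c ⊞ d) s n ≡ partial c s n + partial d s n
partial-⊞ c d s n = trans (∑-cong n (λ k _ → ℚ.*-distribʳ-+ (s ^ℚ k) (c k) (d k)))
  (∑-+ (λ k → c k * s ^ℚ k) (λ k → d k * s ^ℚ k) n)

partial-shift : ∀ c s n → partial (shift c) s (suc n) ≡ s * partial c s n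
partial-shift c s zero    = sym (ℚ.*-zeroʳ s)
partial-shift c s (suc n) = trans (cong (_+ c n * (s * s ^ℚ n)) (partial-shift c s n))
  (eq s (partial c s n) (c n) (s ^ℚ n))
  where
  eq : ∀ s p c x → s * p + c * (s * x) ≡ s * (p + c * x)
  eq = solve-∀ ring

partial-one : ∀ s n → partial one s (suc n) ≡ 1ℚ
partial-one s zero    = refl
partial-one s (suc n) = trans (cong₂ _+_ (partial-one s n) (ℚ.*-zeroˡ (s ^ℚ suc n))) refl

Sums : Coeffs → ℚ → ℚ → Set
Sums c s v = Null (λ n → partial c s n - v)

Sums-scale : ∀ a c s v → Sums c s v → Sums (scale a c) s (a * v)
Sums-scale a c s v c⟶v = Null-cong {y = λ n → a * (partial c s n - v)}
  (λ n → trans (cong (_- a * v) (partial-scale a c s n)) (eq a (partial c s n) v)) (Null-* a c⟶v)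
  where
  eq : ∀ a p v → a * p - a * v ≡ a * (p - v)
  eq = solve-∀ ring

Sums-⊞ : ∀ c d s v w → Sums c s v → Sums d s w → Sums (c ⊞ d) s (v + w)
Sums-⊞ c d s v w c⟶v d⟶w = Null-cong {y = λ n → (partial c s n - v) + (partial d s n - w)}
  (λ n → trans (cong (_- (v + w)) (partial-⊞ c d s n)) (eq (partial c s n) (partial d s n) v w))
  (Null-+ c⟶v d⟶w)
  where
  eq : ∀ p q v w → (p + q) - (v + w) ≡ (p - v) + (q - w)
  eq = solve-∀ ring

Sums-shift : ∀ c s v → Sums c s v → Sums (shift c) s (s * v)
Sums-shift c s v c⟶v = Null-suc (Null-cong {y = λ n → s * (partial c s n - v)}
  (λ n → trans (cong (_- s * v) (partial-shift c s n)) (eq s (partial c s n) v)) (Null-* s c⟶v))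
  where
  eq : ∀ a p v → a * p - a * v ≡ a * (p - v)
  eq = solve-∀ ring

Sums-shiftBy : ∀ i c s v → Sums c s v → Sums (shiftBy i c) s (s ^ℚ i * v)
Sums-shiftBy zero    c s v c⟶v = subst (Sums c s) (sym (ℚ.*-identityˡ v)) c⟶v
Sums-shiftBy (suc i) c s v c⟶v = subst (Sums (shiftBy (suc i) c) s) (sym (ℚ.*-assoc s (s ^ℚ i) v))
  (Sums-shift (shiftBy i c) s (s ^ℚ i * v) (Sums-shiftBy i c s v c⟶v))

Sums-one : ∀ s → Sums one s 1ℚ
Sums-one s = Null-suc (Null-cong {y = λ _ → 0ℚ} (λ n → cong (_- 1ℚ) (partial-one s n)) Null-0)

-- Majorants and evaluation at half the radius

Bounded : ℚ → ℚ → Coeffs → Set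
Bounded R B c = ∀ n → norm R c n ≤ B

Bounded-weaken : ∀ {R B B′ c} → B ≤ B′ → Bounded R B c → Bounded R B′ c
Bounded-weaken B≤B′ c≤B n = ℚ.≤-trans (c≤B n) B≤B′

norm-scale : ∀ R a c n → norm R (scale a c) n ≡ ∣ a ∣ * norm R c n
norm-scale R a c n = trans (∑-cong n (λ k _ → cong (_* R ^ℚ k) (ℚ.∣p*q∣≡∣p∣*∣q∣ a (c k))))
  (partial-scale ∣ a ∣ (λ k → ∣ c k ∣) R n)

norm-shift : ∀ R c n → norm R (shift c) (suc n) ≡ R * norm R c n
norm-shift R c n = trans (∑-cong (suc n) (λ k _ → cong (_* R ^ℚ k) (abs-shift k)))
  (partial-shift (λ k → ∣ c k ∣) R n)
  where
  abs-shift : ∀ k → ∣ shift c k ∣ ≡ shift (λ k → ∣ c k ∣) k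
  abs-shift zero    = refl
  abs-shift (suc k) = refl

module Majorant {R : ℚ} (0≤R : 0ℚ ≤ R) where

  0≤norm : ∀ c n → 0ℚ ≤ norm R c n
  0≤norm c n = 0≤∑ n (λ k → 0≤p*q (ℚ.0≤∣p∣ (c k)) (0≤^ k 0≤R))

  Bounded-scale : ∀ {B} a c → Bounded R B c → Bounded R (∣ a ∣ * B) (scale a c)
  Bounded-scale {B} a c c≤B n = subst (_≤ ∣ a ∣ * B) (sym (norm-scale R a c n))
    (ℚ.*-monoˡ-≤-nonNeg ∣ a ∣ ⦃ ℚ.nonNegative (ℚ.0≤∣p∣ a) ⦄ (c≤B n))

  Bounded-shift : ∀ {B} c → Bounded R B c → Bounded R (R * B) (shift c)
  Bounded-shift c c≤B zero    = 0≤p*q 0≤R (c≤B 0)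
  Bounded-shift {B} c c≤B (suc n) = subst (_≤ R * B) (sym (norm-shift R c n))
    (ℚ.*-monoˡ-≤-nonNeg R ⦃ ℚ.nonNegative 0≤R ⦄ (c≤B n))

  Bounded-shiftBy : ∀ {B} i c → Bounded R B c → Bounded R (R ^ℚ i * B) (shiftBy i c)
  Bounded-shiftBy {B} zero    c c≤B = subst (λ B → Bounded R B c) (sym (ℚ.*-identityˡ B)) c≤B
  Bounded-shiftBy {B} (suc i) c c≤B = subst (λ B → Bounded R B (shiftBy (suc i) c)) (sym (ℚ.*-assoc R
      (R ^ℚ i) B))
    (Bounded-shift (shiftBy i c) (Bounded-shiftBy i c c≤B))

  Bounded-⊞ : ∀ {B B′} c d → Bounded R B c → Bounded R B′ d → Bounded R (B + B′) (c ⊞ d)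
  Bounded-⊞ c d c≤B d≤B′ n = ℚ.≤-trans
    (∑-mono-≤ n (λ k → ℚ.*-monoʳ-≤-nonNeg (R ^ℚ k) ⦃ ℚ.nonNegative (0≤^ k 0≤R) ⦄ (ℚ.∣p+q∣≤∣p∣+∣q∣ (c k) (d k))))
    (ℚ.≤-trans (ℚ.≤-reflexive (partial-⊞ (λ k → ∣ c k ∣) (λ k → ∣ d k ∣) R n)) (ℚ.+-mono-≤ (c≤B n) (d≤B′ n)))

  Bounded-one : Bounded R 1ℚ one
  Bounded-one zero    = 0≤1
  Bounded-one (suc n) = ℚ.≤-reflexive (trans (∑-cong (suc n) (λ k _ → cong (_* R ^ℚ k) (abs-one k)))
      (partial-one R n))
    where
    abs-one : ∀ k → ∣ one k ∣ ≡ one k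
    abs-one zero    = refl
    abs-one (suc k) = refl

  Bounded-infiniteSum : ∀ c (B : ℕ → ℚ) M → (∀ i → Order i (c i)) → (∀ i → Bounded R (B i) (c i)) →
    (∀ n → ∑<ℚ n B ≤ M) → Bounded R M (infiniteSum c)
  Bounded-infiniteSum c B M c≡0 c≤B B≤M n = ℚ.≤-trans
    (∑-mono-≤ n (λ k → ℚ.*-monoʳ-≤-nonNeg (R ^ℚ k) ⦃ ℚ.nonNegative (0≤^ k 0≤R) ⦄ (∣∑∣≤∑∣∣ (λ i → c i k)
        (suc k))))
    (ℚ.≤-trans (ℚ.≤-reflexive (partial-infiniteSum (λ i k → ∣ c i k ∣) (λ i k k<i → cong ∣_∣
        (c≡0 i k k<i)) R n))
      (ℚ.≤-trans (∑-mono-≤ n (λ i → c≤B i n)) (B≤M n)))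

  ⊠-term-bound : Coeffs → ℚ → ℕ → ℚ
  ⊠-term-bound c B′ i = ∣ c i ∣ * (R ^ℚ i * B′)

  Bounded-⊠-term : ∀ {B′} c d → Bounded R B′ d → ∀ i → Bounded R (⊠-term-bound c B′ i) (⊠-term c d i)
  Bounded-⊠-term c d d≤B′ i = Bounded-scale (c i) (shiftBy i d) (Bounded-shiftBy i d d≤B′)

  ∑⊠-term-bound : ∀ {B B′} c → 0ℚ ≤ B′ → Bounded R B c → ∀ n → ∑<ℚ n (⊠-term-bound c B′) ≤ B * B′
  ∑⊠-term-bound {B} {B′} c 0≤B′ c≤B n = subst (_≤ B * B′) (sym total)
    (ℚ.*-monoʳ-≤-nonNeg B′ ⦃ ℚ.nonNegative 0≤B′ ⦄ (c≤B n))
    where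
    eq : ∀ a b c → a * (b * c) ≡ c * (a * b)
    eq = solve-∀ ring
    total : ∑<ℚ n (⊠-term-bound c B′) ≡ norm R c n * B′
    total = trans (∑-cong n (λ i _ → eq ∣ c i ∣ (R ^ℚ i) B′))
      (trans (∑-* B′ (λ i → ∣ c i ∣ * R ^ℚ i) n) (ℚ.*-comm B′ (norm R c n)))

  Bounded-⊠ : ∀ {B B′} c d → Bounded R B c → Bounded R B′ d → Bounded R (B * B′) (c ⊠ d)
  Bounded-⊠ {B} {B′} c d c≤B d≤B′ = Bounded-infiniteSum (⊠-term c d) (⊠-term-bound c B′) (B * B′)
    (Order-⊠-term c d) (Bounded-⊠-term c d d≤B′) (∑⊠-term-bound c (d≤B′ 0) c≤B)

  Bounded-power : ∀ {B} c → Bounded R B c → ∀ i → Bounded R (B ^ℚ i) (power c i)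
  Bounded-power c c≤B zero    = Bounded-one
  Bounded-power c c≤B (suc i) = Bounded-⊠ c (power c i) c≤B (Bounded-power c c≤B i)

  module Evaluation {s : ℚ} (∣s∣≤ : ∣ s ∣ ≤ ½ * R) where

    -- Half the radius gains `½ ^ k` in the term of index `k`. Keeping a difference of norms on the
    -- right lets the induction telescope.
    partial-tail : ∀ c n m → ∣ partial c s (m ℕ.+ n) - partial c s n ∣ ≤ ½ ^ℚ n * (norm R c
        (m ℕ.+ n) - norm R c n)
    partial-tail c n zero = ℚ.≤-reflexive (trans (cong ∣_∣ (ℚ.+-inverseʳ (partial c s n)))
      (sym (trans (cong (½ ^ℚ n *_) (ℚ.+-inverseʳ (norm R c n))) (ℚ.*-zeroʳ (½ ^ℚ n)))))
    partial-tail c n (suc m) = step (partial c s k) (partial c s n) (c k * s ^ℚ k) (½ ^ℚ n) (norm R c k)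
        (norm R c n)
        (∣ c k ∣ * R ^ℚ k) (partial-tail c n m) term
      where
      k = m ℕ.+ n
      ∣s^k∣≤ : ∣ s ^ℚ k ∣ ≤ ½ ^ℚ n * R ^ℚ k
      ∣s^k∣≤ = ℚ.≤-trans (ℚ.≤-reflexive (∣^∣ s k)) (ℚ.≤-trans (^-monoˡ-≤ k (ℚ.0≤∣p∣ s) ∣s∣≤)
        (ℚ.≤-trans (ℚ.≤-reflexive (^-distribʳ-* ½ R k))
          (ℚ.*-monoʳ-≤-nonNeg (R ^ℚ k) ⦃ ℚ.nonNegative (0≤^ k 0≤R) ⦄ (^-antimonoʳ-≤ m n 0≤½ ½≤1))))
      eq : ∀ a b c → a * (b * c) ≡ b * (a * c)
      eq = solve-∀ ring
      term : ∣ c k * s ^ℚ k ∣ ≤ ½ ^ℚ n * (∣ c k ∣ * R ^ℚ k)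
      term = ℚ.≤-trans (∣p*q∣≤ (c k) (s ^ℚ k) ℚ.≤-refl ∣s^k∣≤) (ℚ.≤-reflexive (eq ∣ c k ∣ (½ ^ℚ n) (R ^ℚ k)))
      step : ∀ A B t h M N u → ∣ A - B ∣ ≤ h * (M - N) → ∣ t ∣ ≤ h * u → ∣ (A + t) - B ∣ ≤ h * ((M + u) - N)
      step A B t h M N u h₁ h₂ = subst₂ _≤_ (cong ∣_∣ (eq₁ A B t)) (eq₂ h M N u) (∣p+q∣≤ (A - B) t h₁ h₂)
        where
        eq₁ : ∀ A B t → (A - B) + t ≡ (A + t) - B
        eq₁ = solve-∀ ring
        eq₂ : ∀ h M N u → h * (M - N) + h * u ≡ h * ((M + u) - N)
        eq₂ = solve-∀ ring

    partial-close : ∀ {B} c → Bounded R B c → ∀ n m → ∣ partial c s (m ℕ.+ n) - partial c s n ∣ ≤ B * ½ ^ℚ n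
    partial-close {B} c c≤B n m = ℚ.≤-trans (partial-tail c n m)
      (bound (½ ^ℚ n) (norm R c (m ℕ.+ n)) (norm R c n) (0≤^ n 0≤½) (c≤B (m ℕ.+ n)) (0≤norm c n))
      where
      eq : ∀ B h M N → B * h ≡ h * (M - N) + h * ((B - M) + N)
      eq = solve-∀ ring
      bound : ∀ h M N → 0ℚ ≤ h → M ≤ B → 0ℚ ≤ N → h * (M - N) ≤ B * h
      bound h M N 0≤h M≤B 0≤N = ≤-by (0≤p*q 0≤h (0≤p+q (p≤q⇒0≤q-p M≤B) 0≤N)) (eq B h M N)

    Sums-rate : ∀ {B} c v → Bounded R B c → Sums c s v → ∀ n → ∣ partial c s n - v ∣ ≤ B * ½ ^ℚ n
    Sums-rate {B} c v c≤B c⟶v n = ≤-limit λ ε 0<ε → at-index ε (c⟶v ε 0<ε)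
      where
      at-index : ∀ ε → Eventually (λ m → ∣ partial c s m - v ∣ ≤ ε) → ∣ partial c s n - v ∣ ≤ B * ½ ^ℚ n + ε
      at-index ε (N , close) = combine (partial c s n) (partial c s (N ℕ.+ n)) v (B * ½ ^ℚ n)
          (partial-close c c≤B n N) (close (N ℕ.+ n) (ℕ.m≤m+n N n))
        where
        combine : ∀ p q v b → ∣ q - p ∣ ≤ b → ∣ q - v ∣ ≤ ε → ∣ p - v ∣ ≤ b + ε
        combine p q v b h₁ h₂ = subst (_≤ b + ε) (cong ∣_∣ (eq p q v))
          (∣p+q∣≤ (p - q) (q - v) (subst (_≤ b) (∣p-q∣≡∣q-p∣ q p) h₁) h₂)
          where
          eq : ∀ p q v → (p - q) + (q - v) ≡ p - v
          eq = solve-∀ ring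

    -- The case `n = 0` of `Sums-rate`, where the partial sum is empty.
    Sums-bound : ∀ {B} c v → Bounded R B c → Sums c s v → ∣ v ∣ ≤ B
    Sums-bound {B} c v c≤B c⟶v = subst₂ _≤_ (trans (cong ∣_∣ (ℚ.+-identityˡ (- v))) (ℚ.∣-p∣≡∣p∣ v))
      (ℚ.*-identityʳ B) (Sums-rate c v c≤B c⟶v 0)

    -- The targets `x i n` may vary with `n` because a logarithm is available only as its
    -- approximating sequence. For series with rational values they are constant in `n`.
    infiniteSum-close : ∀ c (B : ℕ → ℚ) M (x : ℕ → ℕ → ℚ) → (∀ i → Order i (c i)) → (∀ n → ∑<ℚ n B ≤ M) →
      (∀ i n → ∣ partial (c i) s n - x i n ∣ ≤ B i * ½ ^ℚ n) →
      ∀ n → ∣ partial (infiniteSum c) s n - ∑<ℚ n (λ i → x i n) ∣ ≤ M * ½ ^ℚ n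
    infiniteSum-close c B M x c≡0 B≤M close n = begin
      ∣ partial (infiniteSum c) s n - ∑<ℚ n (λ i → x i n) ∣
        ≡⟨ cong ∣_∣ (cong₂ _+_ (partial-infiniteSum c c≡0 s n) (sym (∑-neg (λ i → x i n) n))) ⟩
      ∣ ∑<ℚ n (λ i → partial (c i) s n) + ∑<ℚ n (λ i → - x i n) ∣
        ≡⟨ cong ∣_∣ (∑-+ (λ i → partial (c i) s n) (λ i → - x i n) n) ⟨
      ∣ ∑<ℚ n (λ i → partial (c i) s n - x i n) ∣
        ≤⟨ ∣∑∣≤∑∣∣ (λ i → partial (c i) s n - x i n) n ⟩
      ∑<ℚ n (λ i → ∣ partial (c i) s n - x i n ∣)
        ≤⟨ ∑-mono-≤ n (λ i → ℚ.≤-trans (close i n) (ℚ.≤-reflexive (ℚ.*-comm (B i) (½ ^ℚ n)))) ⟩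
      ∑<ℚ n (λ i → ½ ^ℚ n * B i)
        ≡⟨ trans (∑-* (½ ^ℚ n) B n) (ℚ.*-comm (½ ^ℚ n) (∑<ℚ n B)) ⟩
      ∑<ℚ n B * ½ ^ℚ n
        ≤⟨ ℚ.*-monoʳ-≤-nonNeg (½ ^ℚ n) ⦃ ℚ.nonNegative (0≤^ n 0≤½) ⦄ (B≤M n) ⟩
      M * ½ ^ℚ n ∎
      where open ℚ.≤-Reasoning

    Sums-infiniteSum : ∀ c (B : ℕ → ℚ) M v w → (∀ i → Order i (c i)) → (∀ i → Bounded R (B i) (c i)) →
      (∀ n → ∑<ℚ n B ≤ M) → (∀ i → Sums (c i) s (v i)) → Null (λ n → ∑<ℚ n v - w) →
      Sums (infiniteSum c) s w
    Sums-infiniteSum c B M v w c≡0 c≤B B≤M c⟶v v⟶w = Null-cong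
      {y = λ n → (partial (infiniteSum c) s n - ∑<ℚ n v) + (∑<ℚ n v - w)}
      (λ n → eq (partial (infiniteSum c) s n) (∑<ℚ n v) w)
      (Null-+ (Null-bound (infiniteSum-close c B M (λ i _ → v i) c≡0 B≤M (λ i → Sums-rate (c i) (v i)
          (c≤B i) (c⟶v i)))
        (Null-* M Null-½^)) v⟶w)
      where
      eq : ∀ p q w → p - w ≡ (p - q) + (q - w)
      eq = solve-∀ ring

    Sums-⊠ : ∀ {B B′} c d v w → Bounded R B c → Bounded R B′ d → Sums c s v → Sums d s w →
        Sums (c ⊠ d) s (v * w)
    Sums-⊠ {B} {B′} c d v w c≤B d≤B′ c⟶v d⟶w = Sums-infiniteSum (⊠-term c d) (⊠-term-bound c B′) (B * B′)
      (λ i → c i * (s ^ℚ i * w)) (v * w) (Order-⊠-term c d) (Bounded-⊠-term c d d≤B′)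
      (∑⊠-term-bound c (d≤B′ 0) c≤B)
      (λ i → Sums-scale (c i) (shiftBy i d) s (s ^ℚ i * w) (Sums-shiftBy i d s w d⟶w))
      (Null-cong {y = λ n → w * (partial c s n - v)} total (Null-* w c⟶v))
      where
      eq : ∀ a b c → a * (b * c) ≡ c * (a * b)
      eq = solve-∀ ring
      eq′ : ∀ w p v → w * p - v * w ≡ w * (p - v)
      eq′ = solve-∀ ring
      total : ∀ n → ∑<ℚ n (λ i → c i * (s ^ℚ i * w)) - v * w ≡ w * (partial c s n - v)
      total n = trans (cong (_- v * w) (trans (∑-cong n (λ i _ → eq (c i) (s ^ℚ i) w)) (∑-* w
          (λ i → c i * s ^ℚ i) n)))
        (eq′ w (partial c s n) v)

    Sums-power : ∀ {B} c v → Bounded R B c → Sums c s v → ∀ i → Sums (power c i) s (v ^ℚ i)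
    Sums-power c v c≤B c⟶v zero    = Sums-one s
    Sums-power c v c≤B c⟶v (suc i) = Sums-⊠ c (power c i) v (v ^ℚ i) c≤B (Bounded-power c c≤B i) c⟶v
        (Sums-power c v c≤B c⟶v i)

-- Inverses and logarithms of power series

negate : Coeffs → Coeffs
negate = scale (- 1ℚ)

-- 1 / (1 + z), for z of order at least 1.
inverse : Coeffs → Coeffs
inverse z = infiniteSum (power (negate z))

-- u / (2 + u), so that 1 + u = (1 + w) / (1 - w).
toCayley : Coeffs → Coeffs
toCayley u = scale ½ (u ⊠ inverse (scale ½ u))

artanhSeries-term : Coeffs → ℕ → Coeffs
artanhSeries-term w j = scale (+ 2 / suc (2 ℕ.* j)) (power w (suc (2 ℕ.* j)))

artanhSeries : Coeffs → Coeffs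
artanhSeries w = infiniteSum (artanhSeries-term w)

-- log (1 + u)
logSeries : Coeffs → Coeffs
logSeries u = artanhSeries (toCayley u)

Order-⊠ˡ : ∀ {i} c d → Order i c → Order i (c ⊠ d)
Order-⊠ˡ {i} c d c≡0 = subst (λ j → Order j (c ⊠ d)) (ℕ.+-identityʳ i) (Order-⊠ c d c≡0 Order-0)

Order-negate-power : ∀ z → Order 1 z → ∀ i → Order i (power (negate z) i)
Order-negate-power z z≡0 = Order-power (negate z) (Order-scale (- 1ℚ) z z≡0)

Order-toCayley : ∀ {i} u → Order i u → Order i (toCayley u)
Order-toCayley u u≡0 = Order-scale ½ (u ⊠ inverse (scale ½ u)) (Order-⊠ˡ u (inverse (scale ½ u)) u≡0)

Order-artanhSeries-term : ∀ w → Order 1 w → ∀ j → Order j (artanhSeries-term w j)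
Order-artanhSeries-term w w≡0 j = Order-scale (+ 2 / suc (2 ℕ.* j)) (power w (suc (2 ℕ.* j)))
  (Order-weaken (ℕ.≤-trans (ℕ.m≤m+n j (j ℕ.+ 0)) (ℕ.n≤1+n (2 ℕ.* j))) (Order-power w w≡0 (suc (2 ℕ.* j))))

Order-logSeries : ∀ {i} u → Order i u → Order i (logSeries u)
Order-logSeries u u≡0 = Order-infiniteSum (artanhSeries-term (toCayley u))
  λ j → Order-scale (+ 2 / suc (2 ℕ.* j)) (power (toCayley u) (suc (2 ℕ.* j)))
    (Order-⊠ˡ (toCayley u) (power (toCayley u) (2 ℕ.* j)) (Order-toCayley u u≡0))

2/≤2 : ∀ m → + 2 / suc m ≤ 2ℚ
2/≤2 = LogSeries.2/≤2 0

-- The size of the term of index `j` at an argument of size at most ½. It serves both for series in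
-- the norm and for rational numbers.
artanh-bound : ℕ → ℚ
artanh-bound j = ∣ + 2 / suc (2 ℕ.* j) ∣ * ½ ^ℚ suc (2 ℕ.* j)

artanh-bound≤ : ∀ j → artanh-bound j ≤ ½ ^ℚ j
artanh-bound≤ j = ℚ.≤-trans
  (*-mono-≤ (ℚ.0≤∣p∣ (+ 2 / suc (2 ℕ.* j))) (0≤^ (suc j) 0≤½)
    (subst (_≤ 2ℚ) (sym (ℚ.0≤p⇒∣p∣≡p (0≤/ 2 (2 ℕ.* j)))) (2/≤2 (2 ℕ.* j)))
    (subst (λ m → ½ ^ℚ m ≤ ½ ^ℚ suc j) (trans (ℕ.+-suc j j) (cong (λ m → suc (j ℕ.+ m)) (sym
        (ℕ.+-identityʳ j))))
      (^-antimonoʳ-≤ j (suc j) 0≤½ ½≤1)))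
  (ℚ.≤-reflexive (eq (½ ^ℚ j)))
  where
  eq : ∀ x → 2ℚ * (½ * x) ≡ x
  eq = solve-∀ ring

∑artanh-bound≤2 : ∀ n → ∑<ℚ n artanh-bound ≤ 2ℚ
∑artanh-bound≤2 n = ℚ.≤-trans (∑-mono-≤ n artanh-bound≤) (∑½^≤2 n)

module MajorantLog {R : ℚ} (0≤R : 0ℚ ≤ R) where
  open Majorant 0≤R

  Bounded-negate : ∀ {B} z → Bounded R B z → Bounded R B (negate z)
  Bounded-negate {B} z z≤B = subst (λ B → Bounded R B (negate z)) (ℚ.*-identityˡ B) (Bounded-scale (- 1ℚ) z z≤B)

  Bounded-inverse : ∀ z → Order 1 z → Bounded R ½ z → Bounded R 2ℚ (inverse z)
  Bounded-inverse z z≡0 z≤½ = Bounded-infiniteSum (power (negate z)) (½ ^ℚ_) 2ℚ (Order-negate-power z z≡0)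
    (Bounded-power (negate z) (Bounded-negate z z≤½)) ∑½^≤2

  Bounded-half : ∀ u → Bounded R ½ u → Bounded R ½ (scale ½ u)
  Bounded-half u u≤½ = Bounded-weaken {R = R} {½ * ½} {½} {scale ½ u} (ℚ.≤-trans
      (*-mono-≤ 0≤½ 0≤½ ½≤1 ℚ.≤-refl) (ℚ.≤-reflexive (ℚ.*-identityˡ ½)))
    (Bounded-scale ½ u u≤½)

  -- The bound ½ reproduces itself: `½ · (½ · 2) = ½`.
  Bounded-toCayley : ∀ u → Order 1 u → Bounded R ½ u → Bounded R ½ (toCayley u)
  Bounded-toCayley u u≡0 u≤½ = Bounded-scale ½ (u ⊠ inverse (scale ½ u)) (Bounded-⊠ u (inverse (scale ½ u)) u≤½
    (Bounded-inverse (scale ½ u) (Order-scale ½ u u≡0) (Bounded-half u u≤½)))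

  Bounded-logSeries : ∀ u → Order 1 u → Bounded R ½ u → Bounded R 2ℚ (logSeries u)
  Bounded-logSeries u u≡0 u≤½ = Bounded-infiniteSum (artanhSeries-term w)
    artanh-bound 2ℚ (Order-artanhSeries-term w (Order-toCayley u u≡0))
    (λ j → Bounded-scale (+ 2 / suc (2 ℕ.* j)) (power w (suc (2 ℕ.* j)))
      (Bounded-power w (Bounded-toCayley u u≡0 u≤½) (suc (2 ℕ.* j))))
    ∑artanh-bound≤2
    where
    w : Coeffs
    w = toCayley u

  module _ {s : ℚ} (∣s∣≤ : ∣ s ∣ ≤ ½ * R) where
    open Evaluation ∣s∣≤

    -- Geometric series: its partial sums differ from `r` by `- r (- v)ⁿ`, and `Sums-bound` gives
    -- `∣ v ∣ ≤ ½`.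
    Sums-inverse : ∀ z v r → Order 1 z → Bounded R ½ z → Sums z s v → r * (1ℚ + v) ≡ 1ℚ → Sums (inverse z) s r
    Sums-inverse z v r z≡0 z≤½ z⟶v r[1+v]≡1 = Sums-infiniteSum (power (negate z)) (½ ^ℚ_) 2ℚ (v′ ^ℚ_) r
      (Order-negate-power z z≡0) (Bounded-power (negate z) (Bounded-negate z z≤½)) ∑½^≤2
      (Sums-power (negate z) v′ (Bounded-negate z z≤½) (Sums-scale (- 1ℚ) z s v z⟶v))
      (Null-cong {y = λ n → - r * v′ ^ℚ n} geometric (Null-* (- r) (Null-squeeze 0 (λ n _ → small n) Null-½^)))
      where
      v′ : ℚ
      v′ = - 1ℚ * v
      eq₃ : ∀ v S r p → (S + p - r) ≡ (S - r) + p
      eq₃ = solve-∀ ring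
      eq₄ : ∀ v r p → (- r) * p + (r * (1ℚ + v)) * p ≡ - r * ((- 1ℚ * v) * p)
      eq₄ = solve-∀ ring
      geometric : ∀ n → ∑<ℚ n (v′ ^ℚ_) - r ≡ - r * v′ ^ℚ n
      geometric zero    = trans (ℚ.+-identityˡ (- r)) (sym (ℚ.*-identityʳ (- r)))
      geometric (suc n) = trans (eq₃ v (∑<ℚ n (v′ ^ℚ_)) r (v′ ^ℚ n)) (trans
        (cong₂ _+_ (geometric n) (trans (sym (ℚ.*-identityˡ (v′ ^ℚ n))) (cong (_* v′ ^ℚ n) (sym r[1+v]≡1))))
        (eq₄ v r (v′ ^ℚ n)))
      small : ∀ n → ∣ v′ ^ℚ n ∣ ≤ ∣ ½ ^ℚ n ∣
      small n = ℚ.≤-trans (ℚ.≤-reflexive (∣^∣ v′ n)) (ℚ.≤-trans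
        (^-monoˡ-≤ n (ℚ.0≤∣p∣ v′) (Sums-bound (negate z) v′ (Bounded-negate z z≤½) (Sums-scale
            (- 1ℚ) z s v z⟶v)))
        (p≤∣p∣ (½ ^ℚ n)))

    Sums-toCayley : ∀ u v w → Order 1 u → Bounded R ½ u → Sums u s v → 0ℚ < 2ℚ + v → w * (2ℚ + v) ≡ v →
        Sums (toCayley u) s w
    Sums-toCayley u v w u≡0 u≤½ u⟶v 0<2+v hw = use (reciprocal (2ℚ + v) 0<2+v)
      where
      use : ∃[ r ] 0ℚ < r × (2ℚ + v) * r ≡ 1ℚ → Sums (toCayley u) s w
      use (r , _ , hr) = subst (Sums (toCayley u) s) value
        (Sums-scale ½ (u ⊠ inverse (scale ½ u)) s (v * (2ℚ * r)) (Sums-⊠ u (inverse (scale ½ u)) v (2ℚ * r)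
          u≤½ (Bounded-inverse (scale ½ u) (Order-scale ½ u u≡0) (Bounded-half u u≤½)) u⟶v
          (Sums-inverse (scale ½ u) (½ * v) (2ℚ * r) (Order-scale ½ u u≡0) (Bounded-half u u≤½)
            (Sums-scale ½ u s v u⟶v) (trans (eq₁ v r) hr))))
        where
        eq₁ : ∀ v r → (2ℚ * r) * (1ℚ + ½ * v) ≡ (2ℚ + v) * r
        eq₁ = solve-∀ ring
        eq₂ : ∀ v r → ½ * (v * (2ℚ * r)) ≡ v * r
        eq₂ = solve-∀ ring
        eq₃ : ∀ v w r → (w * (2ℚ + v)) * r ≡ w * ((2ℚ + v) * r)
        eq₃ = solve-∀ ring
        value : ½ * (v * (2ℚ * r)) ≡ w
        value = trans (eq₂ v r) (trans (cong (_* r) (sym hw)) (trans (eq₃ v w r) (trans (cong (w *_) hr)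
            (ℚ.*-identityʳ w))))

    -- The value is `log (1 + v)`, in general not rational, so `Sums` cannot express it and a
    -- truncated logarithm takes its place.
    logSeries-close : ∀ u v w → Order 1 u → Bounded R ½ u → Sums u s v → 0ℚ < 2ℚ + v → w * (2ℚ + v) ≡ v →
      ∀ n → ∣ partial (logSeries u) s n - 2artanh w n ∣ ≤ 2ℚ * ½ ^ℚ n
    logSeries-close u v w u≡0 u≤½ u⟶v 0<2+v hw = infiniteSum-close
      (artanhSeries-term c) artanh-bound 2ℚ (λ j _ → artanh-term w j)
      (Order-artanhSeries-term c (Order-toCayley u u≡0)) ∑artanh-bound≤2
      (λ j → Sums-rate (artanhSeries-term c j) (artanh-term w j)
        (Bounded-scale (+ 2 / suc (2 ℕ.* j)) (power c (suc (2 ℕ.* j))) (Bounded-power c c≤½ (suc (2 ℕ.* j))))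
        (Sums-scale (+ 2 / suc (2 ℕ.* j)) (power c (suc (2 ℕ.* j))) s (w ^ℚ suc (2 ℕ.* j))
          (Sums-power c w c≤½ (Sums-toCayley u v w u≡0 u≤½ u⟶v 0<2+v hw) (suc (2 ℕ.* j)))))
      where
      c : Coeffs
      c = toCayley u
      c≤½ : Bounded R ½ c
      c≤½ = Bounded-toCayley u u≡0 u≤½

-- Telescoping

lg-^ : ∀ {x} → 1ℚ ≤ x → ∀ d → Null (λ n → lg (x ^ℚ d) n - fromℕ d * lg x n)
lg-^ {x} 1≤x zero    = Null-cong {y = λ _ → 0ℚ} (λ n → trans (cong (_- 0ℚ * lg x n) (lg-1 n)) (eq
    (lg x n))) Null-0
  where
  eq : ∀ a → 0ℚ - 0ℚ * a ≡ 0ℚ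
  eq = solve-∀ ring
lg-^ {x} 1≤x (suc d) = Null-cong
  {y = λ n → (lg (x * x ^ℚ d) n - (lg x n + lg (x ^ℚ d) n)) + (lg (x ^ℚ d) n - fromℕ d * lg x n)}
  (λ n → trans (cong (λ k → lg (x ^ℚ suc d) n - k * lg x n) (fromℕ-suc d)) (eq (lg (x ^ℚ suc d) n) (lg
      (x ^ℚ d) n) (lg x n) (fromℕ d)))
  (Null-+ (lg-* 1≤x (1≤^ d)) (lg-^ 1≤x d))
  where
  1≤^ : ∀ d → 1ℚ ≤ x ^ℚ d
  1≤^ d = subst (_≤ x ^ℚ d) (1^n≡1 d) (^-monoˡ-≤ d 0≤1 1≤x)
  eq : ∀ A B a k → A - (1ℚ + k) * a ≡ (A - (a + B)) + (B - k * a)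
  eq = solve-∀ ring

∣artanh-term∣≤ : ∀ {w} → ∣ w ∣ ≤ ½ → ∀ j → ∣ artanh-term w j ∣ ≤ artanh-bound j
∣artanh-term∣≤ {w} ∣w∣≤½ j = ∣p*q∣≤ (+ 2 / suc (2 ℕ.* j)) (w ^ℚ suc (2 ℕ.* j)) ℚ.≤-refl
  (ℚ.≤-trans (ℚ.≤-reflexive (∣^∣ w (suc (2 ℕ.* j)))) (^-monoˡ-≤ (suc (2 ℕ.* j)) (ℚ.0≤∣p∣ w) ∣w∣≤½))

∣2artanh∣≤2 : ∀ {w} → ∣ w ∣ ≤ ½ → ∀ n → ∣ 2artanh w n ∣ ≤ 2ℚ
∣2artanh∣≤2 {w} ∣w∣≤½ n = ℚ.≤-trans (∣∑∣≤∑∣∣ (artanh-term w) n)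
  (ℚ.≤-trans (∑-mono-≤ n (∣artanh-term∣≤ ∣w∣≤½)) (∑artanh-bound≤2 n))

-- Double sequences, the inner index n being that of an approximating sequence.
infix 4 _⇝_
_⇝_ : (ℕ → ℕ → ℚ) → (ℕ → ℚ) → Set
a ⇝ l = ∀ ε → 0ℚ < ε → Eventually λ N → Eventually λ n → ∣ a N n - l n ∣ ≤ ε

⇝-respʳ : ∀ a l m → Null (λ n → l n - m n) → a ⇝ l → a ⇝ m
⇝-respʳ a l m l-m a⇝l ε 0<ε with a⇝l (½ * ε) (0<p*q 0<½ 0<ε) | l-m (½ * ε) (0<p*q 0<½ 0<ε)
... | N₀ , outer | M , close = N₀ , λ N N≥ → proj₁ (outer N N≥) ℕ.⊔ M , λ n n≥ →
  combine (a N n) (l n) (m n) (proj₂ (outer N N≥) n (ℕ.m⊔n≤o⇒m≤o (proj₁ (outer N N≥)) M n≥)) (close n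
      (ℕ.m⊔n≤o⇒n≤o (proj₁ (outer N N≥)) M n≥))
  where
  combine : ∀ a l m → ∣ a - l ∣ ≤ ½ * ε → ∣ l - m ∣ ≤ ½ * ε → ∣ a - m ∣ ≤ ε
  combine a l m h₁ h₂ = subst₂ _≤_ (cong ∣_∣ (eq a l m)) (½-sum ε) (∣p+q∣≤ (a - l) (l - m) h₁ h₂)
    where
    eq : ∀ a l m → (a - l) + (l - m) ≡ a - m
    eq = solve-∀ ring

module Telescoping (β v w : ℕ → ℚ) (1≤β : ∀ i → 1ℚ ≤ β i) (w-spec : ∀ i → w i * (2ℚ + v i) ≡ v i)
  (β-first : β 1 ≡ β 0 * (1ℚ + v 0)) (β-next : ∀ i →
      β (suc (suc i)) ≡ (β (suc i) * β (suc i)) * (1ℚ + v (suc i)))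
  where

  correction : ℕ → ℕ → ℚ
  correction n i = ½ ^ℚ i * 2artanh (w i) n

  lg-growth : ∀ {a b} i → 1ℚ ≤ a → 1ℚ ≤ b → b ≡ a * (1ℚ + v i) → Null (λ n →
      (lg b n - lg a n) - 2artanh (w i) n)
  lg-growth {a} {b} i 1≤a 1≤b b≡ = lg-ratio (w i) 1≤a 1≤b
    (trans (cong (λ b → w i * (a + b)) b≡) (trans (eq₁ a (w i) (v i)) (trans (cong (a *_) (w-spec i))
      (trans (eq₂ a (v i)) (cong (_- a) (sym b≡))))))
    where
    eq₁ : ∀ a w v → w * (a + a * (1ℚ + v)) ≡ a * (w * (2ℚ + v))
    eq₁ = solve-∀ ring
    eq₂ : ∀ a v → a * v ≡ a * (1ℚ + v) - a
    eq₂ = solve-∀ ring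

  1≤β² : ∀ i → 1ℚ ≤ β i * β i
  1≤β² i = ℚ.≤-trans (1≤β i) (subst (_≤ β i * β i) (ℚ.*-identityˡ (β i))
    (ℚ.*-monoʳ-≤-nonNeg (β i) ⦃ ℚ.nonNegative (ℚ.≤-trans 0≤1 (1≤β i)) ⦄ (1≤β i)))

  -- The step from `β 0` to `β 1` does not square, so `β (suc N)` carries the weight `½ ^ N`. Each
  -- later step uses `½ ^ (N + 1) log β² = ½ ^ N log β`, valid up to a null sequence by `lg-*`.
  telescope : ∀ N → Null (λ n → ½ ^ℚ N * lg (β (suc N)) n - (lg (β 0) n + ∑<ℚ (suc N) (correction n)))
  telescope zero = Null-cong {y = λ n → (lg (β 1) n - lg (β 0) n) - 2artanh (w 0) n}
    (λ n → eq (lg (β 1) n) (lg (β 0) n) (2artanh (w 0) n)) (lg-growth 0 (1≤β 0) (1≤β 1) β-first)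
    where
    eq : ∀ b a c → 1ℚ * b - (a + (0ℚ + 1ℚ * c)) ≡ (b - a) - c
    eq = solve-∀ ring
  telescope (suc N) = Null-cong
    {y = λ n → ½ ^ℚ suc N * (((lg (β (suc (suc N))) n - lg (β (suc N) * β (suc N)) n) - 2artanh (w (suc N)) n)
        + (lg (β (suc N) * β (suc N)) n - (lg (β (suc N)) n + lg (β (suc N)) n)))
      + (½ ^ℚ N * lg (β (suc N)) n - (lg (β 0) n + ∑<ℚ (suc N) (correction n)))}
    (λ n → eq (½ ^ℚ N) (lg (β (suc (suc N))) n) (lg (β (suc N) * β (suc N)) n) (lg (β (suc N)) n) (lg (β 0) n)
      (∑<ℚ (suc N) (correction n)) (2artanh (w (suc N)) n))
    (Null-+ (Null-* (½ ^ℚ suc N) (Null-+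
        (lg-growth (suc N) (1≤β² (suc N)) (1≤β (suc (suc N))) (β-next N)) (lg-* (1≤β (suc N)) (1≤β (suc N)))))
      (telescope N))
    where
    eq : ∀ h B Q b a S c → (½ * h) * B - (a + (S + (½ * h) * c)) ≡
      (½ * h) * (((B - Q) - c) + (Q - (b + b))) + (h * b - (a + S))
    eq = solve-∀ ring

  module _ (∣w∣≤½ : ∀ i → ∣ w i ∣ ≤ ½) where

    -- Each correction is at most `2 · ½ ^ i` whatever `n` is, and summing this geometric series
    -- gives the constant 4.
    correction-tail : ∀ n N l → ∣ ∑<ℚ N (correction n) - ∑<ℚ (l ℕ.+ N) (correction n) ∣ ≤ 4ℚ *
        (½ ^ℚ N - ½ ^ℚ (l ℕ.+ N))
    correction-tail n N zero    = ℚ.≤-reflexive (trans (cong ∣_∣ (ℚ.+-inverseʳ (∑<ℚ N (correction n))))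
      (sym (trans (cong (4ℚ *_) (ℚ.+-inverseʳ (½ ^ℚ N))) (ℚ.*-zeroʳ 4ℚ))))
    correction-tail n N (suc l) = step (∑<ℚ N (correction n)) (∑<ℚ (l ℕ.+ N) (correction n)) (½ ^ℚ N)
        (½ ^ℚ (l ℕ.+ N))
      (2artanh (w (l ℕ.+ N)) n) (0≤^ (l ℕ.+ N) 0≤½) (correction-tail n N l) (∣2artanh∣≤2 (∣w∣≤½ (l ℕ.+ N)) n)
      where
      eq₁ : ∀ A B h c → (A - B) + - (h * c) ≡ A - (B + h * c)
      eq₁ = solve-∀ ring
      eq₂ : ∀ H h → 4ℚ * (H - h) + h * 2ℚ ≡ 4ℚ * (H - ½ * h)
      eq₂ = solve-∀ ring
      step : ∀ A B H h c → 0ℚ ≤ h → ∣ A - B ∣ ≤ 4ℚ * (H - h) → ∣ c ∣ ≤ 2ℚ →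
        ∣ A - (B + h * c) ∣ ≤ 4ℚ * (H - ½ * h)
      step A B H h c 0≤h h₁ h₂ = subst₂ _≤_ (cong ∣_∣ (eq₁ A B h c)) (eq₂ H h)
        (∣p+q∣≤ (A - B) (- (h * c)) h₁ (subst (_≤ h * 2ℚ) (sym (ℚ.∣-p∣≡∣p∣ (h * c)))
          (∣p*q∣≤ h c (ℚ.≤-reflexive (ℚ.0≤p⇒∣p∣≡p 0≤h)) h₂)))

    telescope-limit : ∀ (F : ℕ → ℚ) → (∀ n → ∣ F n - ∑<ℚ n (correction n) ∣ ≤ 4ℚ * ½ ^ℚ n) →
      (λ N n → ½ ^ℚ N * lg (β (suc N)) n) ⇝ (λ n → lg (β 0) n + F n)
    telescope-limit F F-close ε 0<ε = use (Null-* 4ℚ Null-½^ (½ * (½ * ε)) 0<¼ε)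
      where
      0<¼ε : 0ℚ < ½ * (½ * ε)
      0<¼ε = 0<p*q 0<½ (0<p*q 0<½ 0<ε)
      -- Three errors: `½ ε` from telescoping, `4 (H - h)` from the corrections between `suc N` and
      -- `n`, and `4 h` from truncating `F`. The last two add up to `4 H`, which does not depend on
      -- `n`.
      combine : ∀ x a S T F H h b → 0ℚ ≤ h → ∣ x - (a + S) ∣ ≤ ½ * ε → ∣ S - T ∣ ≤ 4ℚ * (H - h) →
          ∣ F - T ∣ ≤ 4ℚ * h →
        ∣ 4ℚ * H ∣ ≤ ½ * (½ * ε) → b ≡ ½ * (½ * ε) → ∣ x - (a + F) ∣ ≤ ε
      combine x a S T F H h _ 0≤h h₁ h₂ h₃ h₄ refl = subst₂ _≤_ (cong ∣_∣ (eq₁ x a S T F)) refl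
        (ℚ.≤-trans (∣p+q∣≤ ((x - (a + S)) + (S - T)) (- (F - T)) (∣p+q∣≤ (x - (a + S)) (S - T) h₁ h₂)
            (subst (_≤ 4ℚ * h) (sym (ℚ.∣-p∣≡∣p∣ (F - T))) h₃))
          (≤-by (0≤p+q (∣p∣≤q⇒0≤q-p h₄) (ℚ.<⇒≤ 0<¼ε)) (eq₂ ε H h)))
        where
        eq₁ : ∀ x a S T F → ((x - (a + S)) + (S - T)) + - (F - T) ≡ x - (a + F)
        eq₁ = solve-∀ ring
        eq₂ : ∀ ε H h → ε ≡ ((½ * ε + 4ℚ * (H - h)) + 4ℚ * h) + ((½ * (½ * ε) - 4ℚ * H) + ½ * (½ * ε))
        eq₂ = solve-∀ ring
      use : Eventually (λ n → ∣ 4ℚ * ½ ^ℚ n ∣ ≤ ½ * (½ * ε)) →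
        Eventually λ N → Eventually λ n → ∣ ½ ^ℚ N * lg (β (suc N)) n - (lg (β 0) n + F n) ∣ ≤ ε
      use (N₀ , small) = N₀ , λ N N≥ → inner N N≥ (telescope N (½ * ε) (0<p*q 0<½ 0<ε))
        where
        inner : ∀ N → N₀ ℕ.≤ N →
          Eventually (λ n → ∣ ½ ^ℚ N * lg (β (suc N)) n - (lg (β 0) n + ∑<ℚ (suc N) (correction n)) ∣ ≤ ½ * ε) →
          Eventually λ n → ∣ ½ ^ℚ N * lg (β (suc N)) n - (lg (β 0) n + F n) ∣ ≤ ε
        inner N N≥ (M , close) = suc N ℕ.⊔ M , λ n n≥ →
          combine (½ ^ℚ N * lg (β (suc N)) n) (lg (β 0) n) (∑<ℚ (suc N) (correction n)) (∑<ℚ n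
              (correction n)) (F n)
            (½ ^ℚ suc N) (½ ^ℚ n) (½ * (½ * ε)) (0≤^ n 0≤½)
            (close n (ℕ.m⊔n≤o⇒n≤o (suc N) M n≥))
            (subst (λ m → ∣ ∑<ℚ (suc N) (correction n) - ∑<ℚ m (correction n) ∣ ≤ 4ℚ * (½ ^ℚ suc N - ½ ^ℚ m))
              (ℕ.m∸n+n≡m (ℕ.m⊔n≤o⇒m≤o (suc N) M n≥)) (correction-tail n (suc N) (n ℕ.∸ suc N)))
            (F-close n) (small (suc N) (ℕ.≤-trans N≥ (ℕ.n≤1+n N))) refl

-- The orbit as a sequence of power series

-- s (u / (1 + u))² turns t / xᵢ² into t / xᵢ₊₁², where xᵢ₊₁ = xᵢ² + t = xᵢ² (1 + u) and s = 1 / t.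
nextSeries : Coeffs → Coeffs
nextSeries u = shift ((u ⊠ inverse u) ⊠ (u ⊠ inverse u))

-- For x₀ = P(t) = tᵉ⁺¹ (1 + U₀(s)) these are U₀ and then t / xᵢ², as series in s = 1 / t.
orbitSeries : ℕ → Coeffs → ℕ → Coeffs
orbitSeries e U₀ zero          = U₀
orbitSeries e U₀ (suc zero)    = shiftBy (suc (2 ℕ.* e)) (inverse U₀ ⊠ inverse U₀)
orbitSeries e U₀ (suc (suc i)) = nextSeries (orbitSeries e U₀ (suc i))

heightSeries-term : ℕ → Coeffs → ℕ → Coeffs
heightSeries-term e U₀ i = scale (½ ^ℚ i) (logSeries (orbitSeries e U₀ i))

heightSeries : ℕ → Coeffs → Coeffs
heightSeries e U₀ = infiniteSum (heightSeries-term e U₀)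

Order-nextSeries : ∀ {i} u → Order i u → Order (suc i) (nextSeries u)
Order-nextSeries u u≡0 = Order-shift ((u ⊠ inverse u) ⊠ (u ⊠ inverse u))
  (Order-⊠ˡ (u ⊠ inverse u) (u ⊠ inverse u) (Order-⊠ˡ u (inverse u) u≡0))

-- Order `i` makes the infinite sum over `i` meaningful coefficientwise. Order 1 is what inverses
-- and logarithms require, and for `i = 0` it does not follow from the former.
Order-orbitSeries : ∀ e U₀ → Order 1 U₀ → ∀ i → Order 1 (orbitSeries e U₀ i) × Order i (orbitSeries e U₀ i)
Order-orbitSeries e U₀ o zero          = o , Order-0
Order-orbitSeries e U₀ o (suc zero)    = o′ , o′
  where
  o′ : Order 1 (orbitSeries e U₀ 1)
  o′ = Order-shift (shiftBy (2 ℕ.* e) (inverse U₀ ⊠ inverse U₀)) Order-0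
Order-orbitSeries e U₀ o (suc (suc i)) = Order-weaken (ℕ.s≤s ℕ.z≤n) (o′ (proj₂ (Order-orbitSeries e U₀ o
    (suc i))))
    , o′ (proj₂ (Order-orbitSeries e U₀ o (suc i)))
  where
  o′ : Order (suc i) (orbitSeries e U₀ (suc i)) → Order (suc (suc i)) (orbitSeries e U₀ (suc (suc i)))
  o′ = Order-nextSeries (orbitSeries e U₀ (suc i))

Order-heightSeries : ∀ e U₀ → Order 1 U₀ → Order 1 (heightSeries e U₀)
Order-heightSeries e U₀ o = Order-infiniteSum (heightSeries-term e U₀)
  λ i → Order-scale (½ ^ℚ i) (logSeries (orbitSeries e U₀ i))
    (Order-logSeries (orbitSeries e U₀ i) (proj₁ (Order-orbitSeries e U₀ o i)))

Order-heightSeries-term : ∀ e U₀ → Order 1 U₀ → ∀ i → Order i (heightSeries-term e U₀ i)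
Order-heightSeries-term e U₀ o i = Order-scale (½ ^ℚ i) (logSeries (orbitSeries e U₀ i))
  (Order-logSeries (orbitSeries e U₀ i) (proj₂ (Order-orbitSeries e U₀ o i)))

∣½^∣ : ∀ i → ∣ ½ ^ℚ i ∣ ≡ ½ ^ℚ i
∣½^∣ i = ℚ.0≤p⇒∣p∣≡p (0≤^ i 0≤½)

heightSeries-bound : ∀ n → ∑<ℚ n (λ i → ∣ ½ ^ℚ i ∣ * 2ℚ) ≤ 4ℚ
heightSeries-bound n = ℚ.≤-trans (ℚ.≤-reflexive (trans (∑-cong n (λ i _ → trans (cong (_* 2ℚ) (∣½^∣ i))
    (ℚ.*-comm (½ ^ℚ i) 2ℚ))) (∑-* 2ℚ (½ ^ℚ_) n)))
  (ℚ.*-monoˡ-≤-nonNeg 2ℚ (∑½^≤2 n))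

⅛≤1 : ∀ {R} → 0ℚ ≤ R → R * (4ℚ * 2ℚ) ≤ 1ℚ → R ≤ 1ℚ
⅛≤1 {R} 0≤R R≤⅛ = ≤-by (0≤p+q (p≤q⇒0≤q-p R≤⅛) (0≤p*q (0≤p+q 0≤4 (0≤p+q 0≤1 0≤2)) 0≤R)) (eq R)
  where
  eq : ∀ R → 1ℚ ≡ R + ((1ℚ - R * (4ℚ * 2ℚ)) + (4ℚ + (1ℚ + 2ℚ)) * R)
  eq = solve-∀ ring

2^suc* : ∀ i d → 2 ℕ.^ i ℕ.* d ℕ.+ 2 ℕ.^ i ℕ.* d ≡ 2 ℕ.^ suc i ℕ.* d
2^suc* i d = trans (cong (λ m → 2 ℕ.^ i ℕ.* d ℕ.+ m ℕ.* d) (sym (ℕ.+-identityʳ (2 ℕ.^ i))))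
  (sym (ℕ.*-distribʳ-+ d (2 ℕ.^ i) (2 ℕ.^ i ℕ.+ 0)))

module OrbitBounds {R : ℚ} (0≤R : 0ℚ ≤ R) (R≤⅛ : R * (4ℚ * 2ℚ) ≤ 1ℚ) (e : ℕ) (U₀ : Coeffs)
  (U₀-order : Order 1 U₀) (U₀-bounded : Bounded R ½ U₀) where
  open Majorant 0≤R
  open MajorantLog 0≤R

  U : ℕ → Coeffs
  U = orbitSeries e U₀

  U-order : ∀ i → Order 1 (U i)
  U-order i = proj₁ (Order-orbitSeries e U₀ U₀-order i)

  R≤1 : R ≤ 1ℚ
  R≤1 = ⅛≤1 0≤R R≤⅛

  R*4≤½ : R * (2ℚ * 2ℚ) ≤ ½
  R*4≤½ = ≤-by (0≤p*q 0≤½ (p≤q⇒0≤q-p R≤⅛)) (eq R)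
    where
    eq : ∀ R → ½ ≡ R * (2ℚ * 2ℚ) + ½ * (1ℚ - R * (4ℚ * 2ℚ))
    eq = solve-∀ ring

  R≤½ : R * ((½ * 2ℚ) * (½ * 2ℚ)) ≤ ½
  R≤½ = ℚ.≤-trans (*-mono-≤ 0≤R 0≤4 ℚ.≤-refl (≤-by {e = 1ℚ + 2ℚ} (0≤p+q 0≤1 0≤2) refl)) R*4≤½

  -- Every series after the initial one carries a factor `s`, hence a factor `R` in its norm. At
  -- index 1 the squared inverse has norm at most `2 · 2`, and `R ≤ 1/8` brings this down to ½;
  -- afterwards `u ⊠ inverse u` has norm at most `½ · 2 = 1`.
  U-bounded : ∀ i → Bounded R ½ (U i)
  U-bounded zero          = U₀-bounded
  U-bounded (suc zero)    = Bounded-weaken {R} {R ^ℚ suc (2 ℕ.* e) * (2ℚ * 2ℚ)} {½} {U 1}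
    (ℚ.≤-trans (*-mono-≤ (0≤^ (suc (2 ℕ.* e)) 0≤R) 0≤4 R^suc≤R ℚ.≤-refl) R*4≤½)
    (Bounded-shiftBy (suc (2 ℕ.* e)) (inverse U₀ ⊠ inverse U₀)
      (Bounded-⊠ (inverse U₀) (inverse U₀) (Bounded-inverse U₀ U₀-order U₀-bounded)
          (Bounded-inverse U₀ U₀-order U₀-bounded)))
    where
    R^suc≤R : R ^ℚ suc (2 ℕ.* e) ≤ R
    R^suc≤R = ℚ.≤-trans (ℚ.≤-reflexive (cong (R ^ℚ_) (sym (ℕ.+-comm (2 ℕ.* e) 1))))
      (ℚ.≤-trans (^-antimonoʳ-≤ (2 ℕ.* e) 1 0≤R R≤1) (ℚ.≤-reflexive (ℚ.*-identityʳ R)))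
  U-bounded (suc (suc i)) = next (U (suc i)) (U-order (suc i)) (U-bounded (suc i))
    where
    next : ∀ u → Order 1 u → Bounded R ½ u → Bounded R ½ (nextSeries u)
    next u u≡0 u≤½ = Bounded-weaken {R} {R * ((½ * 2ℚ) * (½ * 2ℚ))} {½} {nextSeries u} R≤½
      (Bounded-shift (M ⊠ M) (Bounded-⊠ M M M≤ M≤))
      where
      M : Coeffs
      M = u ⊠ inverse u
      M≤ : Bounded R (½ * 2ℚ) M
      M≤ = Bounded-⊠ u (inverse u) u≤½ (Bounded-inverse u u≡0 u≤½)

  heightSeries-bounded : Bounded R 4ℚ (heightSeries e U₀)
  heightSeries-bounded = Bounded-infiniteSum (heightSeries-term e U₀) (λ i → ∣ ½ ^ℚ i ∣ * 2ℚ) 4ℚ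
    (Order-heightSeries-term e U₀ U₀-order)
    (λ i → Bounded-scale (½ ^ℚ i) (logSeries (U i)) (Bounded-logSeries (U i) (U-order i) (U-bounded i)))
    heightSeries-bound

  module OrbitValues {s t x₀ : ℚ} (∣s∣≤ : ∣ s ∣ ≤ ½ * R) (st≡1 : s * t ≡ 1ℚ)
    (U₀-sums : Sums U₀ s (x₀ * s ^ℚ suc e - 1ℚ)) where
    open Evaluation ∣s∣≤

    x : ℕ → ℚ
    x = fold x₀ (f t)

    ½≤1+ : ∀ {v} → ∣ v ∣ ≤ ½ → ½ ≤ 1ℚ + v
    ½≤1+ {v} ∣v∣≤½ = ≤-by (∣p∣≤q⇒0≤q+p ∣v∣≤½) (eq v)
      where
      eq : ∀ v → 1ℚ + v ≡ ½ + (½ + v)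
      eq = solve-∀ ring

    -- The value `t / xᵢ²` is characterised by a product, which avoids dividing by `xᵢ` before it is
    -- known to be nonzero. The reciprocals taken are those of `1 + v`, which is at least ½ by
    -- `Sums-bound`.
    values : ∀ i → ∃[ v ] Sums (U (suc i)) s v × (x i * x i) * v ≡ t
    values zero = first (reciprocal (x₀ * s ^ℚ suc e) 0<)
      where
      eq₀ : ∀ y → 1ℚ + (y - 1ℚ) ≡ y
      eq₀ = solve-∀ ring
      0< : 0ℚ < x₀ * s ^ℚ suc e
      0< = subst (0ℚ <_) (eq₀ (x₀ * s ^ℚ suc e))
        (ℚ.<-≤-trans 0<½ (½≤1+ (Sums-bound U₀ (x₀ * s ^ℚ suc e - 1ℚ) U₀-bounded U₀-sums)))
      first : ∃[ r ] 0ℚ < r × (x₀ * s ^ℚ suc e) * r ≡ 1ℚ → ∃[ v ] Sums (U 1) s v × (x₀ * x₀) * v ≡ t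
      -- Here `r = 1 / (1 + u₀)`. Multiplying by `x₀²` and inserting `s t = 1` gives
      -- `t (x₀ s^(e+1) r)² = t`.
      first (r , _ , hr) = s ^ℚ suc (2 ℕ.* e) * (r * r)
        , Sums-shiftBy (suc (2 ℕ.* e)) (inverse U₀ ⊠ inverse U₀) s (r * r)
            (Sums-⊠ (inverse U₀) (inverse U₀) r r B B S S)
        , trans (cong (λ a → (x₀ * x₀) * (s * a * (r * r))) s^2e) (value x₀ s (s ^ℚ e) r t hr st≡1)
        where
        B : Bounded R 2ℚ (inverse U₀)
        B = Bounded-inverse U₀ U₀-order U₀-bounded
        S : Sums (inverse U₀) s r
        S = Sums-inverse ∣s∣≤ U₀ (x₀ * s ^ℚ suc e - 1ℚ) r U₀-order U₀-bounded U₀-sums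
          (trans (cong (r *_) (eq₀ (x₀ * s ^ℚ suc e))) (trans (ℚ.*-comm r (x₀ * s ^ℚ suc e)) hr))
        s^2e : s ^ℚ (2 ℕ.* e) ≡ s ^ℚ e * s ^ℚ e
        s^2e = trans (^-2* s e) (^-distribʳ-* s s e)
        eq₁ : ∀ x s p r t → ((x * x) * (s * (p * p) * (r * r))) * (s * t) ≡ t * (((x * (s * p)) * r) *
            ((x * (s * p)) * r))
        eq₁ = solve-∀ ring
        eq₂ : ∀ t → t * (1ℚ * 1ℚ) ≡ t
        eq₂ = solve-∀ ring
        value : ∀ x s p r t → (x * (s * p)) * r ≡ 1ℚ → s * t ≡ 1ℚ → (x * x) * (s * (p * p) * (r * r)) ≡ t
        value x s p r t hr st≡1 = trans (sym (ℚ.*-identityʳ ((x * x) * (s * (p * p) * (r * r)))))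
          (trans (cong ((x * x) * (s * (p * p) * (r * r)) *_) (sym st≡1))
            (trans (eq₁ x s p r t) (trans (cong (λ a → t * (a * a)) hr) (eq₂ t))))
    values (suc i) = next (values i)
      where
      next : ∃[ v ] Sums (U (suc i)) s v × (x i * x i) * v ≡ t →
          ∃[ v ] Sums (U (suc (suc i))) s v × (x (suc i) * x (suc i)) * v ≡ t
      next (v , S , hv) = use (reciprocal (1ℚ + v) (ℚ.<-≤-trans 0<½ (½≤1+ (Sums-bound (U (suc i)) v
          (U-bounded (suc i)) S))))
        where
        use : ∃[ r ] 0ℚ < r × (1ℚ + v) * r ≡ 1ℚ →
            ∃[ v ] Sums (U (suc (suc i))) s v × (x (suc i) * x (suc i)) * v ≡ t
        -- With `y = xᵢ²` and `y v = t` one has `xᵢ₊₁ = y (1 + v)`, so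
        -- `xᵢ₊₁² s (v r)² = s (y v)² = s t² = t`.
        use (r , _ , hr) = s * ((v * r) * (v * r))
          , Sums-shift (M ⊠ M) s ((v * r) * (v * r)) (Sums-⊠ M M (v * r) (v * r) M≤ M≤ M-sums M-sums)
          , value (x i * x i) v s r t hv hr st≡1
          where
          M : Coeffs
          M = U (suc i) ⊠ inverse (U (suc i))
          I≤ : Bounded R 2ℚ (inverse (U (suc i)))
          I≤ = Bounded-inverse (U (suc i)) (U-order (suc i)) (U-bounded (suc i))
          M≤ : Bounded R (½ * 2ℚ) M
          M≤ = Bounded-⊠ (U (suc i)) (inverse (U (suc i))) (U-bounded (suc i)) I≤
          M-sums : Sums M s (v * r)
          M-sums = Sums-⊠ (U (suc i)) (inverse (U (suc i))) v r (U-bounded (suc i)) I≤ S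
            (Sums-inverse ∣s∣≤ (U (suc i)) v r (U-order (suc i)) (U-bounded (suc i)) S (trans (ℚ.*-comm r
                (1ℚ + v)) hr))
          eq₁ : ∀ y v s r → ((y + y * v) * (y + y * v)) * (s * ((v * r) * (v * r))) ≡ (s * (y * v)) *
              ((y * v) * (((1ℚ + v) * r) * ((1ℚ + v) * r)))
          eq₁ = solve-∀ ring
          eq₂ : ∀ t → 1ℚ * (t * (1ℚ * 1ℚ)) ≡ t
          eq₂ = solve-∀ ring
          value : ∀ y v s r t → y * v ≡ t → (1ℚ + v) * r ≡ 1ℚ → s * t ≡ 1ℚ →
              ((y + t) * (y + t)) * (s * ((v * r) * (v * r))) ≡ t
          value y v s r _ refl hr st≡1 = trans (eq₁ y v s r)
            (trans (cong₂ (λ a b → a * ((y * v) * (b * b))) st≡1 hr) (eq₂ (y * v)))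

    v : ℕ → ℚ
    v zero    = x₀ * s ^ℚ suc e - 1ℚ
    v (suc i) = proj₁ (values i)

    v-sums : ∀ i → Sums (U i) s (v i)
    v-sums zero    = U₀-sums
    v-sums (suc i) = proj₁ (proj₂ (values i))

    ½≤1+v : ∀ i → ½ ≤ 1ℚ + v i
    ½≤1+v i = ½≤1+ (Sums-bound (U i) (v i) (U-bounded i) (v-sums i))

    0≤1+v : ∀ i → 0ℚ ≤ 1ℚ + v i
    0≤1+v i = ℚ.≤-trans 0≤½ (½≤1+v i)

    0<2+v : ∀ i → 0ℚ < 2ℚ + v i
    0<2+v i = subst (0ℚ <_) (eq (v i)) (ℚ.+-mono-<-≤ 0<1 (0≤1+v i))
      where
      eq : ∀ v → 1ℚ + (1ℚ + v) ≡ 2ℚ + v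
      eq = solve-∀ ring

    w : ℕ → ℚ
    w i = v i * proj₁ (reciprocal (2ℚ + v i) (0<2+v i))

    w-spec : ∀ i → w i * (2ℚ + v i) ≡ v i
    w-spec i = spec (v i) (reciprocal (2ℚ + v i) (0<2+v i))
      where
      eq : ∀ v a r → (v * r) * a ≡ v * (a * r)
      eq = solve-∀ ring
      spec : ∀ v {a} (r : ∃[ r ] 0ℚ < r × a * r ≡ 1ℚ) → (v * proj₁ r) * a ≡ v
      spec v {a} (r , _ , ar≡1) = trans (eq v a r) (trans (cong (v *_) ar≡1) (ℚ.*-identityʳ v))

    ∣w∣≤½ : ∀ i → ∣ w i ∣ ≤ ½
    ∣w∣≤½ i = Sums-bound (toCayley (U i)) (w i) (Bounded-toCayley (U i) (U-order i) (U-bounded i))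
      (Sums-toCayley ∣s∣≤ (U i) (v i) (w i) (U-order i) (U-bounded i) (v-sums i) (0<2+v i) (w-spec i))

    x-first : x₀ * s ^ℚ suc e ≡ 1ℚ + v 0
    x-first = eq (x₀ * s ^ℚ suc e)
      where
      eq : ∀ y → y ≡ 1ℚ + (y - 1ℚ)
      eq = solve-∀ ring

    x-next : ∀ i → x (suc i) ≡ (x i * x i) * (1ℚ + v (suc i))
    x-next i = trans (cong (λ a → x i * x i + a) (sym (proj₂ (proj₂ (values i))))) (eq (x i * x i) (v (suc i)))
      where
      eq : ∀ y v → y + y * v ≡ y * (1ℚ + v)
      eq = solve-∀ ring

    ∣s∣*∣t∣≡1 : ∣ s ∣ * ∣ t ∣ ≡ 1ℚ
    ∣s∣*∣t∣≡1 = trans (sym (ℚ.∣p*q∣≡∣p∣*∣q∣ s t)) (cong ∣_∣ st≡1)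

    16≤∣t∣ : 4ℚ * 4ℚ ≤ ∣ t ∣
    16≤∣t∣ = bound ∣ s ∣ ∣ t ∣ ∣s∣≤ ∣s∣*∣t∣≡1 (ℚ.0≤∣p∣ t)
      where
      eq : ∀ t R s → t ≡ 4ℚ * 4ℚ * (s * t) + (t * (1ℚ - R * (4ℚ * 2ℚ)) + 4ℚ * 4ℚ * (t * (½ * R - s)))
      eq = solve-∀ ring
      bound : ∀ s t → s ≤ ½ * R → s * t ≡ 1ℚ → 0ℚ ≤ t → 4ℚ * 4ℚ ≤ t
      bound s t s≤ st≡1 0≤t = ≤-by (0≤p+q (0≤p*q 0≤t (p≤q⇒0≤q-p R≤⅛))
          (0≤p*q (0≤p*q 0≤4 0≤4) (0≤p*q 0≤t (p≤q⇒0≤q-p s≤))))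
        (trans (eq t R s) (cong (λ a → 4ℚ * 4ℚ * a + (t * (1ℚ - R * (4ℚ * 2ℚ)) + 4ℚ * 4ℚ * (t *
            (½ * R - s)))) st≡1))

    4≤∣t∣ : 4ℚ ≤ ∣ t ∣
    4≤∣t∣ = ℚ.≤-trans (≤-by {e = 4ℚ + 4ℚ + 4ℚ} (0≤p+q (0≤p+q 0≤4 0≤4) 0≤4) refl) 16≤∣t∣

    1≤∣t∣ : 1ℚ ≤ ∣ t ∣
    1≤∣t∣ = ℚ.≤-trans (≤-by {e = 1ℚ + 2ℚ} (0≤p+q 0≤1 0≤2) refl) 4≤∣t∣

    ∣x-first∣ : ∣ x₀ ∣ ≡ ∣ t ∣ ^ℚ suc e * (1ℚ + v 0)
    ∣x-first∣ = begin
      ∣ x₀ ∣                                                   ≡⟨ ℚ.*-identityʳ ∣ x₀ ∣ ⟨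
      ∣ x₀ ∣ * 1ℚ                                              ≡⟨ cong (∣ x₀ ∣ *_) (1^n≡1 (suc e)) ⟨
      ∣ x₀ ∣ * 1ℚ ^ℚ suc e                                     ≡⟨ cong (λ a → ∣ x₀ ∣ * a ^ℚ suc e) ∣s∣*∣t∣≡1 ⟨
      ∣ x₀ ∣ * (∣ s ∣ * ∣ t ∣) ^ℚ suc e                         ≡⟨ cong (∣ x₀ ∣ *_)
          (^-distribʳ-* ∣ s ∣ ∣ t ∣ (suc e)) ⟩
      ∣ x₀ ∣ * (∣ s ∣ ^ℚ suc e * ∣ t ∣ ^ℚ suc e)                ≡⟨ eq′ ∣ x₀ ∣ (∣ s ∣ ^ℚ suc e)
          (∣ t ∣ ^ℚ suc e) ⟩
      ∣ t ∣ ^ℚ suc e * (∣ x₀ ∣ * ∣ s ∣ ^ℚ suc e)                ≡⟨ cong (λ a → ∣ t ∣ ^ℚ suc e *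
          (∣ x₀ ∣ * a)) (∣^∣ s (suc e)) ⟨
      ∣ t ∣ ^ℚ suc e * (∣ x₀ ∣ * ∣ s ^ℚ suc e ∣)                ≡⟨ cong (∣ t ∣ ^ℚ suc e *_)
          (ℚ.∣p*q∣≡∣p∣*∣q∣ x₀ (s ^ℚ suc e)) ⟨
      ∣ t ∣ ^ℚ suc e * ∣ x₀ * s ^ℚ suc e ∣                      ≡⟨ cong (λ a → ∣ t ∣ ^ℚ suc e * ∣ a ∣) x-first ⟩
      ∣ t ∣ ^ℚ suc e * ∣ 1ℚ + v 0 ∣                             ≡⟨ cong (∣ t ∣ ^ℚ suc e *_) (ℚ.0≤p⇒∣p∣≡p
          (0≤1+v 0)) ⟩
      ∣ t ∣ ^ℚ suc e * (1ℚ + v 0)                              ∎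
      where
      open ≡-Reasoning
      eq′ : ∀ a b c → a * (b * c) ≡ c * (a * b)
      eq′ = solve-∀ ring

    ∣x-next∣ : ∀ i → ∣ x (suc i) ∣ ≡ (∣ x i ∣ * ∣ x i ∣) * (1ℚ + v (suc i))
    ∣x-next∣ i = trans (cong ∣_∣ (x-next i)) (trans (ℚ.∣p*q∣≡∣p∣*∣q∣ (x i * x i) (1ℚ + v (suc i)))
      (cong₂ _*_ (ℚ.∣p*q∣≡∣p∣*∣q∣ (x i) (x i)) (ℚ.0≤p⇒∣p∣≡p (0≤1+v (suc i)))))

    -- Heights call only for `1 ≤ ∣ xᵢ ∣`, but the factor `1 + v` is merely known to be at least ½,
    -- so the induction is run with 2, for which `2 · 2 · ½ = 2`.
    2≤∣x∣ : ∀ i → 2ℚ ≤ ∣ x i ∣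
    2≤∣x∣ zero = subst (2ℚ ≤_) (sym ∣x-first∣) (ℚ.≤-trans (ℚ.≤-reflexive {2ℚ} {4ℚ * ½} refl)
      (*-mono-≤ 0≤4 (0≤1+v 0) (ℚ.≤-trans 4≤∣t∣ ∣t∣≤∣t∣^) (½≤1+v 0)))
      where
      ∣t∣≤∣t∣^ : ∣ t ∣ ≤ ∣ t ∣ ^ℚ suc e
      ∣t∣≤∣t∣^ = subst (_≤ ∣ t ∣ ^ℚ suc e) (ℚ.*-identityʳ ∣ t ∣)
        (ℚ.*-monoˡ-≤-nonNeg ∣ t ∣ ⦃ ℚ.nonNegative (ℚ.0≤∣p∣ t) ⦄ (subst (_≤ ∣ t ∣ ^ℚ e) (1^n≡1 e)
            (^-monoˡ-≤ e 0≤1 1≤∣t∣)))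
    2≤∣x∣ (suc i) = subst (2ℚ ≤_) (sym (∣x-next∣ i)) (ℚ.≤-trans (ℚ.≤-reflexive {2ℚ} {(2ℚ * 2ℚ) * ½} refl)
      (*-mono-≤ 0≤4 (0≤1+v (suc i)) (*-mono-≤ 0≤2 (ℚ.0≤∣p∣ (x i)) (2≤∣x∣ i) (2≤∣x∣ i)) (½≤1+v (suc i))))

    1≤∣x∣ : ∀ i → 1ℚ ≤ ∣ x i ∣
    1≤∣x∣ i = ℚ.≤-trans (≤-by {e = 1ℚ} 0≤1 refl) (2≤∣x∣ i)

    -- For t = a / b in lowest terms, |x i| b^(2^i d) is the numerator of x i up
    -- to sign; the extra initial entry |a|^d starts the telescoping.
    module Numerators {b : ℚ} (1≤b : 1ℚ ≤ b) where

      numerator : ℕ → ℚ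
      numerator zero    = (∣ t ∣ * b) ^ℚ suc e
      numerator (suc i) = ∣ x i ∣ * b ^ℚ (2 ℕ.^ i ℕ.* suc e)

      1≤1*1 : ∀ {p q} → 1ℚ ≤ p → 1ℚ ≤ q → 1ℚ ≤ p * q
      1≤1*1 1≤p 1≤q = *-mono-≤ 0≤1 (ℚ.≤-trans 0≤1 1≤q) 1≤p 1≤q

      1≤^ : ∀ {p} n → 1ℚ ≤ p → 1ℚ ≤ p ^ℚ n
      1≤^ {p} n 1≤p = subst (_≤ p ^ℚ n) (1^n≡1 n) (^-monoˡ-≤ n 0≤1 1≤p)

      1≤numerator : ∀ i → 1ℚ ≤ numerator i
      1≤numerator zero    = 1≤^ (suc e) (1≤1*1 1≤∣t∣ 1≤b)
      1≤numerator (suc i) = 1≤1*1 (1≤∣x∣ i) (1≤^ (2 ℕ.^ i ℕ.* suc e) 1≤b)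

      numerator-first : numerator 1 ≡ numerator 0 * (1ℚ + v 0)
      numerator-first = trans (cong₂ (λ a m → a * b ^ℚ m) ∣x-first∣ (ℕ.+-identityʳ (suc e)))
        (trans (eq (∣ t ∣ ^ℚ suc e) (1ℚ + v 0) (b ^ℚ suc e)) (cong (_* (1ℚ + v 0)) (sym
            (^-distribʳ-* ∣ t ∣ b (suc e)))))
        where
        eq : ∀ T u B → (T * u) * B ≡ (T * B) * u
        eq = solve-∀ ring

      numerator-next : ∀ i → numerator (suc (suc i)) ≡ (numerator (suc i) * numerator (suc i)) * (1ℚ + v
          (suc i))
      numerator-next i = trans (cong₂ _*_ (∣x-next∣ i) (trans (cong (b ^ℚ_) (sym (2^suc* i (suc e))))
          (^-+ b (2 ℕ.^ i ℕ.* suc e) (2 ℕ.^ i ℕ.* suc e))))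
        (eq ∣ x i ∣ (1ℚ + v (suc i)) (b ^ℚ (2 ℕ.^ i ℕ.* suc e)))
        where
        eq : ∀ X u B → ((X * X) * u) * (B * B) ≡ ((X * B) * (X * B)) * u
        eq = solve-∀ ring

      open Telescoping numerator v w 1≤numerator w-spec numerator-first numerator-next

      heightSeries-close : ∀ n → ∣ partial (heightSeries e U₀) s n - ∑<ℚ n (correction n) ∣ ≤ 4ℚ * ½ ^ℚ n
      heightSeries-close = infiniteSum-close (heightSeries-term e U₀) (λ i → ∣ ½ ^ℚ i ∣ * 2ℚ) 4ℚ
        (λ i n → correction n i) (Order-heightSeries-term e U₀ U₀-order) heightSeries-bound
        (λ i n → close i n)
        where
        eq : ∀ h p a → h * p - h * a ≡ h * (p - a)
        eq = solve-∀ ring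
        close : ∀ i n → ∣ partial (heightSeries-term e U₀ i) s n - correction n i ∣ ≤ (∣ ½ ^ℚ i ∣ * 2ℚ) * ½ ^ℚ n
        close i n = subst₂ _≤_
          (cong ∣_∣ (sym (trans (cong (_- correction n i) (partial-scale (½ ^ℚ i) (logSeries (U i)) s n))
            (eq (½ ^ℚ i) (partial (logSeries (U i)) s n) (2artanh (w i) n)))))
          (sym (ℚ.*-assoc ∣ ½ ^ℚ i ∣ 2ℚ (½ ^ℚ n)))
          (∣p*q∣≤ (½ ^ℚ i) (partial (logSeries (U i)) s n - 2artanh (w i) n) ℚ.≤-refl
            (logSeries-close ∣s∣≤ (U i) (v i) (w i) (U-order i) (U-bounded i) (v-sums i) (0<2+v i)
                (w-spec i) n))

      height-limit : (λ N n → ½ ^ℚ N * lg (numerator (suc N)) n) ⇝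
        (λ n → fromℕ (suc e) * lg (∣ t ∣ * b) n + partial (heightSeries e U₀) s n)
      height-limit = ⇝-respʳ (λ N n → ½ ^ℚ N * lg (numerator (suc N)) n)
        (λ n → lg (numerator 0) n + partial (heightSeries e U₀) s n)
        (λ n → fromℕ (suc e) * lg (∣ t ∣ * b) n + partial (heightSeries e U₀) s n)
        (Null-cong {y = λ n → lg (numerator 0) n - fromℕ (suc e) * lg (∣ t ∣ * b) n}
          (λ n → eq (lg (numerator 0) n) (fromℕ (suc e) * lg (∣ t ∣ * b) n) (partial (heightSeries e U₀) s n))
          (lg-^ (1≤1*1 1≤∣t∣ 1≤b) (suc e)))
        (telescope-limit ∣w∣≤½ (partial (heightSeries e U₀) s) heightSeries-close)
        where
        eq : ∀ a b c → (a + c) - (b + c) ≡ a - b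
        eq = solve-∀ ring

-- Heights along the orbit

fromℤ-* : ∀ i j → fromℤ (i ℤ.* j) ≡ fromℤ i * fromℤ j
fromℤ-* i j = ℚ.toℚᵘ-injective (begin
  ℚ.toℚᵘ (fromℤ (i ℤ.* j))               ≈⟨ ℚ.toℚᵘ-fromℚᵘ (ℚᵘ.mkℚᵘ (i ℤ.* j) 0) ⟩
  ℚᵘ.mkℚᵘ i 0 ℚᵘ.* ℚᵘ.mkℚᵘ j 0           ≈⟨ ℚᵘ.*-cong (ℚ.toℚᵘ-fromℚᵘ (ℚᵘ.mkℚᵘ i 0)) (ℚ.toℚᵘ-fromℚᵘ
      (ℚᵘ.mkℚᵘ j 0)) ⟨
  ℚ.toℚᵘ (fromℤ i) ℚᵘ.* ℚ.toℚᵘ (fromℤ j) ≈⟨ ℚ.toℚᵘ-homo-* (fromℤ i) (fromℤ j) ⟨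
  ℚ.toℚᵘ (fromℤ i * fromℤ j)             ∎)
  where open ℚᵘ.≃-Reasoning

fromℤ-+ : ∀ i j → fromℤ (i ℤ.+ j) ≡ fromℤ i + fromℤ j
fromℤ-+ i j = ℚ.toℚᵘ-injective (begin
  ℚ.toℚᵘ (fromℤ (i ℤ.+ j))               ≈⟨ ℚ.toℚᵘ-fromℚᵘ (ℚᵘ.mkℚᵘ (i ℤ.+ j) 0) ⟩
  ℚᵘ.mkℚᵘ (i ℤ.+ j) 0                    ≈⟨ ℚᵘ.*≡* (cong (ℤ._* 1ℤ) (cong₂ ℤ._+_ (sym (ℤ.*-identityʳ i))
      (sym (ℤ.*-identityʳ j)))) ⟩
  ℚᵘ.mkℚᵘ i 0 ℚᵘ.+ ℚᵘ.mkℚᵘ j 0           ≈⟨ ℚᵘ.+-cong (ℚ.toℚᵘ-fromℚᵘ (ℚᵘ.mkℚᵘ i 0)) (ℚ.toℚᵘ-fromℚᵘ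
      (ℚᵘ.mkℚᵘ j 0)) ⟨
  ℚ.toℚᵘ (fromℤ i) ℚᵘ.+ ℚ.toℚᵘ (fromℤ j) ≈⟨ ℚ.toℚᵘ-homo-+ (fromℤ i) (fromℤ j) ⟨
  ℚ.toℚᵘ (fromℤ i + fromℤ j)             ∎)
  where open ℚᵘ.≃-Reasoning

fromℕ-^ : ∀ b n → fromℕ (b ℕ.^ n) ≡ fromℕ b ^ℚ n
fromℕ-^ b zero    = refl
fromℕ-^ b (suc n) = trans (cong fromℤ (ℤ.pos-* b (b ℕ.^ n)))
  (trans (fromℤ-* (+ b) (+ (b ℕ.^ n))) (cong (fromℕ b *_) (fromℕ-^ b n)))

*-fromℕ-↧ : ∀ x → x * fromℕ (↧ₙ x) ≡ fromℤ (↥ x)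
*-fromℕ-↧ x@(ℚ.mkℚ _ d _) = trans (cong (_* fromℕ (suc d)) (sym (ℚ.↥p/↧p≡p x))) (/-cancel (↥ x) d)

∣fromℤ∣ : ∀ i → ∣ fromℤ i ∣ ≡ fromℕ ℤ.∣ i ∣
∣fromℤ∣ (+ n)      = ℚ.0≤p⇒∣p∣≡p (0≤fromℕ n)
∣fromℤ∣ ℤ.-[1+ n ] = trans (ℚ.∣-p∣≡∣p∣ (fromℕ (suc n))) (ℚ.0≤p⇒∣p∣≡p (0≤fromℕ (suc n)))

fromℕ-∣↥∣ : ∀ x → fromℕ ℤ.∣ ↥ x ∣ ≡ ∣ x ∣ * fromℕ (↧ₙ x)
fromℕ-∣↥∣ x = trans (sym (∣fromℤ∣ (↥ x))) (trans (cong ∣_∣ (sym (*-fromℕ-↧ x)))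
  (trans (ℚ.∣p*q∣≡∣p∣*∣q∣ x (fromℕ (↧ₙ x))) (cong (∣ x ∣ *_) (ℚ.0≤p⇒∣p∣≡p (0≤fromℕ (↧ₙ x))))))

fromℕ-cancel-≤ : ∀ {m n} → fromℕ m ≤ fromℕ n → m ℕ.≤ n
fromℕ-cancel-≤ {m} {n} m≤n with m ℕ.≤? n
... | yes le = le
... | no  nle = contradiction (ℚ.<-≤-trans n<n+1 (ℚ.≤-trans (fromℕ-mono (ℕ.≰⇒> nle)) m≤n)) (ℚ.<-irrefl refl)
  where
  n<n+1 : fromℕ n < fromℕ (suc n)
  n<n+1 = subst₂ _<_ (ℚ.+-identityˡ (fromℕ n)) (sym (fromℕ-suc n)) (ℚ.+-monoˡ-< (fromℕ n) 0<1)

log-lg : ∀ m .⦃ _ : ℕ.NonZero m ⦄ n → seq (log m) n ≡ lg (fromℕ m) n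
log-lg (suc k) n = cong (λ w → 2artanh w n) (sym (cayley-unique {fromℕ (suc k)} {+ k / suc (suc k)}
    (0≤fromℕ (suc k)) spec))
  where
  eq₂ : ∀ a → a ≡ (1ℚ + a) - 1ℚ
  eq₂ = solve-∀ ring
  spec : (+ k / suc (suc k)) * (fromℕ (suc k) + 1ℚ) ≡ fromℕ (suc k) - 1ℚ
  spec = trans (cong ((+ k / suc (suc k)) *_) (sym (trans (fromℕ-suc (suc k)) (ℚ.+-comm 1ℚ (fromℕ (suc k))))))
    (trans (/-cancel (+ k) (suc k)) (trans (eq₂ (fromℕ k)) (cong (_- 1ℚ) (sym (fromℕ-suc k)))))

-- For `∣ x ∣ ≥ 1` the maximum in the definition of `h` is attained by the numerator.
h-lg : ∀ x → 1ℚ ≤ ∣ x ∣ → ∀ n → seq (h x) n ≡ lg (∣ x ∣ * fromℕ (↧ₙ x)) n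
h-lg x 1≤∣x∣ n = trans (log-lg (ℤ.∣ ↥ x ∣ ℕ.⊔ ↧ₙ x) ⦃ _ ⦄ n)
  (cong (λ q → lg q n) (trans (cong fromℕ (ℕ.m≥n⇒m⊔n≡m {ℤ.∣ ↥ x ∣} {↧ₙ x}
      (fromℕ-cancel-≤ {↧ₙ x} {ℤ.∣ ↥ x ∣} ↧≤↥))) (fromℕ-∣↥∣ x)))
  where
  ↧≤↥ : fromℕ (↧ₙ x) ≤ fromℕ ℤ.∣ ↥ x ∣
  ↧≤↥ = subst₂ _≤_ (ℚ.*-identityˡ (fromℕ (↧ₙ x))) (sym (fromℕ-∣↥∣ x))
    (ℚ.*-monoʳ-≤-nonNeg (fromℕ (↧ₙ x)) ⦃ ℚ.nonNegative (0≤fromℕ (↧ₙ x)) ⦄ 1≤∣x∣)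

coprime-∣ : ∀ {d m n} → d ℕ.∣ m → Coprime m n → Coprime d n
coprime-∣ d∣m c (e∣d , e∣n) = c (∣-trans e∣d d∣m , e∣n)

coprime-^ : ∀ {m b} n → Coprime m b → Coprime m (b ℕ.^ n)
coprime-^ zero    c (_ , d∣1) = ℕ.∣1⇒≡1 d∣1
coprime-^ (suc n) c (d∣m , d∣bbⁿ) =
  coprime-^ n c (d∣m , Coprimality.coprime-divisor (coprime-∣ d∣m c) d∣bbⁿ)

-- A common divisor of the sum and `b` divides `A B`. Being coprime to `A`, it divides `B`, and
-- hence it is 1.
coprime-*+ : ∀ A B C {b} → Coprime ℤ.∣ A ∣ b → Coprime ℤ.∣ B ∣ b → Coprime ℤ.∣ A ℤ.* B ℤ.+ + b ℤ.* C ∣ b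
coprime-*+ A B C {b} A⊥b B⊥b {d} (d∣ , d∣b) = B⊥b
  ( Coprimality.coprime-divisor (λ (e∣d , e∣A) → A⊥b (e∣A , ∣-trans e∣d d∣b))
      (subst (d ℕ.∣_) (ℤ.abs-* A B) (ℤ.∣⇒∣ᵤ {+ d} {A ℤ.* B} d∣AB))
  , d∣b)
  where
  d∣AB : + d ℤ.∣ A ℤ.* B
  d∣AB = ℤ.∣m+n∣n⇒∣m {+ d} {A ℤ.* B} {+ b ℤ.* C} (ℤ.∣ᵤ⇒∣ d∣) (ℤ.∣m⇒∣m*n {+ d} {+ b} C (ℤ.∣ᵤ⇒∣ d∣b))

↧-unique : ∀ x A B .⦃ _ : ℕ.NonZero B ⦄ → Coprime ℤ.∣ A ∣ B → x * fromℕ B ≡ fromℤ A → ↧ₙ x ≡ B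
↧-unique x A (suc B) c xB≡A = cong ↧ₙ_ (*-cancelʳ {x} {y} {fromℕ (suc B)} (0<fromℕ-suc B) (trans xB≡A (sym
    (*-fromℕ-↧ y))))
  where
  y : ℚ
  y = ℚ.mkℚ A B c

data MonicOfDegree {A : Set} (one : A) : ℕ → List A → Set where
  leading : MonicOfDegree one 0 [ one ]
  _∷_     : ∀ c {d p} → MonicOfDegree one d p → MonicOfDegree one (suc d) (c ∷ p)

monicOfDegree : ∀ P → Monic P → ∃[ d ] MonicOfDegree 1ℤ d P
monicOfDegree (c ∷ [])    refl  = 0 , leading
monicOfDegree (c ∷ d ∷ P) monic with monicOfDegree (d ∷ P) monic
... | n , m = suc n , c ∷ m

-- x is A / b ^ D in lowest terms.
HasNumerator : ℕ → ℕ → ℚ → Set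
HasNumerator b D x = ∃[ A ] Coprime ℤ.∣ A ∣ b × x * fromℕ (b ℕ.^ D) ≡ fromℤ A

-- Horner's scheme: if `y = A / b^d`, the numerator of `c + t y` is `a A` modulo `b`, because `c` is
-- an integer. Monicity starts the induction with the numerator 1.
eval-numerator : ∀ t {d P} → MonicOfDegree 1ℤ d P → HasNumerator (↧ₙ t) d (eval (ℤ[t]⇒ℚ[t] P) t)
eval-numerator t leading = 1ℤ , (λ (d∣1 , _) → ℕ.∣1⇒≡1 d∣1) , eq t
  where
  eq : ∀ t → (1ℚ + t * 0ℚ) * 1ℚ ≡ 1ℚ
  eq = solve-∀ ring
eval-numerator t@(ℚ.mkℚ a b-1 a⊥b) (_∷_ c {d} {P} monic) = next (eval-numerator t monic)
  where
  b : ℕ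
  b = suc b-1
  y : ℚ
  y = eval (ℤ[t]⇒ℚ[t] P) t
  eq₁ : ∀ c t y b B → (c + t * y) * (b * B) ≡ (t * b) * (y * B) + b * (c * B)
  eq₁ = solve-∀ ring
  next : HasNumerator b d y → HasNumerator b (suc d) (fromℤ c + t * y)
  next (A , A⊥b , yB≡A) = a ℤ.* A ℤ.+ + b ℤ.* (c ℤ.* + (b ℕ.^ d))
    , coprime-*+ a A (c ℤ.* + (b ℕ.^ d)) (Coprimality.recompute a⊥b) A⊥b
    , (begin
      (fromℤ c + t * y) * fromℕ (b ℕ.^ suc d)
        ≡⟨ cong ((fromℤ c + t * y) *_) (trans (cong fromℤ (ℤ.pos-* b (b ℕ.^ d))) (fromℤ-* (+ b) (+
            (b ℕ.^ d)))) ⟩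
      (fromℤ c + t * y) * (fromℕ b * fromℕ (b ℕ.^ d))
        ≡⟨ eq₁ (fromℤ c) t y (fromℕ b) (fromℕ (b ℕ.^ d)) ⟩
      (t * fromℕ b) * (y * fromℕ (b ℕ.^ d)) + fromℕ b * (fromℤ c * fromℕ (b ℕ.^ d))
        ≡⟨ cong₂ _+_ (cong₂ _*_ (*-fromℕ-↧ t) yB≡A) (cong (fromℕ b *_) (sym (fromℤ-* c (+ (b ℕ.^ d))))) ⟩
      fromℤ a * fromℤ A + fromℕ b * fromℤ (c ℤ.* + (b ℕ.^ d))
        ≡⟨ cong₂ _+_ (sym (fromℤ-* a A)) (sym (fromℤ-* (+ b) (c ℤ.* + (b ℕ.^ d)))) ⟩
      fromℤ (a ℤ.* A) + fromℤ (+ b ℤ.* (c ℤ.* + (b ℕ.^ d)))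
        ≡⟨ fromℤ-+ (a ℤ.* A) (+ b ℤ.* (c ℤ.* + (b ℕ.^ d))) ⟨
      fromℤ (a ℤ.* A ℤ.+ + b ℤ.* (c ℤ.* + (b ℕ.^ d))) ∎)
    where open ≡-Reasoning

-- For nonzero `D` the contribution `t b^(2D) = a b^(2D-1)` is divisible by `b`, so the new
-- numerator is `A²` modulo `b`. For `D = 0` the denominator would jump from 1 to `b`, which is why
-- constant `P` is treated apart.
f-numerator : ∀ t D .⦃ _ : ℕ.NonZero D ⦄ x → HasNumerator (↧ₙ t) D x → HasNumerator (↧ₙ t) (D ℕ.+ D) (f t x)
f-numerator t (suc D) x (A , A⊥b , xB≡A) = A ℤ.* A ℤ.+ + b ℤ.* (↥ t ℤ.* E)
    , coprime-*+ A A (↥ t ℤ.* E) A⊥b A⊥b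
    , (begin
      (x * x + t) * fromℕ (b ℕ.^ (suc D ℕ.+ suc D))
        ≡⟨ cong ((x * x + t) *_) (trans (fromℕ-^ b (suc D ℕ.+ suc D)) (^-+ β (suc D) (suc D))) ⟩
      (x * x + t) * ((β * β ^ℚ D) * (β * β ^ℚ D))
        ≡⟨ eq₁ x t β (β ^ℚ D) ⟩
      (x * (β * β ^ℚ D)) * (x * (β * β ^ℚ D)) + β * ((t * β) * (β ^ℚ D * β ^ℚ D))
        ≡⟨ cong₂ (λ u v → u * u + β * (v * (β ^ℚ D * β ^ℚ D))) (trans (cong (x *_) (sym (fromℕ-^ b
            (suc D)))) xB≡A) (*-fromℕ-↧ t) ⟩
      fromℤ A * fromℤ A + β * (fromℤ (↥ t) * (β ^ℚ D * β ^ℚ D))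
        ≡⟨ cong (λ u → fromℤ A * fromℤ A + β * (fromℤ (↥ t) * u)) (trans (cong₂ _*_ (sym (fromℕ-^ b D))
            (sym (fromℕ-^ b D))) (sym (fromℤ-* (+ (b ℕ.^ D)) (+ (b ℕ.^ D))))) ⟩
      fromℤ A * fromℤ A + β * (fromℤ (↥ t) * fromℤ E)
        ≡⟨ cong₂ _+_ (sym (fromℤ-* A A)) (trans (cong (β *_) (sym (fromℤ-* (↥ t) E))) (sym (fromℤ-* (+ b)
            (↥ t ℤ.* E)))) ⟩
      fromℤ (A ℤ.* A) + fromℤ (+ b ℤ.* (↥ t ℤ.* E))
        ≡⟨ fromℤ-+ (A ℤ.* A) (+ b ℤ.* (↥ t ℤ.* E)) ⟨
      fromℤ (A ℤ.* A ℤ.+ + b ℤ.* (↥ t ℤ.* E)) ∎)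
  where
  open ≡-Reasoning
  b : ℕ
  b = ↧ₙ t
  β : ℚ
  β = fromℕ b
  E : ℤ
  E = + (b ℕ.^ D) ℤ.* + (b ℕ.^ D)
  eq₁ : ∀ x t b B → (x * x + t) * ((b * B) * (b * B)) ≡ (x * (b * B)) * (x * (b * B)) + b * ((t * b) * (B * B))
  eq₁ = solve-∀ ring

orbit-numerator : ∀ t e x → HasNumerator (↧ₙ t) (suc e) x → ∀ i →
    HasNumerator (↧ₙ t) (2 ℕ.^ i ℕ.* suc e) (fold x (f t) i)
orbit-numerator t e x num zero    = subst (λ D → HasNumerator (↧ₙ t) D x) (sym (ℕ.+-identityʳ (suc e))) num
orbit-numerator t e x num (suc i) = subst (λ D → HasNumerator (↧ₙ t) D (fold x (f t) (suc i))) (2^suc* i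
    (suc e))
  (f-numerator t (2 ℕ.^ i ℕ.* suc e) ⦃ ℕ.m*n≢0 (2 ℕ.^ i) (suc e) ⦃ ℕ.m^n≢0 2 i ⦄ ⦄ (fold x (f t) i)
      (orbit-numerator t e x num i))

orbit-height : ∀ t e x → HasNumerator (↧ₙ t) (suc e) x → ∀ i → 1ℚ ≤ ∣ fold x (f t) i ∣ → ∀ n →
  seq (h (fold x (f t) i)) n ≡ lg (∣ fold x (f t) i ∣ * fromℕ (↧ₙ t) ^ℚ (2 ℕ.^ i ℕ.* suc e)) n
orbit-height t@(ℚ.mkℚ _ b-1 _) e x num i 1≤∣x∣ n = trans (h-lg (fold x (f t) i) 1≤∣x∣ n)
  (cong (λ q → lg (∣ fold x (f t) i ∣ * q) n) (trans (cong fromℕ ↧≡) (fromℕ-^ (↧ₙ t) D)))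
  where
  D : ℕ
  D = 2 ℕ.^ i ℕ.* suc e
  ↧≡ : ↧ₙ (fold x (f t) i) ≡ ↧ₙ t ℕ.^ D
  ↧≡ with orbit-numerator t e x num i
  ... | A , A⊥b , eq = ↧-unique (fold x (f t) i) A (↧ₙ t ℕ.^ D) ⦃ ℕ.m^n≢0 (suc b-1) D ⦄ (coprime-^ D A⊥b) eq

-- The function field height

MonicOfDegree-map : ∀ {d P} → MonicOfDegree 1ℤ d P → MonicOfDegree 1ℚ d (ℤ[t]⇒ℚ[t] P)
MonicOfDegree-map leading     = leading
MonicOfDegree-map (c ∷ monic) = fromℤ c ∷ MonicOfDegree-map monic

degree-monic : ∀ {d p} → MonicOfDegree 1ℚ d p → degree p ≡ just d
degree-monic leading = refl
degree-monic (_∷_ c {d} {p} monic) with degree p | degree-monic monic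
... | just d | refl = refl

length-monic : ∀ {d p} → MonicOfDegree 1ℚ d p → length p ≡ suc d
length-monic leading     = refl
length-monic (c ∷ monic) = cong suc (length-monic monic)

+ₚ-monicʳ : ∀ {d} p {q} → length p ℕ.≤ d → MonicOfDegree 1ℚ d q → MonicOfDegree 1ℚ d (p +ₚ q)
+ₚ-monicʳ []      _           monic       = monic
+ₚ-monicʳ (c ∷ p) (ℕ.s≤s p≤d) (e ∷ monic) = (c + e) ∷ +ₚ-monicʳ p p≤d monic

+ₚ-monicˡ : ∀ {d p} q → MonicOfDegree 1ℚ d p → length q ℕ.≤ d → MonicOfDegree 1ℚ d (p +ₚ q)
+ₚ-monicˡ []      leading     _           = leading
+ₚ-monicˡ []      (c ∷ monic) _           = c ∷ monic
+ₚ-monicˡ (e ∷ q) (c ∷ monic) (ℕ.s≤s q≤d) = (c + e) ∷ +ₚ-monicˡ q monic q≤d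

1*-monic : ∀ {d q} → MonicOfDegree 1ℚ d q → MonicOfDegree 1ℚ d (map (1ℚ *_) q)
1*-monic leading     = leading
1*-monic (c ∷ monic) = (1ℚ * c) ∷ 1*-monic monic

*ₚ-monic : ∀ {m n p q} → MonicOfDegree 1ℚ m p → MonicOfDegree 1ℚ n q → MonicOfDegree 1ℚ (m ℕ.+ n) (p *ₚ q)
*ₚ-monic leading leading = leading
*ₚ-monic leading (c ∷ q) = +ₚ-monicˡ (0ℚ ∷ []) (1*-monic (c ∷ q)) (ℕ.s≤s ℕ.z≤n)
*ₚ-monic {suc m} {n} {q = q} (c ∷ monic) q-monic = +ₚ-monicʳ (map (c *_) q)
  (subst (ℕ._≤ suc (m ℕ.+ n)) (sym (trans (List.length-map (c *_) q) (length-monic q-monic))) (ℕ.s≤s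
      (ℕ.m≤n+m n m)))
  (0ℚ ∷ *ₚ-monic monic q-monic)

-- The square has degree at least 2, so adding `t` leaves its leading coefficient alone.
fₜ-monic : ∀ {e p} → MonicOfDegree 1ℚ (suc e) p → MonicOfDegree 1ℚ (suc e ℕ.+ suc e) (fₜ p)
fₜ-monic {e} monic = +ₚ-monicˡ (0ℚ ∷ 1ℚ ∷ []) (*ₚ-monic monic monic)
  (subst (2 ℕ.≤_) (cong suc (sym (ℕ.+-suc e e))) (ℕ.s≤s (ℕ.s≤s ℕ.z≤n)))

orbit-monic : ∀ {e p} → MonicOfDegree 1ℚ (suc e) p → ∀ N → MonicOfDegree 1ℚ (2 ℕ.^ N ℕ.* suc e) (fold p fₜ N)
orbit-monic {e} {p} monic zero    = subst (λ d → MonicOfDegree 1ℚ d p) (sym (ℕ.+-identityʳ (suc e))) monic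
orbit-monic {e} {p} monic (suc N) = subst (λ d → MonicOfDegree 1ℚ d (fold p fₜ (suc N))) (2^suc* N (suc e))
  (step (2 ℕ.^ N ℕ.* suc e) ⦃ ℕ.m*n≢0 (2 ℕ.^ N) (suc e) ⦃ ℕ.m^n≢0 2 N ⦄ ⦄ (orbit-monic monic N))
  where
  step : ∀ d .⦃ _ : ℕ.NonZero d ⦄ {q} → MonicOfDegree 1ℚ d q → MonicOfDegree 1ℚ (d ℕ.+ d) (fₜ q)
  step (suc d) = fₜ-monic

½^*2^ : ∀ N d → ½ ^ℚ N * fromℕ (2 ℕ.^ N ℕ.* d) ≡ fromℕ d
½^*2^ N d = trans (cong (½ ^ℚ N *_) (trans (cong fromℤ (ℤ.pos-* (2 ℕ.^ N) d)) (trans (fromℤ-* (+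
    (2 ℕ.^ N)) (+ d)) (cong (_* fromℕ d) (fromℕ-^ 2 N)))))
  (trans (sym (ℚ.*-assoc (½ ^ℚ N) (fromℕ 2 ^ℚ N) (fromℕ d)))
    (trans (cong (_* fromℕ d) (trans (sym (^-distribʳ-* ½ (fromℕ 2) N)) (1^n≡1 N))) (ℚ.*-identityˡ (fromℕ d))))

⟶-eventually : ∀ {a : ℕ → ℚ} {q} → Eventually (λ N → a N ≡ q) → (λ N → fromℚ (a N)) ⟶ fromℚ q
⟶-eventually {a} {q} (N , a≡q) ε 0<ε = N , λ n n≥ ε′ 0<ε′ → 0 , λ _ _ →
  subst (λ x → ∣ x - q ∣ ≤ ε + ε′) (sym (a≡q n n≥))
    (subst (_≤ ε + ε′) (sym (cong ∣_∣ (ℚ.+-inverseʳ q))) (0≤p+q (ℚ.<⇒≤ 0<ε) (ℚ.<⇒≤ 0<ε′)))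

≡⇒≃ : ∀ x y → (∀ n → seq x n ≡ seq y n) → x ≃ y
≡⇒≃ x y x≡y ε 0<ε = 0 , λ n _ → subst (λ a → ∣ a - seq y n ∣ ≤ ε) (sym (x≡y n))
  (subst (_≤ ε) (sym (cong ∣_∣ (ℚ.+-inverseʳ (seq y n)))) (ℚ.<⇒≤ 0<ε))

module _ {a ℓ} (ℚ̄ : AlgebraicClosureOfℚ a ℓ) where
  open FunctionField ℚ̄ hiding (IsFunctionFieldHeight)

  max0-ord-finite : ∀ x g → max0- (ord (just x) g) ≡ 0ℤ
  max0-ord-finite x g with degree g
  ... | nothing = refl
  ... | just d with multiplicity d x (map (AlgebraicClosureOfℚ.ι ℚ̄) g)
  ...   | zero  = refl
  ...   | suc _ = refl

  max0-ord-∞ : ∀ {d g} → MonicOfDegree 1ℚ d g → max0- (ord ∞ g) ≡ + d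
  max0-ord-∞ {d} {g} monic with degree g | degree-monic monic
  ... | just zero    | refl = refl
  ... | just (suc d) | refl = refl

  -- The orbit consists of polynomials, so ∞ is the only possible pole and the sum over places has
  -- one term. Eventual constancy at ∞ is assumed because for `P = 1` the sequence is constant only
  -- from index 1 on.
  functionFieldHeight : ∀ P {q} → Eventually (λ N → ½ ^ℚ N * fromℤ (max0- (ord ∞ (fold P fₜ N))) ≡ q) →
    IsFunctionFieldHeight ℚ̄ P (fromℚ q)
  functionFieldHeight P {q} stable = u , local , (∞ ∷ []) , ([] ∷ []) , outside , ≡⇒≃ (fromℚ q +ʳ 0ʳ)
      (fromℚ q) (λ _ → ℚ.+-identityʳ q)
    where
    u : ℙ¹ → ℝ
    u ∞        = fromℚ q
    u (just _) = 0ʳ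
    local : ∀ β → IsLocalHeight P β (u β)
    local ∞        = ⟶-eventually stable
    local (just x) = ⟶-eventually (0 , λ N _ →
      trans (cong (λ i → ½ ^ℚ N * fromℤ i) (max0-ord-finite x (fold P fₜ N))) (ℚ.*-zeroʳ (½ ^ℚ N)))
    outside : ∀ β → _ → u β ≃ 0ʳ
    outside ∞        ∉ = contradiction (here Pointwise.nothing) ∉
    outside (just x) _ = ≡⇒≃ 0ʳ 0ʳ (λ _ → refl)

  functionFieldHeight-monic : ∀ {e p} → MonicOfDegree 1ℚ (suc e) p →
      IsFunctionFieldHeight ℚ̄ p (fromℚ (fromℕ (suc e)))
  functionFieldHeight-monic {e} {p} monic = functionFieldHeight p (0 , λ N _ →
    trans (cong (λ i → ½ ^ℚ N * fromℤ i) (max0-ord-∞ (orbit-monic monic N))) (½^*2^ N (suc e)))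

  -- The first iterate `1 + t` has degree 1, so iterate `N + 1` has degree `2^N`, against the weight
  -- `½ ^ (N + 1)`.
  functionFieldHeight-1 : IsFunctionFieldHeight ℚ̄ (1ℚ ∷ []) (fromℚ ½)
  functionFieldHeight-1 = functionFieldHeight (1ℚ ∷ []) (1 , λ where
    (suc N) _ → trans (cong (λ i → ½ ^ℚ suc N * fromℤ i)
        (trans (cong (λ g → max0- (ord ∞ g)) (trans (cong (fold (1ℚ ∷ []) fₜ) (ℕ.+-comm 1 N)) (fold-+
            (1ℚ ∷ []) fₜ N)))
          (max0-ord-∞ (orbit-monic {0} (1ℚ ∷ leading) N))))
      (trans (ℚ.*-assoc ½ (½ ^ℚ N) (fromℕ (2 ℕ.^ N ℕ.* 1))) (cong (½ *_) (½^*2^ N 1))))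

-- The expansion of the canonical height

-- P(1/s) s^d - 1 for P monic of degree d.
lowerTerms : ∀ {d P} → MonicOfDegree 1ℤ d P → Coeffs
lowerTerms leading           = scale 0ℚ one
lowerTerms (_∷_ c {d} monic) = scale (fromℤ c) (shiftBy (suc d) one) ⊞ lowerTerms monic

lowerTerms-size : ∀ {d P} → MonicOfDegree 1ℤ d P → ℚ
lowerTerms-size leading     = 0ℚ
lowerTerms-size (c ∷ monic) = ∣ fromℤ c ∣ + lowerTerms-size monic

0≤lowerTerms-size : ∀ {d P} (monic : MonicOfDegree 1ℤ d P) → 0ℚ ≤ lowerTerms-size monic
0≤lowerTerms-size leading     = ℚ.≤-refl
0≤lowerTerms-size (c ∷ monic) = 0≤p+q (ℚ.0≤∣p∣ (fromℤ c)) (0≤lowerTerms-size monic)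

Order-lowerTerms : ∀ {d P} (monic : MonicOfDegree 1ℤ d P) → Order 1 (lowerTerms monic)
Order-lowerTerms leading           k _ = ℚ.*-zeroˡ (one k)
Order-lowerTerms (_∷_ c {d} monic) = Order-⊞ (scale (fromℤ c) (shiftBy (suc d) one)) (lowerTerms monic)
  (Order-scale (fromℤ c) (shiftBy (suc d) one) (Order-shift (shiftBy d one) Order-0)) (Order-lowerTerms monic)

-- Every lower coefficient is multiplied by a positive power of `s`, so for `R ≤ 1` one factor `R`
-- can be taken out. This makes the norm small for small `R`.
Bounded-lowerTerms : ∀ {R} → 0ℚ ≤ R → R ≤ 1ℚ → ∀ {d P} (monic : MonicOfDegree 1ℤ d P) →
  Bounded R (R * lowerTerms-size monic) (lowerTerms monic)
Bounded-lowerTerms {R} 0≤R R≤1 leading = Bounded-weaken {R} {0ℚ * 1ℚ} {R * 0ℚ} {scale 0ℚ one}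
  (ℚ.≤-reflexive (sym (ℚ.*-zeroʳ R))) (Majorant.Bounded-scale 0≤R 0ℚ one (Majorant.Bounded-one 0≤R))
Bounded-lowerTerms {R} 0≤R R≤1 (_∷_ c {d} monic) =
  Bounded-weaken {R} {∣ fromℤ c ∣ * (R ^ℚ suc d * 1ℚ) + R * lowerTerms-size monic} {R *
      (∣ fromℤ c ∣ + lowerTerms-size monic)}
    {lowerTerms (c ∷ monic)}
    (bound ∣ fromℤ c ∣ (R ^ℚ d) (lowerTerms-size monic) (ℚ.0≤∣p∣ (fromℤ c)) (subst (R ^ℚ d ≤_) (1^n≡1 d)
        (^-monoˡ-≤ d 0≤R R≤1)))
    (Bounded-⊞ (scale (fromℤ c) (shiftBy (suc d) one)) (lowerTerms monic)
      (Bounded-scale (fromℤ c) (shiftBy (suc d) one) (Bounded-shiftBy (suc d) one Bounded-one))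
      (Bounded-lowerTerms 0≤R R≤1 monic))
  where
  open Majorant 0≤R
  eq : ∀ a p C R → R * (a + C) ≡ (a * ((R * p) * 1ℚ) + R * C) + (a * R) * (1ℚ - p)
  eq = solve-∀ ring
  bound : ∀ a p C → 0ℚ ≤ a → p ≤ 1ℚ → a * ((R * p) * 1ℚ) + R * C ≤ R * (a + C)
  bound a p C 0≤a p≤1 = ≤-by (0≤p*q (0≤p*q 0≤a 0≤R) (p≤q⇒0≤q-p p≤1)) (eq a p C R)

Sums-lowerTerms : ∀ {s t} → s * t ≡ 1ℚ → ∀ {d P} (monic : MonicOfDegree 1ℤ d P) →
  Sums (lowerTerms monic) s (eval (ℤ[t]⇒ℚ[t] P) t * s ^ℚ d - 1ℚ)
Sums-lowerTerms {s} {t} st≡1 leading = subst (Sums (scale 0ℚ one) s) (eq t) (Sums-scale 0ℚ one s 1ℚ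
    (Sums-one s))
  where
  eq : ∀ t → 0ℚ * 1ℚ ≡ (1ℚ + t * 0ℚ) * 1ℚ - 1ℚ
  eq = solve-∀ ring
Sums-lowerTerms {s} {t} st≡1 (_∷_ c {d} {P} monic) = subst (Sums (lowerTerms (c ∷ monic)) s)
  (value (fromℤ c) (s ^ℚ d) (eval (ℤ[t]⇒ℚ[t] P) t) s t st≡1)
  (Sums-⊞ (scale (fromℤ c) (shiftBy (suc d) one)) (lowerTerms monic) s
    (fromℤ c * (s ^ℚ suc d * 1ℚ)) (eval (ℤ[t]⇒ℚ[t] P) t * s ^ℚ d - 1ℚ)
    (Sums-scale (fromℤ c) (shiftBy (suc d) one) s (s ^ℚ suc d * 1ℚ) (Sums-shiftBy (suc d) one s 1ℚ
        (Sums-one s)))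
    (Sums-lowerTerms st≡1 monic))
  where
  eq₁ : ∀ c p y s → c * ((s * p) * 1ℚ) + (y * p - 1ℚ) ≡ (c * (s * p) + (y * p) * 1ℚ) - 1ℚ
  eq₁ = solve-∀ ring
  eq₂ : ∀ c p y s t → (c * (s * p) + (y * p) * (s * t)) - 1ℚ ≡ (c + t * y) * (s * p) - 1ℚ
  eq₂ = solve-∀ ring
  value : ∀ c p y s t → s * t ≡ 1ℚ → c * ((s * p) * 1ℚ) + (y * p - 1ℚ) ≡ (c + t * y) * (s * p) - 1ℚ
  value c p y s t st≡1 = trans (eq₁ c p y s) (trans (cong (λ a → (c * (s * p) + (y * p) * a) - 1ℚ)
      (sym st≡1)) (eq₂ c p y s t))

-- Bounded power series at real arguments

seq-^ʳ : ∀ x m k → seq (x ^ʳ m) k ≡ seq x k ^ℚ m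
seq-^ʳ x zero    k = refl
seq-^ʳ x (suc m) k = cong (seq x k *_) (seq-^ʳ x m k)

seq-partial : ∀ F x n k → seq (∑<ʳ n (λ m → fromℚ (F m) *ʳ x ^ʳ m)) k ≡ partial F (seq x k) n
seq-partial F x zero    k = refl
seq-partial F x (suc n) k = cong₂ _+_ (seq-partial F x n k) (cong (F n *_) (seq-^ʳ x n k))

module PowerSeriesSums {R : ℚ} (0<R : 0ℚ < R) (B : ℚ) (F : Coeffs) (F≤B : Bounded R B F) where

  private
    0≤R : 0ℚ ≤ R
    0≤R = ℚ.<⇒≤ 0<R

    close : ∀ {s} → ∣ s ∣ ≤ ½ * R → ∀ {n m} → n ℕ.≤ m → ∣ partial F s n - partial F s m ∣ ≤ B * ½ ^ℚ n
    close {s} ∣s∣≤ {n} {m} n≤m = subst (_≤ B * ½ ^ℚ n)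
      (∣p-q∣≡∣q-p∣ (partial F s m) (partial F s n))
      (subst (λ m → ∣ partial F s m - partial F s n ∣ ≤ B * ½ ^ℚ n) (ℕ.m∸n+n≡m n≤m)
        (Majorant.Evaluation.partial-close 0≤R ∣s∣≤ F F≤B n (m ℕ.∸ n)))

  module _ (x : ℝ) (x-small : Eventually λ n → ∣ seq x n ∣ ≤ ½ * R) where

    private
      diagonal : ℕ → ℚ
      diagonal n = partial F (seq x n) n

      -- The index moves both the truncation and the argument. Cutting at a fixed `K` separates
      -- them: the tails are at most `B ½ ^ K` uniformly in the argument, and the remaining
      -- polynomial in `x` is a real number, hence Cauchy.
      diagonal-cauchy : Cauchy diagonal
      diagonal-cauchy ε 0<ε = use x-small (Null-* B Null-½^ (½ * (½ * ε)) (0<p*q 0<½ (0<p*q 0<½ 0<ε)))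
        where
        combine : ∀ a b c d → ∣ b - a ∣ ≤ ½ * (½ * ε) → ∣ b - c ∣ ≤ ½ * ε → ∣ c - d ∣ ≤ ½ * (½ * ε) →
            ∣ a - d ∣ ≤ ε
        combine a b c d h₁ h₂ h₃ = subst₂ _≤_ (cong ∣_∣ (eq₁ a b c d)) (eq₂ ε)
          (∣p+q∣≤ ((a - b) + (b - c)) (c - d) (∣p+q∣≤ (a - b) (b - c) (subst (_≤ ½ * (½ * ε))
              (∣p-q∣≡∣q-p∣ b a) h₁) h₂) h₃)
          where
          eq₁ : ∀ a b c d → ((a - b) + (b - c)) + (c - d) ≡ a - d
          eq₁ = solve-∀ ring
          eq₂ : ∀ ε → (½ * (½ * ε) + ½ * ε) + ½ * (½ * ε) ≡ ε
          eq₂ = solve-∀ ring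
        use : Eventually (λ n → ∣ seq x n ∣ ≤ ½ * R) → Eventually (λ n → ∣ B * ½ ^ℚ n ∣ ≤ ½ * (½ * ε)) →
          ∃[ N ] ∀ m n → N ℕ.≤ m → N ℕ.≤ n → ∣ diagonal m - diagonal n ∣ ≤ ε
        use (M , small) (K , tail) = finish (cauchy (∑<ʳ K (λ m → fromℚ (F m) *ʳ x ^ʳ m)) (½ * ε)
            (0<p*q 0<½ 0<ε))
          where
          tail-K : B * ½ ^ℚ K ≤ ½ * (½ * ε)
          tail-K = ℚ.≤-trans (p≤∣p∣ (B * ½ ^ℚ K)) (tail K ℕ.≤-refl)
          finish : ∃[ L ] (∀ m n → L ℕ.≤ m → L ℕ.≤ n →
              ∣ seq (∑<ʳ K (λ i → fromℚ (F i) *ʳ x ^ʳ i)) m - seq (∑<ʳ K (λ i → fromℚ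
                  (F i) *ʳ x ^ʳ i)) n ∣ ≤ ½ * ε) →
            ∃[ N ] ∀ m n → N ℕ.≤ m → N ℕ.≤ n → ∣ diagonal m - diagonal n ∣ ≤ ε
          finish (L , polynomial-close) = (M ℕ.⊔ K) ℕ.⊔ L , λ m n m≥ n≥ →
            combine (diagonal m) (partial F (seq x m) K) (partial F (seq x n) K) (diagonal n)
              (ℚ.≤-trans (close (small m (M≤ m≥)) (K≤ m≥)) tail-K)
              (subst₂ (λ a b → ∣ a - b ∣ ≤ ½ * ε) (seq-partial F x K m) (seq-partial F x K n)
                (polynomial-close m n (ℕ.m⊔n≤o⇒n≤o (M ℕ.⊔ K) L m≥) (ℕ.m⊔n≤o⇒n≤o (M ℕ.⊔ K) L n≥)))
              (ℚ.≤-trans (close (small n (M≤ n≥)) (K≤ n≥)) tail-K)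
            where
            M≤ : ∀ {m} → (M ℕ.⊔ K) ℕ.⊔ L ℕ.≤ m → M ℕ.≤ m
            M≤ m≥ = ℕ.m⊔n≤o⇒m≤o M K (ℕ.m⊔n≤o⇒m≤o (M ℕ.⊔ K) L m≥)
            K≤ : ∀ {m} → (M ℕ.⊔ K) ℕ.⊔ L ℕ.≤ m → K ℕ.≤ m
            K≤ m≥ = ℕ.m⊔n≤o⇒n≤o M K (ℕ.m⊔n≤o⇒m≤o (M ℕ.⊔ K) L m≥)

    powerSeriesSum : ℝ
    powerSeriesSum = mkℝ diagonal diagonal-cauchy

    isPowerSeriesSum : PowerSeriesSum F x powerSeriesSum
    isPowerSeriesSum ε 0<ε = use x-small (Null-* B Null-½^ ε 0<ε)
      where
      use : Eventually (λ n → ∣ seq x n ∣ ≤ ½ * R) → Eventually (λ n → ∣ B * ½ ^ℚ n ∣ ≤ ε) →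
        Eventually λ n → ∣ ∑<ʳ n (λ m → fromℚ (F m) *ʳ x ^ʳ m) -ʳ powerSeriesSum ∣ʳ ≤ʳ fromℚ ε
      use (M , small) (K , tail) = K , λ n n≥ ε′ 0<ε′ → M ℕ.⊔ n , λ k k≥ →
        subst (λ a → ∣ a - diagonal k ∣ ≤ ε + ε′) (sym (seq-partial F x n k))
          (ℚ.≤-trans (close (small k (ℕ.m⊔n≤o⇒m≤o M n k≥)) (ℕ.m⊔n≤o⇒n≤o M n k≥))
            (ℚ.≤-trans (p≤∣p∣ (B * ½ ^ℚ n)) (ℚ.≤-trans (tail n n≥)
              (subst (_≤ ε + ε′) (ℚ.+-identityʳ ε) (ℚ.+-monoʳ-≤ ε (ℚ.<⇒≤ 0<ε′))))))

  convergesNear0 : ConvergesNear0 F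
  -- A quarter of `R` rather than half: `≤ʳ` bounds the approximations of `x` only up to a positive
  -- slack, and a slack of `¼ R` keeps them within `½ R`.
  convergesNear0 = ½ * (½ * R) , 0<¼R , λ x ∣x∣≤ → powerSeriesSum x (small x ∣x∣≤) , isPowerSeriesSum x
      (small x ∣x∣≤)
    where
    0<¼R : 0ℚ < ½ * (½ * R)
    0<¼R = 0<p*q 0<½ (0<p*q 0<½ 0<R)
    small : ∀ x → ∣ x ∣ʳ ≤ʳ fromℚ (½ * (½ * R)) → Eventually λ n → ∣ seq x n ∣ ≤ ½ * R
    small x ∣x∣≤ with ∣x∣≤ (½ * (½ * R)) 0<¼R
    ... | N , bound = N , λ n n≥ → subst (∣ seq x n ∣ ≤_) (½-sum (½ * R)) (bound n n≥)

-- The common outcome of the cases of positive degree and of degree 0, with `q` the height over the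
-- function field. The bound yields convergence near 0, and `limit` yields the height formula.
record HeightExpansion (q : ℚ) (p : ℚ[t]) : Set where
  field
    series           : Coeffs
    radius bound     : ℚ
    0<radius         : 0ℚ < radius
    series-bounded   : Bounded radius bound series
    constant-term    : series 0 ≡ 0ℚ
    limit            : ∀ t s → ∣ s ∣ ≤ ½ * radius → s * t ≡ 1ℚ →
      (λ N n → ½ ^ℚ N * seq (h (fold (eval p t) (f t) N)) n) ⇝ (λ n → q * seq (h t) n + partial series s n)

⇝-cong : ∀ a b l → (∀ N n → a N n ≡ b N n) → a ⇝ l → b ⇝ l
⇝-cong a b l a≡b a⇝l ε 0<ε with a⇝l ε 0<ε
... | N₀ , close = N₀ , λ N N≥ → proj₁ (close N N≥) , λ n n≥ →
  subst (λ x → ∣ x - l n ∣ ≤ ε) (a≡b N n) (proj₂ (close N N≥) n n≥)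

heightExpansion : ∀ {e P} → MonicOfDegree 1ℤ (suc e) P → HeightExpansion (fromℕ (suc e)) (ℤ[t]⇒ℚ[t] P)
-- The choice `R = 1 / (8 + 2 C)` gives both `8 R ≤ 1`, for the orbit, and `R C ≤ ½`, for the
-- initial series.
heightExpansion {e} {P} monic = expansion (reciprocal (4ℚ * 2ℚ + 2ℚ * C)
    (ℚ.<-≤-trans (ℚ.<-≤-trans 0<1 (≤-by {1ℚ} {4ℚ * 2ℚ} {4ℚ + 2ℚ + 1ℚ} (0≤p+q (0≤p+q 0≤4 0≤2) 0≤1) refl))
        (LogSeries.p≤p+q (4ℚ * 2ℚ) (0≤p*q 0≤2 0≤C))))
  where
  C : ℚ
  C = lowerTerms-size monic
  0≤C : 0ℚ ≤ C
  0≤C = 0≤lowerTerms-size monic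
  U₀ : Coeffs
  U₀ = lowerTerms monic

  expansion : ∃[ R ] 0ℚ < R × (4ℚ * 2ℚ + 2ℚ * C) * R ≡ 1ℚ → HeightExpansion (fromℕ (suc e)) (ℤ[t]⇒ℚ[t] P)
  expansion (R , 0<R , total) = record
    { series        = heightSeries e U₀
    ; radius        = R
    ; bound         = 4ℚ
    ; 0<radius      = 0<R
    ; series-bounded = heightSeries-bounded
    ; constant-term = Order-heightSeries e U₀ (Order-lowerTerms monic) 0 (ℕ.s≤s ℕ.z≤n)
    ; limit         = limit
    }
    where
    0≤R : 0ℚ ≤ R
    0≤R = ℚ.<⇒≤ 0<R
    eq₁ : ∀ C R → (4ℚ * 2ℚ + 2ℚ * C) * R ≡ R * (4ℚ * 2ℚ) + (2ℚ * C) * R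
    eq₁ = solve-∀ ring
    R≤⅛ : R * (4ℚ * 2ℚ) ≤ 1ℚ
    R≤⅛ = ≤-by (0≤p*q (0≤p*q 0≤2 0≤C) 0≤R) (trans (sym total) (eq₁ C R))
    eq₂ : ∀ C R → ½ * ((4ℚ * 2ℚ + 2ℚ * C) * R) ≡ R * C + 4ℚ * R
    eq₂ = solve-∀ ring
    RC≤½ : R * C ≤ ½
    RC≤½ = ≤-by (0≤p*q 0≤4 0≤R) (trans (sym (ℚ.*-identityʳ ½)) (trans (cong (½ *_) (sym total)) (eq₂ C R)))
    open OrbitBounds 0≤R R≤⅛ e U₀ (Order-lowerTerms monic)
      (Bounded-weaken {R} {R * C} {½} {U₀} RC≤½ (Bounded-lowerTerms 0≤R (⅛≤1 0≤R R≤⅛) monic))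

    limit : ∀ t s → ∣ s ∣ ≤ ½ * R → s * t ≡ 1ℚ →
      (λ N n → ½ ^ℚ N * seq (h (fold (eval (ℤ[t]⇒ℚ[t] P) t) (f t) N)) n) ⇝
      (λ n → fromℕ (suc e) * seq (h t) n + partial (heightSeries e U₀) s n)
    limit t s ∣s∣≤ st≡1 = ⇝-respʳ (λ N n → ½ ^ℚ N * seq (h (x N)) n)
        (λ n → fromℕ (suc e) * lg (∣ t ∣ * fromℕ (↧ₙ t)) n + partial (heightSeries e U₀) s n)
        (λ n → fromℕ (suc e) * seq (h t) n + partial (heightSeries e U₀) s n)
        (Null-cong {y = λ _ → 0ℚ} (λ n → trans (cong (λ a → (fromℕ (suc e) * lg (∣ t ∣ * fromℕ
            (↧ₙ t)) n + partial (heightSeries e U₀) s n)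
            - (fromℕ (suc e) * a + partial (heightSeries e U₀) s n)) (h-lg t 1≤∣t∣ n))
          (ℚ.+-inverseʳ (fromℕ (suc e) * lg (∣ t ∣ * fromℕ (↧ₙ t)) n + partial
              (heightSeries e U₀) s n))) Null-0)
        (⇝-cong (λ N n → ½ ^ℚ N * lg (numerator (suc N)) n) (λ N n → ½ ^ℚ N * seq (h (x N)) n)
          (λ n → fromℕ (suc e) * lg (∣ t ∣ * fromℕ (↧ₙ t)) n + partial (heightSeries e U₀) s n)
          (λ N n → cong (½ ^ℚ N *_) (sym (orbit-height t e (eval (ℤ[t]⇒ℚ[t] P) t)
              (eval-numerator t monic) N (1≤∣x∣ N) n)))
          height-limit)
      where
      open OrbitValues {s} {t} {eval (ℤ[t]⇒ℚ[t] P) t} ∣s∣≤ st≡1 (Sums-lowerTerms st≡1 monic)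
      open Numerators {fromℕ (↧ₙ t)} (fromℕ-mono (ℕ.s≤s (ℕ.z≤n {ℚ.denominator-1 t})))

-- The orbit of the constant polynomial 1 is that of 1 + t, delayed by one step.
heightExpansion-1 : HeightExpansion ½ (1ℚ ∷ [])
heightExpansion-1 = record
  { series        = scale ½ E.series
  ; radius        = E.radius
  ; bound         = ∣ ½ ∣ * E.bound
  ; 0<radius      = E.0<radius
  ; series-bounded = Majorant.Bounded-scale (ℚ.<⇒≤ E.0<radius) ½ E.series E.series-bounded
  ; constant-term = trans (cong (½ *_) E.constant-term) (ℚ.*-zeroʳ ½)
  ; limit         = λ t s ∣s∣≤ st≡1 → delay t s (E.limit t s ∣s∣≤ st≡1)
  }
  where
  module E = HeightExpansion (heightExpansion (1ℤ ∷ leading))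
  eq₁ : ∀ t → (1ℚ + t * 0ℚ) * (1ℚ + t * 0ℚ) + t ≡ 1ℚ + t * (1ℚ + t * 0ℚ)
  eq₁ = solve-∀ ring
  eq₃ : ∀ p H a F → ½ * (p * H - (1ℚ * a + F)) ≡ (½ * p) * H - (½ * a + ½ * F)
  eq₃ = solve-∀ ring
  delay : ∀ t s →
    (λ N n → ½ ^ℚ N * seq (h (fold (eval (1ℚ ∷ 1ℚ ∷ []) t) (f t) N)) n) ⇝ (λ n → 1ℚ * seq
        (h t) n + partial E.series s n) →
    (λ N n → ½ ^ℚ N * seq (h (fold (eval (1ℚ ∷ []) t) (f t) N)) n) ⇝ (λ n → ½ * seq (h t) n + partial
        (scale ½ E.series) s n)
  delay t s lim ε 0<ε = delayed
    where
    halve : ∀ p H a F → ∣ p * H - (1ℚ * a + F) ∣ ≤ ε → ∣ (½ * p) * H - (½ * a + ½ * F) ∣ ≤ ε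
    halve p H a F h = subst (λ b → ∣ b ∣ ≤ ε) (eq₃ p H a F)
      (ℚ.≤-trans (∣p*q∣≤ ½ (p * H - (1ℚ * a + F)) {½} {ε} ℚ.≤-refl h)
        (subst (½ * ε ≤_) (ℚ.*-identityˡ ε) (ℚ.*-monoʳ-≤-nonNeg ε ⦃ ℚ.nonNegative (ℚ.<⇒≤ 0<ε) ⦄ ½≤1)))
    Close : ℕ → Set
    Close N = Eventually λ n → ∣ ½ ^ℚ N * seq (h (fold (eval (1ℚ ∷ 1ℚ ∷ []) t) (f t) N)) n - (1ℚ * seq
        (h t) n + partial E.series s n) ∣ ≤ ε
    Close′ : ℕ → Set
    Close′ N = Eventually λ n → ∣ ½ ^ℚ N * seq (h (fold (eval (1ℚ ∷ []) t) (f t) N)) n - (½ * seq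
        (h t) n + partial (scale ½ E.series) s n) ∣ ≤ ε
    orbit : ∀ N → fold (eval (1ℚ ∷ 1ℚ ∷ []) t) (f t) N ≡ fold (eval (1ℚ ∷ []) t) (f t) (suc N)
    orbit N = trans (cong (λ z → fold z (f t) N) (sym (eq₁ t)))
      (trans (sym (fold-+ (eval (1ℚ ∷ []) t) (f t) N)) (cong (fold (eval (1ℚ ∷ []) t) (f t)) (ℕ.+-comm N 1)))
    step : ∀ N → Close N → Close′ (suc N)
    step N (M , close) = M , λ n n≥ →
      subst₂ (λ y F → ∣ (½ * ½ ^ℚ N) * seq (h y) n - (½ * seq (h t) n + F) ∣ ≤ ε)
        (orbit N) (sym (partial-scale ½ E.series s n))
        (halve (½ ^ℚ N) (seq (h (fold (eval (1ℚ ∷ 1ℚ ∷ []) t) (f t) N)) n) (seq (h t) n)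
            (partial E.series s n) (close n n≥))
    shifted : Eventually Close → Eventually Close′
    shifted (N₀ , close) = suc N₀ , λ where (suc N) (ℕ.s≤s N≥) → step N (close N N≥)
    delayed : Eventually Close′
    delayed = shifted (lim ε 0<ε)

module Variation {q p} (E : HeightExpansion q p) where
  open HeightExpansion E
  open PowerSeriesSums 0<radius bound series series-bounded public

  threshold : ∃[ T ] 0ℚ < T × (½ * radius) * T ≡ 1ℚ
  threshold = reciprocal (½ * radius) (0<p*q 0<½ 0<radius)

  1/t-small : ∀ t s → s * t ≡ 1ℚ → proj₁ threshold < ∣ t ∣ → ∣ s ∣ ≤ ½ * radius
  1/t-small t s st≡1 T<∣t∣ = bound′ ∣ s ∣ ∣ t ∣ (½ * radius) (proj₁ threshold) (ℚ.<⇒≤ (0<p*q 0<½ 0<radius))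
      (ℚ.<-trans (proj₁ (proj₂ threshold)) T<∣t∣) (ℚ.<⇒≤ T<∣t∣)
      (trans (sym (ℚ.∣p*q∣≡∣p∣*∣q∣ s t)) (cong ∣_∣ st≡1)) (proj₂ (proj₂ threshold))
    where
    eq : ∀ s t r T → t * (r - s) ≡ (r * (t - T)) + (r * T - s * t)
    eq = solve-∀ ring
    bound′ : ∀ s t r T → 0ℚ ≤ r → 0ℚ < t → T ≤ t → s * t ≡ 1ℚ → r * T ≡ 1ℚ → s ≤ r
    bound′ s t r T 0≤r 0<t T≤t st≡1 rT≡1 = 0≤q-p⇒p≤q (*-cancel-0≤ 0<t (subst (0ℚ ≤_) (sym (eq s t r T))
      (0≤p+q (0≤p*q 0≤r (p≤q⇒0≤q-p T≤t))
        (ℚ.≤-reflexive {0ℚ} {r * T - s * t} (sym (cong₂ _-_ rT≡1 st≡1))))))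

  module At (t s : ℚ) (st≡1 : s * t ≡ 1ℚ) (T<∣t∣ : proj₁ threshold < ∣ t ∣) where

    ∣s∣≤ : Eventually λ n → ∣ seq (fromℚ s) n ∣ ≤ ½ * radius
    ∣s∣≤ = 0 , λ _ _ → 1/t-small t s st≡1 T<∣t∣

    F[s] : ℝ
    F[s] = powerSeriesSum (fromℚ s) ∣s∣≤

    -- At a constant argument the diagonal sequence of `F[s]` is `partial series s n`, so `limit` is
    -- this convergence with the reals unfolded.
    isCanonicalHeight : IsCanonicalHeight t (eval p t) ((fromℚ q *ʳ h t) +ʳ F[s])
    isCanonicalHeight ε 0<ε = use (limit t s (1/t-small t s st≡1 T<∣t∣) st≡1 ε 0<ε)
      where
      use : (Eventually λ N → Eventually λ n →
          ∣ ½ ^ℚ N * seq (h (fold (eval p t) (f t) N)) n - (q * seq (h t) n + partial series s n) ∣ ≤ ε) →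
        Eventually λ N → ∣ (fromℚ (½ ^ℚ N) *ʳ h (fold (eval p t) (f t) N)) -ʳ
            ((fromℚ q *ʳ h t) +ʳ F[s]) ∣ʳ ≤ʳ fromℚ ε
      use (N₀ , close) = N₀ , λ N N≥ ε′ 0<ε′ → proj₁ (close N N≥) , λ n n≥ →
        ℚ.≤-trans (proj₂ (close N N≥) n n≥) (subst (_≤ ε + ε′) (ℚ.+-identityʳ ε) (ℚ.+-monoʳ-≤ ε (ℚ.<⇒≤ 0<ε′)))

variation : ∀ {a ℓ} (ℚ̄ : AlgebraicClosureOfℚ a ℓ) {q p} → IsFunctionFieldHeight ℚ̄ p (fromℚ q) →
    HeightExpansion q p →
  ∃[ ĥP ] IsFunctionFieldHeight ℚ̄ p ĥP ×
  ∃[ F ] F 0 ≡ 0ℚ × ConvergesNear0 F ×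
  ∃[ T ] ∀ (t : ℚ) .⦃ _ : ℚ.NonZero t ⦄ → T < ∣ t ∣ →
    ∃[ ĥt ] IsCanonicalHeight t (eval p t) ĥt ×
    ∃[ F[1/t] ] PowerSeriesSum F (fromℚ (1/ t)) F[1/t] ×
    ĥt ≃ (ĥP *ʳ h t) +ʳ F[1/t]
variation ℚ̄ {q} {p} ffh E = fromℚ q , ffh , series , constant-term , convergesNear0 , proj₁ threshold ,
  λ t T<∣t∣ → let module A = At t (1/ t) (ℚ.*-inverseˡ t) T<∣t∣ in
    -- The right side of the formula is itself exhibited as the canonical height, so the content
    -- lies in its being the limit and the final equality is reflexivity.
    (fromℚ q *ʳ h t) +ʳ A.F[s] , A.isCanonicalHeight , A.F[s] , isPowerSeriesSum (fromℚ (1/ t)) A.∣s∣≤ ,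
    ≡⇒≃ ((fromℚ q *ʳ h t) +ʳ A.F[s]) ((fromℚ q *ʳ h t) +ʳ A.F[s]) (λ _ → refl)
  where
  open HeightExpansion E
  open Variation E

heights : ∀ {a ℓ} (ℚ̄ : AlgebraicClosureOfℚ a ℓ) P → ∃[ d ] MonicOfDegree 1ℤ d P →
  ∃[ q ] IsFunctionFieldHeight ℚ̄ (ℤ[t]⇒ℚ[t] P) (fromℚ q) × HeightExpansion q (ℤ[t]⇒ℚ[t] P)
heights ℚ̄ P (suc e , monic)  = fromℕ (suc e) , functionFieldHeight-monic ℚ̄
    (MonicOfDegree-map monic) , heightExpansion monic
heights ℚ̄ _ (zero , leading) = ½ , functionFieldHeight-1 ℚ̄ , heightExpansion-1

theorem2 : ∀ {a ℓ} (ℚ̄ : AlgebraicClosureOfℚ a ℓ) (P : List ℤ) → Monic P →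
    ∃[ ĥP ] IsFunctionFieldHeight ℚ̄ (ℤ[t]⇒ℚ[t] P) ĥP ×
    ∃[ F ] F 0 ≡ 0ℚ × ConvergesNear0 F ×
    ∃[ T ] ∀ (t : ℚ) .⦃ _ : ℚ.NonZero t ⦄ → T < ∣ t ∣ →
    ∃[ ĥt ] IsCanonicalHeight t (eval (ℤ[t]⇒ℚ[t] P) t) ĥt ×
    ∃[ F[1/t] ] PowerSeriesSum F (fromℚ (1/ t)) F[1/t] ×
    ĥt ≃ (ĥP *ʳ h t) +ʳ F[1/t]
theorem2 ℚ̄ P monic = variation ℚ̄ {q} {ℤ[t]⇒ℚ[t] P} (proj₁ (proj₂ expansion)) (proj₂ (proj₂ expansion))
  where
  expansion : ∃[ q ] IsFunctionFieldHeight ℚ̄ (ℤ[t]⇒ℚ[t] P) (fromℚ q) × HeightExpansion q (ℤ[t]⇒ℚ[t] P)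
  expansion = heights ℚ̄ P (monicOfDegree P monic)
  q : ℚ
  q = proj₁ expansion
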